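{- Let $k$ and $n$ be positive integers. For $m\in\{0,1,2\}$, we have $$(-1)^{k-1}\left(C_m(n)-\sum_{j=-k}^{k}(-1)^j\,u_m\big(n-j(3j-1)/2\big)\right)\geqslant 0.$$
   Context: Unimodal compositions. A composition of a positive integer $n$ is a sequence $(\lambda_1,\ldots,\lambda_r)$ of positive integers (parts) with sum $n$. It is unimodal if there exists $t\in\{1,\ldots,r\}$ with $\lambda_1\leqslant\cdots\leqslant\lambda_t$ and $\lambda_t\geqslant\cdots\geqslant\lambda_r$. For $n\geqslant 1$, $u_0(n)$ is the number of unimodal compositions of $n$, and $u_0(0)=0$. For $m\geqslant1$ and $n\geqslant0$, $u_m(n)$ is the number of unimodal compositions of $n+m$ in which the maximal part appears exactly $m$ times; in particular $u_m(0)=1$. Convention: $u_m(n)=0$ for $n<0$. Crank. For a partition $\lambda=(\lambda_1\geqslant\lambda_2\geqslant\cdots)$, let $\omega(\lambda)$ be the number of parts of $\lambda$ equal to $1$, and $\mu(\lambda)$ the number of parts of $\lambda$ larger than $\omega(\lambda)$. The crank is $c(\lambda)=\lambda_1$ (the largest part) if $\omega(\lambda)=0$, and $c(\lambda)=\mu(\lambda)-\omega(\lambda)$ if $\omega(\lambda)>0$. For an integer $n\geqslant 2$: $C_0(n)$ is the number of partitions $\lambda$ of $n$ with $c(\lambda)>0$; $C_1(n)$ is the number of partitions $\lambda$ of $n$ with $c(\lambda)\geqslant0$; $C_2(n)$ is the number of partitions $\lambda$ of $n$ with $c(\lambda)=0$. Moreover, by definition, $C_0(1)=1$, $C_1(1)=0$,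 $C_2(1)=-1$. -}

module Defs where

open import Data.Fin.Base using (Fin; zero; suc; toℕ)
import Data.Fin.Properties as Fin
open import Data.Integer.Base as ℤ using (ℤ; +_; -[1+_]; 0ℤ; 1ℤ; -1ℤ)
import Data.Integer.Properties as ℤ
open import Data.List.Base
  using (List; []; _∷_; length; filter; take; drop; map; foldr; upTo; concatMap)
open import Data.List.Extrema.Nat using (max)
open import Data.List.Membership.Propositional using (_∈_; find; lose)
open import Data.List.Membership.Propositional.Properties using (∈-concatMap⁺; ∈-concatMap⁻)
open import Data.List.Relation.Unary.All as All using (All; []; _∷_)
open import Data.List.Relation.Unary.AllPairs using ([]; _∷_)
open import Data.List.Relation.Unary.Any using (here; there)
open import Data.List.Relation.Unary.Linked using (Linked; linked?)
open import Data.List.Relation.Unary.Unique.Propositional using (Unique)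
import Data.List.Relation.Unary.Unique.Propositional.Properties as Unique
open import Data.Nat.Base as ℕ using (ℕ; zero; suc; z≤n; s≤s)
open import Data.Nat.ListAction using (sum)
import Data.Nat.Properties as ℕ
open import Data.Product.Base using (∃; _×_; _,_)
open import Relation.Binary.PropositionalEquality using (_≡_; refl; cong)
open import Relation.Nullary.Decidable using (_×-dec_)
open import Relation.Unary using (Pred; Decidable)

------------------------------------------------------------------------
-- Counting

#_of_ : ∀ {a p} {A : Set a} {P : Pred A p} → Decidable P → List A → ℕ
# P? of xs = length (filter P? xs)

multiplicity : ℕ → List ℕ → ℕ
multiplicity x xs = # (ℕ._≟ x) of xs

-- Parts are natural numbers, so the default value 0 only matters for [].
largestPart : List ℕ → ℕ
largestPart = max 0

------------------------------------------------------------------------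
-- Compositions

record IsComposition (n : ℕ) (λs : List ℕ) : Set where
  constructor composition
  field
    positive : All (ℕ._≥ 1) λs
    total    : sum λs ≡ n

open IsComposition

-- The compositions of n + 1 are obtained, each exactly once, from those of n
-- by prepending a part 1 or increasing the first part by 1.
grow : List ℕ → List (List ℕ)
grow []       = (1 ∷ []) ∷ []
grow (x ∷ xs) = (1 ∷ x ∷ xs) ∷ (suc x ∷ xs) ∷ []

compositions : ℕ → List (List ℕ)
compositions zero    = [] ∷ []
compositions (suc n) = concatMap grow (compositions n)

-- The list compositions n is a repetition-free enumeration of exactly the
-- compositions of n; this is compositions-sound, compositions-complete and
-- compositions-unique below.

grow-sound : ∀ {n λs μs} → IsComposition n λs → μs ∈ grow λs → IsComposition (suc n) μs
grow-sound {λs = []}    (composition p t) (here refl) = composition (s≤s z≤n ∷ p) (cong suc t)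
grow-sound {λs = _ ∷ _} (composition p t) (here refl) = composition (s≤s z≤n ∷ p) (cong suc t)
grow-sound {λs = _ ∷ _} (composition (_ ∷ p) t) (there (here refl)) =
  composition (s≤s z≤n ∷ p) (cong suc t)

compositions-sound : ∀ n {λs} → λs ∈ compositions n → IsComposition n λs
compositions-sound zero    (here refl) = composition [] refl
compositions-sound (suc n) λs∈ with find (∈-concatMap⁻ grow {xs = compositions n} λs∈)
... | μs , μs∈ , λs∈grow = grow-sound (compositions-sound n μs∈) λs∈grow

one∷∈grow : ∀ λs → 1 ∷ λs ∈ grow λs
one∷∈grow []      = here refl
one∷∈grow (_ ∷ _) = here refl

compositions-complete : ∀ n {λs} → IsComposition n λs → λs ∈ compositions n
compositions-complete zero    {[]}               _ = here refl
compositions-complete zero    {zero ∷ _}         (composition (() ∷ _) _)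
compositions-complete (suc n) {zero ∷ _}         (composition (() ∷ _) _)
compositions-complete (suc n) {suc zero ∷ λs}    (composition (_ ∷ p) t) =
  ∈-concatMap⁺ grow
    (lose (compositions-complete n (composition p (ℕ.suc-injective t))) (one∷∈grow λs))
compositions-complete (suc n) {suc (suc x) ∷ λs} (composition (_ ∷ p) t) =
  ∈-concatMap⁺ grow
    (lose (compositions-complete n (composition (s≤s z≤n ∷ p) (ℕ.suc-injective t)))
          (there (here refl)))

grow-unique : ∀ {λs} → All (ℕ._≥ 1) λs → Unique (grow λs)
grow-unique []          = [] ∷ []
grow-unique (s≤s _ ∷ _) = ((λ ()) ∷ []) ∷ [] ∷ []

grow-injective : ∀ {λs μs νs} → All (ℕ._≥ 1) λs → All (ℕ._≥ 1) μs →
                 νs ∈ grow λs → νs ∈ grow μs → λs ≡ μs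
grow-injective []          []          _                   _                   = refl
grow-injective []          (s≤s _ ∷ _) (here refl)         (there (here ()))
grow-injective (s≤s _ ∷ _) []          (here refl)         (here ())
grow-injective (s≤s _ ∷ _) []          (there (here refl)) (here ())
grow-injective (s≤s _ ∷ _) (s≤s _ ∷ _) (here refl)         (here refl)         = refl
grow-injective (s≤s _ ∷ _) (s≤s _ ∷ _) (here refl)         (there (here ()))
grow-injective (s≤s _ ∷ _) (s≤s _ ∷ _) (there (here refl)) (here ())
grow-injective (s≤s _ ∷ _) (s≤s _ ∷ _) (there (here refl)) (there (here refl)) = refl

concatMap-grow-unique : ∀ {λss} → All (All (ℕ._≥ 1)) λss → Unique λss →
                        Unique (concatMap grow λss)
concatMap-grow-unique []       []       = []
concatMap-grow-unique {_ ∷ λss} (p ∷ ps) (λs∉ ∷ u) =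
  Unique.++⁺ (grow-unique p) (concatMap-grow-unique ps u)
    λ (νs∈ , νs∈′) → let μs , μs∈ , νs∈μs = find (∈-concatMap⁻ grow {xs = λss} νs∈′) in
      All.lookup λs∉ μs∈ (grow-injective p (All.lookup ps μs∈) νs∈ νs∈μs)

compositions-unique : ∀ n → Unique (compositions n)
compositions-unique zero    = [] ∷ []
compositions-unique (suc n) =
  concatMap-grow-unique (All.tabulate λ λs∈ → positive (compositions-sound n λs∈))
                        (compositions-unique n)

------------------------------------------------------------------------
-- Unimodal compositions

-- Positions are counted from 0, so with t = toℕ i the peak λₜ₊₁ ends the
-- first segment and starts the second.
Unimodal : List ℕ → Set
Unimodal λs = ∃ λ (i : Fin (length λs)) →
  Linked ℕ._≤_ (take (suc (toℕ i)) λs) × Linked ℕ._≥_ (drop (toℕ i) λs)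

unimodal? : Decidable Unimodal
unimodal? λs = Fin.any? λ i →
  linked? ℕ._≤?_ (take (suc (toℕ i)) λs) ×-dec linked? ℕ._≥?_ (drop (toℕ i) λs)

unimodalCompositions : ℕ → List (List ℕ)
unimodalCompositions n = filter unimodal? (compositions n)

MaxAppears : ℕ → List ℕ → Set
MaxAppears m λs = multiplicity (largestPart λs) λs ≡ m

maxAppears? : ∀ m → Decidable (MaxAppears m)
maxAppears? m λs = multiplicity (largestPart λs) λs ℕ.≟ m

u : ℕ → ℤ → ℕ
u _         -[1+ _ ]  = 0
u zero      (+ zero)  = 0
u zero      (+ suc n) = length (unimodalCompositions (suc n))
u m@(suc _) (+ n)     = # maxAppears? m of unimodalCompositions (n ℕ.+ m)

------------------------------------------------------------------------
-- Partitions and the crank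

-- A partition is a composition with weakly decreasing parts.
partitions : ℕ → List (List ℕ)
partitions n = filter (linked? ℕ._≥?_) (compositions n)

ω : List ℕ → ℕ
ω λs = multiplicity 1 λs

μ : List ℕ → ℕ
μ λs = # (ℕ._>? ω λs) of λs

crank : List ℕ → ℤ
crank λs with ω λs
... | zero      = + largestPart λs
... | w@(suc _) = + μ λs ℤ.- + w

-- The index ranges over {0, 1, 2}.  Only n ≥ 1 is meaningful: the general
-- clauses are the definition for n ≥ 2, and their value at n = 0 is junk.
C : Fin 3 → ℕ → ℤ
C zero             1 = 1ℤ
C (suc zero)       1 = 0ℤ
C (suc (suc zero)) 1 = -1ℤ
C zero             n = + (# (λ λs → 0ℤ ℤ.<? crank λs) of partitions n)
C (suc zero)       n = + (# (λ λs → 0ℤ ℤ.≤? crank λs) of partitions n)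
C (suc (suc zero)) n = + (# (λ λs → crank λs ℤ.≟ 0ℤ) of partitions n)

------------------------------------------------------------------------
-- Pentagonal numbers and symmetric sums

-- The division is exact, since j(3j-1) is even.
pentagonal : ℤ → ℤ
pentagonal j = (j ℤ.* (+ 3 ℤ.* j ℤ.- 1ℤ)) ℤ./ℕ 2

-- The sum of f j over -k ≤ j ≤ k.
∑± : ℕ → (ℤ → ℤ) → ℤ
∑± k f = foldr ℤ._+_ 0ℤ (map (λ i → f (+ i ℤ.- + k)) (upTo (suc (2 ℕ.* k))))

{-# OPTIONS --safe #-}

-- Write (q)_N for (q;q)_N, F_m = Σ_w q^{w²+mw}/(q)_w² and A_m = Σ_N q^{mN}/(q)_N².
-- Peeling the smallest parts off both ends of a unimodal composition shows that
-- u_1, u_2 and u_0 have the generating functions A_1, A_2 and A_1 − A_2.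
-- Peeling off the ones and then the smallest parts of a partition shows that
-- C_1, C_2 and C_0 have the generating functions F_1, (1−q)F_2 and
-- F_1 − (1−q)F_2 in degrees n ≥ 1.  Comparing recurrences in m gives
-- (q^m;q)_∞ A_m = F_m, hence (q)_∞ U = C for each of the three pairs.
--
-- Euler's proof of the pentagonal number theorem gives the exact remainder
--   (q)_∞ − Σ_{|j|≤k} (−1)^j q^{j(3j−1)/2} = (−1)^{k+1} q^{(k+1)(3k+2)/2} V_k,
--   V_k = Σ_b q^{(k+1)b} (q^{k+1};q)_b.
-- So it remains to see that V_k U has nonnegative coefficients.  It equals
-- (V_k/(q)_∞) C, where V_k/(q)_∞ = (1/(q)_k) Σ_b q^{(k+1)b}/(q^{k+b+1};q)_∞ is
-- nonnegative, even after multiplication by 1−q because k ≥ 1; the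
-- factor 1−q is needed for C_2 = (1−q)F_2 only.

module Submission where

open import Defs
open import Algebra.Bundles using (CommutativeRing)
import Algebra.Consequences.Setoid
import Algebra.Solver.Ring
open import Algebra.Solver.Ring.AlmostCommutativeRing
  using (fromCommutativeRing; Induced-equivalence; _-Raw-AlmostCommutative⟶_)
open import Algebra.Definitions using (Identity; _DistributesOver_)
open import Algebra.Structures using (IsAbelianGroup; IsRing)
open import Data.Empty using (⊥)
open import Data.Fin.Base using (Fin; toℕ; zero; suc)
open import Data.Integer.Base as ℤ using (ℤ; +_; -[1+_]; 0ℤ; 1ℤ; -1ℤ; ∣_∣; _*_; _-_; _^_; _≥_)
import Data.Integer.Properties as ℤ
open import Data.Integer.Tactic.RingSolver using () renaming (solve-∀ to ℤ-solve-∀)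
import Data.Nat.Properties as ℕ
open import Data.List.Base
  using (List; []; _∷_; _∷ʳ_; _++_; length; filter; map; foldr; replicate; applyUpTo;
         initLast; _∷ʳ′_)
open import Data.List.Extrema ℕ.≤-totalOrder using (max≤v⁺; xs≤max; max-mono-⊆; max≈v⁺)
open import Data.List.Extrema.Nat using (v<max⁺)
open import Data.List.Membership.Propositional using (_∈_)
open import Data.List.Membership.Propositional.Properties
  using (∈-filter⁺; ∈-filter⁻; ∈-map⁺; ∈-map⁻; ∈-++⁺ˡ; ∈-++⁺ʳ; ∈-++⁻)
open import Data.List.Membership.Propositional.Properties.WithK using (unique∧set⇒bag)
open import Data.List.Properties
  using (length-++; length-map; length-filter; length-replicate; ≡-dec; ++-identityʳ; ++-cancelʳ;
         ∷-injectiveʳ; filter-++; filter-none; filter-all; filter-reject)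
open import Data.List.Relation.Binary.Subset.Propositional using (_⊆_)
open import Data.List.Relation.Binary.BagAndSetEquality using (∼bag⇒↭)
open import Data.List.Relation.Binary.Permutation.Propositional.Properties using (↭-length)
open import Data.List.Relation.Unary.All as All using (All; []; _∷_; all?)
import Data.List.Relation.Unary.All.Properties as All
open import Data.List.Relation.Unary.AllPairs using ([]; _∷_)
open import Data.List.Relation.Unary.Any as Any using (Any; here; there; any?)
open import Data.List.Relation.Unary.Linked as Linked using (Linked; []; [-]; _∷_; linked?)
open import Data.List.Relation.Unary.Unique.Propositional using (Unique)
import Data.List.Relation.Unary.Unique.Propositional.Properties as Unique
import Data.Maybe.Base as Maybe
open import Data.Nat.Base as ℕ using (ℕ; zero; suc; z≤n; s≤s)
open import Data.Nat.DivMod using (m*n/n≡m)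
open import Data.Nat.Induction using (<-rec)
open import Data.Nat.ListAction using (sum)
open import Data.Nat.ListAction.Properties using (sum-++)
open import Data.Nat.Tactic.RingSolver using () renaming (solve-∀ to ℕ-solve-∀)
open import Data.Product.Base using (∃; _×_; _,_; proj₁; proj₂)
open import Data.Unit.Base using (⊤; tt)
open import Data.Sum.Base as Sum using (_⊎_; inj₁; inj₂)
open import Function.Base using (_∘_; id; flip)
open import Function.Bundles using (mk⇔)
open import Level using (0ℓ)
open import Relation.Binary.Bundles using (Setoid)
open import Relation.Binary.Definitions using (WeaklyDecidable)
open import Relation.Binary.PropositionalEquality
  using (_≡_; refl; sym; trans; cong; cong₂; subst; module ≡-Reasoning)
import Relation.Binary.Reasoning.Setoid
open import Relation.Binary.Structures using (IsEquivalence)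
open import Relation.Nullary.Decidable using (dec⇒maybe; yes; no; _×-dec_)
open import Relation.Nullary.Negation using (¬_; contradiction)
open import Relation.Unary using (Pred; Decidable)

-- Formal power series over ℤ

-- Infinite sums occur only in the form Σ q^i H_i, which converges for every family `H` because
-- degree n sees only i ≤ n. Infinite products never occur as products: 1/(q^{a+1};q)_∞ enters as
-- Euler's series Σ q^{(a+1)i}/(q)_i and (q)_∞ as 1 - Σ q^{b+1} (q)_b, and functional equations in
-- the index do the work of the product formulas. The recurrences compared are of second order
-- because 1/(q)_N² needs two factors 1 - q^N to step down to N - 1, and each difference in m
-- supplies one of them. A solution is fixed by its behaviour for large m, so agreement modulo
-- q^{m+1} for every m is enough. For crank zero, the peeled sum matches the terms of F_2 one by one
-- when ω ≥ 1. For crank at least zero it does not, since "at least w parts" is not a single term; a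
-- summation by parts replaces it by "exactly w parts". Indices in the code start at zero: `peaks m`
-- and `durfee m` are A_{m+1} and F_{m+1}.

Series : Set
Series = ℕ → ℤ

infix 4 _≈_

-- A record rather than a bare pointwise equation, so that both series can be recovered from the
-- type of a proof.
record _≈_ (f g : Series) : Set where
  constructor coeffwise
  field
    at : ∀ n → f n ≡ g n

open _≈_

≈-refl : ∀ {f} → f ≈ f
≈-refl = coeffwise λ _ → refl

≈-sym : ∀ {f g} → f ≈ g → g ≈ f
≈-sym p = coeffwise λ n → sym (at p n)

≈-trans : ∀ {f g h} → f ≈ g → g ≈ h → f ≈ h
≈-trans p q = coeffwise λ n → trans (at p n) (at q n)

private

  +-*-interchange : ∀ a b c d e →
    (a ℤ.+ b) ℤ.* c ℤ.+ (d ℤ.+ e) ≡ a ℤ.* c ℤ.+ d ℤ.+ (b ℤ.* c ℤ.+ e)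
  +-*-interchange = ℤ-solve-∀

  *-factor : ∀ a b c d → a ℤ.* b ℤ.* c ℤ.+ a ℤ.* d ≡ a ℤ.* (b ℤ.* c ℤ.+ d)
  *-factor = ℤ-solve-∀

  *-factor-+ : ∀ a b c d e →
    a ℤ.* b ℤ.* c ℤ.+ (a ℤ.* d ℤ.+ e) ≡ a ℤ.* (b ℤ.* c ℤ.+ d) ℤ.+ e
  *-factor-+ = ℤ-solve-∀

infixl 6 _⊕_
infixl 7 _⊛_
infix  8 ⊝_

opaque

  constant : ℤ → Series
  constant c zero    = c
  constant c (suc n) = 0ℤ

  _⊕_ : Series → Series → Series
  (f ⊕ g) n = f n ℤ.+ g n

  ⊝_ : Series → Series
  (⊝ f) n = ℤ.- f n

  -- The recursion follows f = f 0 + q (f ∘ suc), so inductions on the degree have to generalise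
  -- over the left factor.
  _⊛_ : Series → Series → Series
  (f ⊛ g) zero    = f 0 ℤ.* g 0
  (f ⊛ g) (suc n) = f 0 ℤ.* g (suc n) ℤ.+ ((f ∘ suc) ⊛ g) n

  X : ℕ → Series
  X zero            = constant 1ℤ
  X (suc a) zero    = 0ℤ
  X (suc a) (suc n) = X a n

  constant-suc : ∀ c n → constant c (suc n) ≡ 0ℤ
  constant-suc c n = refl

  constant-zero : ∀ c → constant c 0 ≡ c
  constant-zero c = refl

  X0 : X 0 ≈ constant 1ℤ
  X0 = coeffwise λ _ → refl

  ⊕-coeff : ∀ f g n → (f ⊕ g) n ≡ f n ℤ.+ g n
  ⊕-coeff f g n = refl

  ⊝-coeff : ∀ f n → (⊝ f) n ≡ ℤ.- f n
  ⊝-coeff f n = refl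

  ⊕-cong : ∀ {f f′ g g′} → f ≈ f′ → g ≈ g′ → f ⊕ g ≈ f′ ⊕ g′
  ⊕-cong p q = coeffwise λ n → cong₂ ℤ._+_ (at p n) (at q n)

  ⊝-cong : ∀ {f g} → f ≈ g → ⊝ f ≈ ⊝ g
  ⊝-cong p = coeffwise λ n → cong ℤ.-_ (at p n)

  ⊛-cong : ∀ {f f′ g g′} → f ≈ f′ → g ≈ g′ → f ⊛ g ≈ f′ ⊛ g′
  ⊛-cong p q = coeffwise λ n → go (at p) (at q) n
    where
    go : ∀ {f f′ g g′} → (∀ n → f n ≡ f′ n) → (∀ n → g n ≡ g′ n) →
         ∀ n → (f ⊛ g) n ≡ (f′ ⊛ g′) n
    go p q zero    = cong₂ ℤ._*_ (p 0) (q 0)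
    go p q (suc n) = cong₂ ℤ._+_ (cong₂ ℤ._*_ (p 0) (q (suc n))) (go (p ∘ suc) q n)

  constant-⊛ : ∀ c f n → (constant c ⊛ f) n ≡ c ℤ.* f n
  constant-⊛ c f zero    = refl
  constant-⊛ c f (suc n) =
    trans (cong (ℤ._+_ (c ℤ.* f (suc n))) (zero⊛ n)) (ℤ.+-identityʳ (c ℤ.* f (suc n)))
    where
    zero⊛ : ∀ n → ((λ _ → 0ℤ) ⊛ f) n ≡ 0ℤ
    zero⊛ zero    = ℤ.*-zeroˡ (f 0)
    zero⊛ (suc n) = cong₂ ℤ._+_ (ℤ.*-zeroˡ (f (suc n))) (zero⊛ n)

  ⊛-distribʳ : ∀ h f g → (f ⊕ g) ⊛ h ≈ (f ⊛ h) ⊕ (g ⊛ h)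
  ⊛-distribʳ h f g = coeffwise (go f g)
    where
    go : ∀ f g n → ((f ⊕ g) ⊛ h) n ≡ (f ⊛ h) n ℤ.+ (g ⊛ h) n
    go f g zero    = ℤ.*-distribʳ-+ (h 0) (f 0) (g 0)
    go f g (suc n) = trans (cong (ℤ._+_ ((f 0 ℤ.+ g 0) ℤ.* h (suc n))) (go (f ∘ suc) (g ∘ suc) n))
      (+-*-interchange (f 0) (g 0) (h (suc n)) (((f ∘ suc) ⊛ h) n) (((g ∘ suc) ⊛ h) n))

  -- The mirror image of the defining recursion, splitting the right factor; commutativity follows
  -- by playing the two against each other.
  ⊛-unfoldʳ : ∀ f g n → (f ⊛ g) (suc n) ≡ (f ⊛ (g ∘ suc)) n ℤ.+ f (suc n) ℤ.* g 0
  ⊛-unfoldʳ f g zero    = refl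
  ⊛-unfoldʳ f g (suc n) =
    trans (cong (ℤ._+_ (f 0 ℤ.* g (2 ℕ.+ n))) (⊛-unfoldʳ (f ∘ suc) g n))
          (sym (ℤ.+-assoc (f 0 ℤ.* g (2 ℕ.+ n)) (((f ∘ suc) ⊛ (g ∘ suc)) n) (f (2 ℕ.+ n) ℤ.* g 0)))

  ⊛-comm : ∀ f g → f ⊛ g ≈ g ⊛ f
  ⊛-comm f g = coeffwise (go f)
    where
    go : ∀ f n → (f ⊛ g) n ≡ (g ⊛ f) n
    go f zero    = ℤ.*-comm (f 0) (g 0)
    go f (suc n) = begin
      f 0 ℤ.* g (suc n) ℤ.+ ((f ∘ suc) ⊛ g) n
        ≡⟨ cong₂ ℤ._+_ (ℤ.*-comm (f 0) (g (suc n))) (go (f ∘ suc) n) ⟩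
      g (suc n) ℤ.* f 0 ℤ.+ (g ⊛ (f ∘ suc)) n ≡⟨ ℤ.+-comm (g (suc n) ℤ.* f 0) ((g ⊛ (f ∘ suc)) n) ⟩
      (g ⊛ (f ∘ suc)) n ℤ.+ g (suc n) ℤ.* f 0 ≡⟨ ⊛-unfoldʳ g f n ⟨
      (g ⊛ f) (suc n)                         ∎
      where open ≡-Reasoning

  constant-⊛-assoc : ∀ a f g n → ((constant a ⊛ f) ⊛ g) n ≡ a ℤ.* (f ⊛ g) n
  constant-⊛-assoc a f g zero    = ℤ.*-assoc a (f 0) (g 0)
  constant-⊛-assoc a f g (suc n) = trans
    (cong (ℤ._+_ (a ℤ.* f 0 ℤ.* g (suc n)))
      (trans (at (⊛-cong tail (≈-refl {g})) n) (constant-⊛-assoc a (f ∘ suc) g n)))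
    (*-factor a (f 0) (g (suc n)) (((f ∘ suc) ⊛ g) n))
    where
    tail : (constant a ⊛ f) ∘ suc ≈ constant a ⊛ (f ∘ suc)
    tail = coeffwise λ n → trans (constant-⊛ a f (suc n)) (sym (constant-⊛ a (f ∘ suc) n))

  ⊛-assoc : ∀ f g h → (f ⊛ g) ⊛ h ≈ f ⊛ (g ⊛ h)
  ⊛-assoc f g h = coeffwise (go f)
    where
    tail : ∀ f → (f ⊛ g) ∘ suc ≈ (constant (f 0) ⊛ (g ∘ suc)) ⊕ ((f ∘ suc) ⊛ g)
    tail f = coeffwise λ n →
      cong (ℤ._+ ((f ∘ suc) ⊛ g) n) (sym (constant-⊛ (f 0) (g ∘ suc) n))

    go : ∀ f n → ((f ⊛ g) ⊛ h) n ≡ (f ⊛ (g ⊛ h)) n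
    go f zero    = ℤ.*-assoc (f 0) (g 0) (h 0)
    go f (suc n) = trans
      (cong (ℤ._+_ (f 0 ℤ.* g 0 ℤ.* h (suc n))) (begin
        (((f ⊛ g) ∘ suc) ⊛ h) n
          ≡⟨ at (⊛-cong (tail f) (≈-refl {h})) n ⟩
        (((constant (f 0) ⊛ (g ∘ suc)) ⊕ ((f ∘ suc) ⊛ g)) ⊛ h) n
          ≡⟨ at (⊛-distribʳ h (constant (f 0) ⊛ (g ∘ suc)) ((f ∘ suc) ⊛ g)) n ⟩
        ((constant (f 0) ⊛ (g ∘ suc)) ⊛ h) n ℤ.+ (((f ∘ suc) ⊛ g) ⊛ h) n
          ≡⟨ cong₂ ℤ._+_ (constant-⊛-assoc (f 0) (g ∘ suc) h n) (go (f ∘ suc) n) ⟩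
        f 0 ℤ.* ((g ∘ suc) ⊛ h) n ℤ.+ ((f ∘ suc) ⊛ (g ⊛ h)) n ∎))
      (*-factor-+ (f 0) (g 0) (h (suc n)) (((g ∘ suc) ⊛ h) n) (((f ∘ suc) ⊛ (g ⊛ h)) n))
      where open ≡-Reasoning

  ⊛-identityˡ : ∀ f → constant 1ℤ ⊛ f ≈ f
  ⊛-identityˡ f = coeffwise λ n → trans (constant-⊛ 1ℤ f n) (ℤ.*-identityˡ (f n))

  constant-⊕ : ∀ c d → constant (c ℤ.+ d) ≈ constant c ⊕ constant d
  constant-⊕ c d = coeffwise λ { zero → refl ; (suc _) → refl }

  constant-⊝ : ∀ c → constant (ℤ.- c) ≈ ⊝ constant c
  constant-⊝ c = coeffwise λ { zero → refl ; (suc _) → refl }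

  constant-* : ∀ c d → constant (c ℤ.* d) ≈ constant c ⊛ constant d
  constant-* c d = coeffwise λ
    { zero    → refl
    ; (suc n) → sym (trans (constant-⊛ c (constant d) (suc n)) (ℤ.*-zeroʳ c)) }

  X-coeff-< : ∀ a f {n} → n ℕ.< a → (X a ⊛ f) n ≡ 0ℤ
  X-coeff-< (suc a) f {zero}  _         = ℤ.*-zeroˡ (f 0)
  X-coeff-< (suc a) f {suc n} (s≤s n<a) =
    cong₂ ℤ._+_ (ℤ.*-zeroˡ (f (suc n))) (X-coeff-< a f n<a)

  X-coeff-+ : ∀ a f n → (X a ⊛ f) (a ℕ.+ n) ≡ f n
  X-coeff-+ zero    f n = trans (constant-⊛ 1ℤ f n) (ℤ.*-identityˡ (f n))
  X-coeff-+ (suc a) f n =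
    trans (cong₂ ℤ._+_ (ℤ.*-zeroˡ (f (suc (a ℕ.+ n)))) (X-coeff-+ a f n)) (ℤ.+-identityˡ (f n))

  X-+ : ∀ a b → X (a ℕ.+ b) ≈ X a ⊛ X b
  X-+ a b = coeffwise (go a)
    where
    go : ∀ a n → X (a ℕ.+ b) n ≡ (X a ⊛ X b) n
    go zero    n       = sym (at (⊛-identityˡ (X b)) n)
    go (suc a) zero    = sym (ℤ.*-zeroˡ (X b 0))
    go (suc a) (suc n) =
      sym (trans (cong₂ ℤ._+_ (ℤ.*-zeroˡ (X b (suc n))) (sym (go a n))) (ℤ.+-identityˡ (X (a ℕ.+ b) n)))

  ⊕-assoc : ∀ f g h → (f ⊕ g) ⊕ h ≈ f ⊕ (g ⊕ h)
  ⊕-assoc f g h = coeffwise λ n → ℤ.+-assoc (f n) (g n) (h n)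

  ⊕-comm : ∀ f g → f ⊕ g ≈ g ⊕ f
  ⊕-comm f g = coeffwise λ n → ℤ.+-comm (f n) (g n)

  ⊕-identityˡ : ∀ f → constant 0ℤ ⊕ f ≈ f
  ⊕-identityˡ f = coeffwise λ
    { zero → ℤ.+-identityˡ (f 0) ; (suc n) → ℤ.+-identityˡ (f (suc n)) }

  ⊝-inverseˡ : ∀ f → ⊝ f ⊕ f ≈ constant 0ℤ
  ⊝-inverseˡ f = coeffwise λ
    { zero → ℤ.+-inverseˡ (f 0) ; (suc n) → ℤ.+-inverseˡ (f (suc n)) }

infixl 6 _⊖_

_⊖_ : Series → Series → Series
f ⊖ g = f ⊕ (⊝ g)

⊖-coeff : ∀ f g n → (f ⊖ g) n ≡ f n ℤ.- g n
⊖-coeff f g n = trans (⊕-coeff f (⊝ g) n) (cong (ℤ._+_ (f n)) (⊝-coeff g n))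

-- The commutative ring of power series

≈-isEquivalence : IsEquivalence _≈_
≈-isEquivalence = record { refl = ≈-refl ; sym = ≈-sym ; trans = ≈-trans }

seriesSetoid : Setoid 0ℓ 0ℓ
seriesSetoid = record { isEquivalence = ≈-isEquivalence }

open Algebra.Consequences.Setoid seriesSetoid
  using (comm∧idˡ⇒id; comm∧invˡ⇒inv; comm∧distrʳ⇒distr)

⊕-isAbelianGroup : IsAbelianGroup _≈_ _⊕_ (constant 0ℤ) ⊝_
⊕-isAbelianGroup = record
  { isGroup = record
    { isMonoid = record
      { isSemigroup = record
        { isMagma = record { isEquivalence = ≈-isEquivalence ; ∙-cong = ⊕-cong }
        ; assoc = ⊕-assoc }
      ; identity = comm∧idˡ⇒id ⊕-comm ⊕-identityˡ }
    ; inverse = comm∧invˡ⇒inv ⊕-comm ⊝-inverseˡ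
    ; ⁻¹-cong = ⊝-cong }
  ; comm = ⊕-comm }

⊛-distrib : _DistributesOver_ _≈_ _⊛_ _⊕_
⊛-distrib = comm∧distrʳ⇒distr ⊕-cong ⊛-comm ⊛-distribʳ

⊛-identity : Identity _≈_ (constant 1ℤ) _⊛_
⊛-identity = comm∧idˡ⇒id ⊛-comm ⊛-identityˡ

⊛-⊕-isRing : IsRing _≈_ _⊕_ _⊛_ ⊝_ (constant 0ℤ) (constant 1ℤ)
⊛-⊕-isRing = record
  { +-isAbelianGroup = ⊕-isAbelianGroup
  ; *-cong = ⊛-cong
  ; *-assoc = ⊛-assoc
  ; *-identity = ⊛-identity
  ; distrib = ⊛-distrib }

seriesRing : CommutativeRing 0ℓ 0ℓ
seriesRing = record
  { Carrier = Series ; _≈_ = _≈_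
  ; _+_ = _⊕_ ; _*_ = _⊛_ ; -_ = ⊝_ ; 0# = constant 0ℤ ; 1# = constant 1ℤ
  ; isCommutativeRing = record { isRing = ⊛-⊕-isRing ; *-comm = ⊛-comm } }

module ≈-Reasoning = Relation.Binary.Reasoning.Setoid seriesSetoid

-- The solver is run with integer coefficients, because equality of series
-- is undecidable and subtraction needs a test for zero coefficients.
constantMorphism :
  ℤ.+-*-rawRing -Raw-AlmostCommutative⟶ fromCommutativeRing seriesRing
constantMorphism = record
  { ⟦_⟧ = constant ; +-homo = constant-⊕ ; *-homo = constant-* ; -‿homo = constant-⊝
  ; 0-homo = ≈-refl ; 1-homo = ≈-refl }

_constant≟_ : WeaklyDecidable (Induced-equivalence constantMorphism)
c constant≟ d = Maybe.map (λ { refl → ≈-refl }) (dec⇒maybe (c ℤ.≟ d))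

module SeriesSolver = Algebra.Solver.Ring ℤ.+-*-rawRing (fromCommutativeRing seriesRing)
  constantMorphism _constant≟_

open SeriesSolver using (solve; con; _:=_; _:+_; _:*_; _:-_; :-_)

𝟘 𝟙 : Series
𝟘 = constant 0ℤ
𝟙 = constant 1ℤ

X-cong : ∀ {a b} → a ≡ b → X a ≈ X b
X-cong refl = ≈-refl

⊛-congˡ : ∀ {f g} h → f ≈ g → h ⊛ f ≈ h ⊛ g
⊛-congˡ h p = ⊛-cong ≈-refl p

⊛-congʳ : ∀ {f g} h → f ≈ g → f ⊛ h ≈ g ⊛ h
⊛-congʳ h p = ⊛-cong p ≈-refl

⊖-cong : ∀ {f f′ g g′} → f ≈ f′ → g ≈ g′ → f ⊖ g ≈ f′ ⊖ g′
⊖-cong p q = ⊕-cong p (⊝-cong q)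

f⊖f≈𝟘 : ∀ f → f ⊖ f ≈ 𝟘
f⊖f≈𝟘 f = solve 1 (λ f → f :- f := con 0ℤ) ≈-refl f

⊖≈𝟘⇒≈ : ∀ {f g} → f ⊖ g ≈ 𝟘 → f ≈ g
⊖≈𝟘⇒≈ {f} {g} p = begin
  f           ≈⟨ solve 2 (λ f g → f := f :- g :+ g) ≈-refl f g ⟩
  f ⊖ g ⊕ g   ≈⟨ ⊕-cong p ≈-refl ⟩
  𝟘 ⊕ g       ≈⟨ ⊕-identityˡ g ⟩
  g           ∎
  where open ≈-Reasoning

-- Nonnegativity and divisibility by powers of q

Nonnegative : Series → Set
Nonnegative f = ∀ n → 0ℤ ℤ.≤ f n

nonnegative-cong : ∀ {f g} → f ≈ g → Nonnegative f → Nonnegative g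
nonnegative-cong p f≥0 n = subst (0ℤ ℤ.≤_) (at p n) (f≥0 n)

infix 4 q^_∣_

q^_∣_ : ℕ → Series → Set
q^ a ∣ f = ∃ λ g → f ≈ X a ⊛ g

∣⇒coeff≡0 : ∀ {a f n} → q^ a ∣ f → n ℕ.< a → f n ≡ 0ℤ
∣⇒coeff≡0 {a} (g , p) n<a = trans (at p _) (X-coeff-< a g n<a)

coeff≡0⇒∣ : ∀ a {f} → (∀ n → n ℕ.< a → f n ≡ 0ℤ) → q^ a ∣ f
coeff≡0⇒∣ a {f} f≡0 = (λ n → f (a ℕ.+ n)) , coeffwise go
  where
  go : ∀ n → f n ≡ (X a ⊛ (λ i → f (a ℕ.+ i))) n
  go n with n ℕ.<? a
  ... | yes n<a = trans (f≡0 n n<a) (sym (X-coeff-< a _ n<a))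
  ... | no  n≮a = subst (λ i → f i ≡ (X a ⊛ (λ i → f (a ℕ.+ i))) i)
                    (ℕ.m+[n∸m]≡n (ℕ.≮⇒≥ n≮a)) (sym (X-coeff-+ a _ (n ℕ.∸ a)))

∣-⊛ : ∀ {a f} h → q^ a ∣ f → q^ a ∣ h ⊛ f
∣-⊛ {a} h (g , p) = h ⊛ g , ≈-trans (⊛-congˡ h p)
  (solve 3 (λ x h g → h :* (x :* g) := x :* (h :* g)) ≈-refl (X a) h g)

-- Sums of q^i H_i over all i

opaque

  ∑q : (ℕ → Series) → Series
  ∑q H zero    = H 0 0
  ∑q H (suc n) = H 0 (suc n) ℤ.+ ∑q (H ∘ suc) n

  ∑q-coeff-zero : ∀ H → ∑q H 0 ≡ H 0 0
  ∑q-coeff-zero H = refl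

  ∑q-coeff-suc : ∀ H n → ∑q H (suc n) ≡ H 0 (suc n) ℤ.+ ∑q (H ∘ suc) n
  ∑q-coeff-suc H n = refl

∑q-cong : ∀ {H K} → (∀ i → H i ≈ K i) → ∑q H ≈ ∑q K
∑q-cong p = coeffwise (go p)
  where
  open ≡-Reasoning
  go : ∀ {H K} → (∀ i → H i ≈ K i) → ∀ n → ∑q H n ≡ ∑q K n
  go {H} {K} p zero = begin
    ∑q H 0   ≡⟨ ∑q-coeff-zero H ⟩
    H 0 0    ≡⟨ at (p 0) 0 ⟩
    K 0 0    ≡⟨ ∑q-coeff-zero K ⟨
    ∑q K 0   ∎
  go {H} {K} p (suc n) = begin
    ∑q H (suc n)                       ≡⟨ ∑q-coeff-suc H n ⟩
    H 0 (suc n) ℤ.+ ∑q (H ∘ suc) n     ≡⟨ cong₂ ℤ._+_ (at (p 0) (suc n)) (go (p ∘ suc) n) ⟩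
    K 0 (suc n) ℤ.+ ∑q (K ∘ suc) n     ≡⟨ ∑q-coeff-suc K n ⟨
    ∑q K (suc n)                       ∎

∑q-unfold : ∀ H → ∑q H ≈ H 0 ⊕ X 1 ⊛ ∑q (H ∘ suc)
∑q-unfold H = coeffwise λ n → trans (go n) (sym (⊕-coeff (H 0) (X 1 ⊛ ∑q (H ∘ suc)) n))
  where
  open ≡-Reasoning
  go : ∀ n → ∑q H n ≡ H 0 n ℤ.+ (X 1 ⊛ ∑q (H ∘ suc)) n
  go zero = begin
    ∑q H 0                                 ≡⟨ ∑q-coeff-zero H ⟩
    H 0 0                                  ≡⟨ ℤ.+-identityʳ (H 0 0) ⟨
    H 0 0 ℤ.+ 0ℤ
      ≡⟨ cong (ℤ._+_ (H 0 0)) (X-coeff-< 1 (∑q (H ∘ suc)) (s≤s z≤n)) ⟨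
    H 0 0 ℤ.+ (X 1 ⊛ ∑q (H ∘ suc)) 0       ∎
  go (suc n) = begin
    ∑q H (suc n)                                     ≡⟨ ∑q-coeff-suc H n ⟩
    H 0 (suc n) ℤ.+ ∑q (H ∘ suc) n
      ≡⟨ cong (ℤ._+_ (H 0 (suc n))) (X-coeff-+ 1 (∑q (H ∘ suc)) n) ⟨
    H 0 (suc n) ℤ.+ (X 1 ⊛ ∑q (H ∘ suc)) (suc n)     ∎

private

  X1-⊛-coeff-cong : ∀ {f g} n → (∀ {i} → i ℕ.< n → f i ≡ g i) → (X 1 ⊛ f) n ≡ (X 1 ⊛ g) n
  X1-⊛-coeff-cong {f} {g} zero    p =
    trans (X-coeff-< 1 f (s≤s z≤n)) (sym (X-coeff-< 1 g (s≤s z≤n)))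
  X1-⊛-coeff-cong {f} {g} (suc n) p =
    trans (X-coeff-+ 1 f n) (trans (p ℕ.≤-refl) (sym (X-coeff-+ 1 g n)))

-- The factor q makes coefficient n depend only on smaller coefficients at the next state, so strong
-- induction on n applies. The state is a family of series, or a pair of families, and `next` drops
-- its first member.
unfold-unique : ∀ {A : Set} (next : A → A) (H S T : A → Series) →
                (∀ a → S a ≈ H a ⊕ X 1 ⊛ S (next a)) → (∀ a → T a ≈ H a ⊕ X 1 ⊛ T (next a)) →
                ∀ a → S a ≈ T a
unfold-unique next H S T S-step T-step a = coeffwise λ n → <-rec _ go n a
  where
  open ≡-Reasoning
  go : ∀ n → (∀ {i} → i ℕ.< n → ∀ a → S a i ≡ T a i) → ∀ a → S a n ≡ T a n
  go n below a = begin
    S a n                                   ≡⟨ at (S-step a) n ⟩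
    (H a ⊕ X 1 ⊛ S (next a)) n              ≡⟨ ⊕-coeff (H a) (X 1 ⊛ S (next a)) n ⟩
    H a n ℤ.+ (X 1 ⊛ S (next a)) n
      ≡⟨ cong (ℤ._+_ (H a n)) (X1-⊛-coeff-cong n (λ i<n → below i<n (next a))) ⟩
    H a n ℤ.+ (X 1 ⊛ T (next a)) n          ≡⟨ ⊕-coeff (H a) (X 1 ⊛ T (next a)) n ⟨
    (H a ⊕ X 1 ⊛ T (next a)) n              ≡⟨ at (T-step a) n ⟨
    T a n                                   ∎

∑q-⊛ : ∀ c H → c ⊛ ∑q H ≈ ∑q (λ i → c ⊛ H i)
∑q-⊛ c = unfold-unique (_∘ suc) (λ H → c ⊛ H 0) (λ H → c ⊛ ∑q H) (λ H → ∑q (λ i → c ⊛ H i))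
  (λ H → ≈-trans (⊛-congˡ c (∑q-unfold H))
    (solve 4 (λ c h x s → c :* (h :+ x :* s) := c :* h :+ x :* (c :* s)) ≈-refl
      c (H 0) (X 1) (∑q (H ∘ suc))))
  (λ H → ∑q-unfold (λ i → c ⊛ H i))

∑q-⊖ : ∀ H K → ∑q (λ i → H i ⊖ K i) ≈ ∑q H ⊖ ∑q K
∑q-⊖ H K = unfold-unique (λ (H , K) → H ∘ suc , K ∘ suc) (λ (H , K) → H 0 ⊖ K 0)
  (λ (H , K) → ∑q (λ i → H i ⊖ K i)) (λ (H , K) → ∑q H ⊖ ∑q K)
  (λ (H , K) → ∑q-unfold (λ i → H i ⊖ K i))
  (λ (H , K) → ≈-trans (⊖-cong (∑q-unfold H) (∑q-unfold K))
    (solve 5 (λ h k x s t → (h :+ x :* s) :- (k :+ x :* t) := h :- k :+ x :* (s :- t)) ≈-refl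
      (H 0) (K 0) (X 1) (∑q (H ∘ suc)) (∑q (K ∘ suc))))
  (H , K)

opaque
  unfolding _⊕_ X ∑q

  X-nonnegative : ∀ a → Nonnegative (X a)
  X-nonnegative zero    zero    = ℤ.+≤+ z≤n
  X-nonnegative zero    (suc n) = ℤ.≤-refl
  X-nonnegative (suc a) zero    = ℤ.≤-refl
  X-nonnegative (suc a) (suc n) = X-nonnegative a n

  ⊕-nonnegative : ∀ {f g} → Nonnegative f → Nonnegative g → Nonnegative (f ⊕ g)
  ⊕-nonnegative f≥0 g≥0 n = ℤ.+-mono-≤ (f≥0 n) (g≥0 n)

  ⊛-nonnegative : ∀ {f g} → Nonnegative f → Nonnegative g → Nonnegative (f ⊛ g)
  ⊛-nonnegative {f} {g} f≥0 g≥0 n = go f f≥0 n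
    where
    *-nonnegative : ∀ {i j} → 0ℤ ℤ.≤ i → 0ℤ ℤ.≤ j → 0ℤ ℤ.≤ i ℤ.* j
    *-nonnegative {+ m} {+ n} _ _ = subst (0ℤ ℤ.≤_) (ℤ.pos-* m n) (ℤ.+≤+ z≤n)
    go : ∀ f → Nonnegative f → ∀ n → 0ℤ ℤ.≤ (f ⊛ g) n
    go f f≥0 zero    = *-nonnegative (f≥0 0) (g≥0 0)
    go f f≥0 (suc n) =
      ℤ.+-mono-≤ (*-nonnegative (f≥0 0) (g≥0 (suc n))) (go (f ∘ suc) (f≥0 ∘ suc) n)

  ∑q-nonnegative : ∀ {H} → (∀ i → Nonnegative (H i)) → Nonnegative (∑q H)
  ∑q-nonnegative H≥0 zero    = H≥0 0 0
  ∑q-nonnegative H≥0 (suc n) = ℤ.+-mono-≤ (H≥0 0 (suc n)) (∑q-nonnegative (H≥0 ∘ suc) n)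

-- Divisibility of `b w` by q^w kills the remainder in the limit. The induction reads `b w` in
-- degree w + n, where the factor q^w has been divided out.
telescope : ∀ (b H : ℕ → Series) → (∀ w → b w ≈ X w ⊛ H w ⊕ b (suc w)) → (∀ w → q^ w ∣ b w) →
            b 0 ≈ ∑q H
telescope b H step small = coeffwise λ n → trans (go n 0)
  (at (∑q-cong λ i → coeffwise λ n → cong (λ j → H j n) (ℕ.+-identityʳ i)) n)
  where
  open ≡-Reasoning
  coeff : ∀ w n → b w (w ℕ.+ n) ≡ H w n ℤ.+ b (suc w) (w ℕ.+ n)
  coeff w n = begin
    b w (w ℕ.+ n)                                 ≡⟨ at (step w) (w ℕ.+ n) ⟩
    (X w ⊛ H w ⊕ b (suc w)) (w ℕ.+ n)             ≡⟨ ⊕-coeff (X w ⊛ H w) (b (suc w)) (w ℕ.+ n) ⟩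
    (X w ⊛ H w) (w ℕ.+ n) ℤ.+ b (suc w) (w ℕ.+ n)
      ≡⟨ cong (ℤ._+ b (suc w) (w ℕ.+ n)) (X-coeff-+ w (H w) n) ⟩
    H w n ℤ.+ b (suc w) (w ℕ.+ n)                 ∎
  go : ∀ n w → b w (w ℕ.+ n) ≡ ∑q (λ i → H (i ℕ.+ w)) n
  go zero w = begin
    b w (w ℕ.+ 0)                    ≡⟨ coeff w 0 ⟩
    H w 0 ℤ.+ b (suc w) (w ℕ.+ 0)
      ≡⟨ cong (ℤ._+_ (H w 0)) (∣⇒coeff≡0 (small (suc w)) (s≤s (ℕ.≤-reflexive (ℕ.+-identityʳ w)))) ⟩
    H w 0 ℤ.+ 0ℤ                     ≡⟨ ℤ.+-identityʳ (H w 0) ⟩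
    H w 0                            ≡⟨ ∑q-coeff-zero (λ i → H (i ℕ.+ w)) ⟨
    ∑q (λ i → H (i ℕ.+ w)) 0         ∎
  go (suc n) w = begin
    b w (w ℕ.+ suc n)                                      ≡⟨ coeff w (suc n) ⟩
    H w (suc n) ℤ.+ b (suc w) (w ℕ.+ suc n)
      ≡⟨ cong (λ i → H w (suc n) ℤ.+ b (suc w) i) (ℕ.+-suc w n) ⟩
    H w (suc n) ℤ.+ b (suc w) (suc w ℕ.+ n)
      ≡⟨ cong (ℤ._+_ (H w (suc n))) (go n (suc w)) ⟩
    H w (suc n) ℤ.+ ∑q (λ i → H (i ℕ.+ suc w)) n
      ≡⟨ cong (ℤ._+_ (H w (suc n))) (at (∑q-cong λ i → coeffwise λ n → cong (λ j → H j n) (ℕ.+-suc i w)) n) ⟩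
    H w (suc n) ℤ.+ ∑q (λ i → H (suc (i ℕ.+ w))) n         ≡⟨ ∑q-coeff-suc (λ i → H (i ℕ.+ w)) n ⟨
    ∑q (λ i → H (i ℕ.+ w)) (suc n)                         ∎

-- Coefficient by coefficient, D has vanishing second differences in m and
-- is zero for large m.
recurrence-unique : ∀ (D : ℕ → Series) →
                    (∀ m → D m ⊖ D (suc m) ⊖ D (suc m) ⊕ D (2 ℕ.+ m) ≈ X (suc m) ⊛ D m) →
                    (∀ m → q^ suc m ∣ D m) → ∀ m → D m ≈ 𝟘
recurrence-unique D step small m = coeffwise λ n →
  trans (<-rec (λ n → ∀ m → D m n ≡ 0ℤ) vanish n m) (sym (zero-coeff n))
  where
  zero-coeff : ∀ n → 𝟘 n ≡ 0ℤ
  zero-coeff n = trans (sym (at (f⊖f≈𝟘 𝟘) n)) (trans (⊖-coeff 𝟘 𝟘 n) (ℤ.+-inverseʳ (𝟘 n)))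

  vanish : ∀ n → (∀ {i} → i ℕ.< n → ∀ m → D m i ≡ 0ℤ) → ∀ m → D m n ≡ 0ℤ
  vanish n below m = descend n m (ℕ.m≤m+n n m)
    where
    -- Multiplication by q^{m+1} refers degree n back to a strictly smaller degree, which the outer
    -- induction covers.
    rhs≡0 : ∀ m → (X (suc m) ⊛ D m) n ≡ 0ℤ
    rhs≡0 m with n ℕ.<? suc m
    ... | yes n<1+m = X-coeff-< (suc m) (D m) n<1+m
    ... | no  n≮1+m = subst (λ i → (X (suc m) ⊛ D m) i ≡ 0ℤ) (ℕ.m+[n∸m]≡n 1+m≤n)
        (trans (X-coeff-+ (suc m) (D m) (n ℕ.∸ suc m))
               (below (ℕ.∸-monoʳ-< {n} {suc m} {0} (s≤s z≤n) 1+m≤n) m))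
      where 1+m≤n = ℕ.≮⇒≥ n≮1+m

    lhs : ∀ m → D m n ℤ.- D (suc m) n ℤ.- D (suc m) n ℤ.+ D (2 ℕ.+ m) n ≡ 0ℤ
    lhs m = begin
      D m n ℤ.- D (suc m) n ℤ.- D (suc m) n ℤ.+ D (2 ℕ.+ m) n
        ≡⟨ cong (λ i → i ℤ.- D (suc m) n ℤ.+ D (2 ℕ.+ m) n) (⊖-coeff (D m) (D (suc m)) n) ⟨
      (D m ⊖ D (suc m)) n ℤ.- D (suc m) n ℤ.+ D (2 ℕ.+ m) n
        ≡⟨ cong (ℤ._+ D (2 ℕ.+ m) n) (⊖-coeff (D m ⊖ D (suc m)) (D (suc m)) n) ⟨
      (D m ⊖ D (suc m) ⊖ D (suc m)) n ℤ.+ D (2 ℕ.+ m) n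
        ≡⟨ ⊕-coeff (D m ⊖ D (suc m) ⊖ D (suc m)) (D (2 ℕ.+ m)) n ⟨
      (D m ⊖ D (suc m) ⊖ D (suc m) ⊕ D (2 ℕ.+ m)) n
        ≡⟨ at (step m) n ⟩
      (X (suc m) ⊛ D m) n
        ≡⟨ rhs≡0 m ⟩
      0ℤ ∎
      where open ≡-Reasoning

    head≡0 : ∀ {a b c} → a ℤ.- b ℤ.- b ℤ.+ c ≡ 0ℤ → b ≡ 0ℤ → c ≡ 0ℤ → a ≡ 0ℤ
    head≡0 {a} p refl refl = trans (a-0 a) p
      where
      a-0 : ∀ a → a ≡ a ℤ.- 0ℤ ℤ.- 0ℤ ℤ.+ 0ℤ
      a-0 = ℤ-solve-∀

    -- The inner induction runs downwards in m: divisibility settles m ≥ n, and a vanishing second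
    -- difference carries zeros from m + 1 and m + 2 to m.
    descend : ∀ k m → n ℕ.≤ k ℕ.+ m → D m n ≡ 0ℤ
    descend zero    m n≤m   = ∣⇒coeff≡0 (small m) (s≤s n≤m)
    descend (suc k) m n≤k+m = head≡0 (lhs m) (descend k (suc m) n≤)
        (descend k (2 ℕ.+ m) (ℕ.≤-trans n≤ (ℕ.+-monoʳ-≤ k (ℕ.n≤1+n (suc m)))))
      where n≤ = ℕ.≤-trans n≤k+m (ℕ.≤-reflexive (sym (ℕ.+-suc k m)))

-- q-series

-- dilate L m is the sum of q^{(m+1)i} L i.
dilate : (ℕ → Series) → ℕ → Series
dilate L m = ∑q (λ i → X (m ℕ.* i) ⊛ L i)

X-*-suc : ∀ m i → X (m ℕ.* suc i) ≈ X m ⊛ X (m ℕ.* i)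
X-*-suc m i = ≈-trans (X-cong (ℕ.*-suc m i)) (X-+ m (m ℕ.* i))

dilate-cong : ∀ {L M} m → (∀ i → L i ≈ M i) → dilate L m ≈ dilate M m
dilate-cong m p = ∑q-cong λ i → ⊛-congˡ (X (m ℕ.* i)) (p i)

dilate-unfold : ∀ L m → dilate L m ≈ L 0 ⊕ X (suc m) ⊛ dilate (L ∘ suc) m
dilate-unfold L m = begin
  dilate L m
    ≈⟨ ∑q-unfold _ ⟩
  X (m ℕ.* 0) ⊛ L 0 ⊕ X 1 ⊛ ∑q (λ i → X (m ℕ.* suc i) ⊛ L (suc i))
    ≈⟨ ⊕-cong (⊛-congʳ (L 0) (≈-trans (X-cong (ℕ.*-zeroʳ m)) X0)) (⊛-congˡ (X 1) (≈-trans
         (∑q-cong λ i → ≈-trans (⊛-congʳ (L (suc i)) (X-*-suc m i)) (⊛-assoc (X m) _ _))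
         (≈-sym (∑q-⊛ (X m) _)))) ⟩
  𝟙 ⊛ L 0 ⊕ X 1 ⊛ (X m ⊛ dilate (L ∘ suc) m)
    ≈⟨ ⊕-cong (⊛-identityˡ (L 0)) (≈-sym (⊛-assoc (X 1) (X m) _)) ⟩
  L 0 ⊕ X 1 ⊛ X m ⊛ dilate (L ∘ suc) m
    ≈⟨ ⊕-cong ≈-refl (⊛-congʳ _ (X-+ 1 m)) ⟨
  L 0 ⊕ X (suc m) ⊛ dilate (L ∘ suc) m ∎
  where open ≈-Reasoning

-- Raising m by one multiplies term i by q^i, so the difference puts 1 - q^i on that term. The term
-- i = 0 disappears and the index shifts.
dilate-Δ : ∀ L m → dilate L m ⊖ dilate L (suc m) ≈
           X (suc m) ⊛ dilate (λ i → (𝟙 ⊖ X (suc i)) ⊛ L (suc i)) m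
dilate-Δ L m = begin
  dilate L m ⊖ dilate L (suc m)
    ≈⟨ ∑q-⊖ _ _ ⟨
  ∑q (λ i → X (m ℕ.* i) ⊛ L i ⊖ X (i ℕ.+ m ℕ.* i) ⊛ L i)
    ≈⟨ (∑q-cong λ i → ≈-trans (⊖-cong ≈-refl (⊛-congʳ (L i) (X-+ i (m ℕ.* i))))
         (solve 3 (λ x y l → y :* l :- x :* y :* l := y :* ((con 1ℤ :- x) :* l)) ≈-refl
           (X i) (X (m ℕ.* i)) (L i))) ⟩
  dilate (λ i → (𝟙 ⊖ X i) ⊛ L i) m
    ≈⟨ dilate-unfold _ m ⟩
  (𝟙 ⊖ X 0) ⊛ L 0 ⊕ s
    ≈⟨ ⊕-cong (⊛-congʳ (L 0) (⊖-cong ≈-refl X0)) ≈-refl ⟩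
  (𝟙 ⊖ 𝟙) ⊛ L 0 ⊕ s
    ≈⟨ solve 2 (λ l s → (con 1ℤ :- con 1ℤ) :* l :+ s := s) ≈-refl (L 0) s ⟩
  s ∎
  where
  open ≈-Reasoning
  s = X (suc m) ⊛ dilate (λ i → (𝟙 ⊖ X (suc i)) ⊛ L (suc i)) m

-- The first difference is left unshifted, so that both factors 1 - q^i meet the same term and the
-- index shifts only once.
dilate-Δ² : ∀ L m → dilate L m ⊖ dilate L (suc m) ⊖ dilate L (suc m) ⊕ dilate L (2 ℕ.+ m) ≈
            X (suc m) ⊛ dilate (λ i → (𝟙 ⊖ X (suc i)) ⊛ ((𝟙 ⊖ X (suc i)) ⊛ L (suc i))) m
dilate-Δ² L m = begin
  l m ⊖ l (suc m) ⊖ l (suc m) ⊕ l (2 ℕ.+ m)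
    ≈⟨ solve 3 (λ a b c → a :- b :- b :+ c := (a :- b) :- (b :- c)) ≈-refl
         (l m) (l (suc m)) (l (2 ℕ.+ m)) ⟩
  (l m ⊖ l (suc m)) ⊖ (l (suc m) ⊖ l (2 ℕ.+ m))
    ≈⟨ ⊖-cong (Δ m) (Δ (suc m)) ⟩
  dilate M m ⊖ dilate M (suc m)
    ≈⟨ dilate-Δ M m ⟩
  X (suc m) ⊛ dilate (λ i → (𝟙 ⊖ X (suc i)) ⊛ M (suc i)) m ∎
  where
  open ≈-Reasoning
  l = dilate L
  M : ℕ → Series
  M i = (𝟙 ⊖ X i) ⊛ L i
  Δ : ∀ m → l m ⊖ l (suc m) ≈ dilate M m
  Δ m = ≈-trans (≈-sym (∑q-⊖ _ _)) (∑q-cong λ i →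
    ≈-trans (⊖-cong ≈-refl (⊛-congʳ (L i) (X-+ i (m ℕ.* i))))
         (solve 3 (λ x y l → y :* l :- x :* y :* l := y :* ((con 1ℤ :- x) :* l)) ≈-refl
           (X i) (X (m ℕ.* i)) (L i)))

-- geometric a is 1/(1 - q^{a+1}).
geometric : ℕ → Series
geometric = dilate (λ _ → 𝟙)

geometric-inverse : ∀ a → (𝟙 ⊖ X (suc a)) ⊛ geometric a ≈ 𝟙
geometric-inverse a = begin
  (𝟙 ⊖ X (suc a)) ⊛ g
    ≈⟨ solve 2 (λ x g → (con 1ℤ :- x) :* g := g :- x :* g) ≈-refl (X (suc a)) g ⟩
  g ⊖ X (suc a) ⊛ g           ≈⟨ ⊖-cong (dilate-unfold (λ _ → 𝟙) a) ≈-refl ⟩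
  𝟙 ⊕ X (suc a) ⊛ g ⊖ X (suc a) ⊛ g
    ≈⟨ solve 1 (λ y → con 1ℤ :+ y :- y := con 1ℤ) ≈-refl (X (suc a) ⊛ g) ⟩
  𝟙 ∎
  where
  open ≈-Reasoning
  g = geometric a

-- Solves the equation left by a peeling step: a class whose members either belong to g or arise
-- from a smaller member by adding a part a + 1.
geometric-unique : ∀ a {f g} → f ≈ X (suc a) ⊛ f ⊕ g → f ≈ geometric a ⊛ g
geometric-unique a {f} {g} p = begin
  f                                          ≈⟨ ⊛-identityˡ f ⟨
  𝟙 ⊛ f                                      ≈⟨ ⊛-congʳ f (geometric-inverse a) ⟨
  (𝟙 ⊖ X (suc a)) ⊛ geometric a ⊛ f
    ≈⟨ solve 3 (λ x h f → (con 1ℤ :- x) :* h :* f := h :* (f :- x :* f)) ≈-refl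
         (X (suc a)) (geometric a) f ⟩
  geometric a ⊛ (f ⊖ X (suc a) ⊛ f)          ≈⟨ ⊛-congˡ (geometric a) (⊖-cong p ≈-refl) ⟩
  geometric a ⊛ (X (suc a) ⊛ f ⊕ g ⊖ X (suc a) ⊛ f)
    ≈⟨ ⊛-congˡ (geometric a) (solve 2 (λ y g → y :+ g :- y := g) ≈-refl (X (suc a) ⊛ f) g) ⟩
  geometric a ⊛ g                            ∎
  where open ≈-Reasoning

-- invPoch n is 1/(q;q)_n.
invPoch : ℕ → Series
invPoch zero    = 𝟙
invPoch (suc n) = invPoch n ⊛ geometric n

invPoch-suc : ∀ n → (𝟙 ⊖ X (suc n)) ⊛ invPoch (suc n) ≈ invPoch n
invPoch-suc n = begin
  (𝟙 ⊖ X (suc n)) ⊛ (invPoch n ⊛ geometric n)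
    ≈⟨ solve 3 (λ x i g → (con 1ℤ :- x) :* (i :* g) := (con 1ℤ :- x) :* g :* i) ≈-refl
         (X (suc n)) (invPoch n) (geometric n) ⟩
  (𝟙 ⊖ X (suc n)) ⊛ geometric n ⊛ invPoch n   ≈⟨ ⊛-congʳ (invPoch n) (geometric-inverse n) ⟩
  𝟙 ⊛ invPoch n                               ≈⟨ ⊛-identityˡ (invPoch n) ⟩
  invPoch n                                   ∎
  where open ≈-Reasoning

invPoch² : ℕ → Series
invPoch² n = invPoch n ⊛ invPoch n

invPoch²-suc : ∀ n → (𝟙 ⊖ X (suc n)) ⊛ ((𝟙 ⊖ X (suc n)) ⊛ invPoch² (suc n)) ≈ invPoch² n
invPoch²-suc n = ≈-trans
  (solve 2 (λ x i → (con 1ℤ :- x) :* ((con 1ℤ :- x) :* (i :* i)) := ((con 1ℤ :- x) :* i) :* ((con 1ℤ :- x) :* i))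
    ≈-refl (X (suc n)) (invPoch (suc n)))
  (⊛-cong (invPoch-suc n) (invPoch-suc n))

-- invPoch∞ a is 1/(q^{a+1};q)_∞, by Euler's expansion.
invPoch∞ : ℕ → Series
invPoch∞ = dilate invPoch

-- Multiplying 1/(q)_{i+1} by 1 - q^{i+1} gives 1/(q)_i, so the difference of the series at a and a
-- + 1 is q^{a+1} times the series at a. This is the functional equation of the product
-- 1/(q^{a+1};q)_∞.
invPoch∞-suc : ∀ a → (𝟙 ⊖ X (suc a)) ⊛ invPoch∞ a ≈ invPoch∞ (suc a)
invPoch∞-suc a = begin
  (𝟙 ⊖ X (suc a)) ⊛ invPoch∞ a
    ≈⟨ solve 3 (λ x e f → (con 1ℤ :- x) :* e := e :- f :- x :* e :+ f) ≈-refl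
         (X (suc a)) (invPoch∞ a) (invPoch∞ (suc a)) ⟩
  invPoch∞ a ⊖ invPoch∞ (suc a) ⊖ X (suc a) ⊛ invPoch∞ a ⊕ invPoch∞ (suc a)
    ≈⟨ ⊕-cong (⊖-cong (≈-trans (dilate-Δ invPoch a)
         (⊛-congˡ (X (suc a)) (dilate-cong a invPoch-suc))) ≈-refl) ≈-refl ⟩
  X (suc a) ⊛ invPoch∞ a ⊖ X (suc a) ⊛ invPoch∞ a ⊕ invPoch∞ (suc a)
    ≈⟨ solve 2 (λ y f → y :- y :+ f := f) ≈-refl (X (suc a) ⊛ invPoch∞ a) (invPoch∞ (suc a)) ⟩
  invPoch∞ (suc a) ∎
  where open ≈-Reasoning

-- peaks m is the sum of q^{(m+1)N}/(q;q)_N² over N.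
peaks : ℕ → Series
peaks = dilate invPoch²

-- The two factors 1 - q^{i+1} cancel the last factors of the squared denominator, and the shifted
-- sum is the original one.
peaks-Δ² : ∀ m → peaks m ⊖ peaks (suc m) ⊖ peaks (suc m) ⊕ peaks (2 ℕ.+ m) ≈ X (suc m) ⊛ peaks m
peaks-Δ² m = ≈-trans (dilate-Δ² invPoch² m) (⊛-congˡ (X (suc m)) (dilate-cong m invPoch²-suc))

durfeeTerm : ℕ → Series
durfeeTerm w = X (w ℕ.* w) ⊛ invPoch² w

-- durfee m is the sum of q^{w²+(m+1)w}/(q;q)_w² over w.
durfee : ℕ → Series
durfee = dilate durfeeTerm

X-suc² : ∀ w → X (suc w ℕ.* suc w) ≈ X 1 ⊛ (X w ⊛ (X w ⊛ X (w ℕ.* w)))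
X-suc² w = begin
  X (1 ℕ.+ (w ℕ.+ w ℕ.* suc w))              ≈⟨ X-+ 1 (w ℕ.+ w ℕ.* suc w) ⟩
  X 1 ⊛ X (w ℕ.+ w ℕ.* suc w)                ≈⟨ ⊛-congˡ (X 1) (X-+ w (w ℕ.* suc w)) ⟩
  X 1 ⊛ (X w ⊛ X (w ℕ.* suc w))              ≈⟨ ⊛-congˡ (X 1) (⊛-congˡ (X w) (X-*-suc w w)) ⟩
  X 1 ⊛ (X w ⊛ (X w ⊛ X (w ℕ.* w)))          ∎
  where open ≈-Reasoning

-- As for `peaks`, but (w+1)² = w² + 2w + 1 leaves a surplus q^{2w+1}, which moves the sum from m to
-- m + 2.
durfee-Δ² : ∀ m → durfee m ⊖ durfee (suc m) ⊖ durfee (suc m) ⊕ durfee (2 ℕ.+ m) ≈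
            X (2 ℕ.+ m) ⊛ durfee (2 ℕ.+ m)
durfee-Δ² m = begin
  durfee m ⊖ durfee (suc m) ⊖ durfee (suc m) ⊕ durfee (2 ℕ.+ m)
    ≈⟨ dilate-Δ² durfeeTerm m ⟩
  X (suc m) ⊛ ∑q (λ w → X (m ℕ.* w) ⊛ ((𝟙 ⊖ X (suc w)) ⊛ ((𝟙 ⊖ X (suc w)) ⊛ durfeeTerm (suc w))))
    ≈⟨ ⊛-congˡ (X (suc m)) (∑q-cong term) ⟩
  X (suc m) ⊛ ∑q (λ w → X 1 ⊛ (X ((2 ℕ.+ m) ℕ.* w) ⊛ durfeeTerm w))
    ≈⟨ ⊛-congˡ (X (suc m)) (∑q-⊛ (X 1) _) ⟨
  X (suc m) ⊛ (X 1 ⊛ durfee (2 ℕ.+ m))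
    ≈⟨ solve 3 (λ x y d → x :* (y :* d) := y :* x :* d) ≈-refl
         (X (suc m)) (X 1) (durfee (2 ℕ.+ m)) ⟩
  X 1 ⊛ X (suc m) ⊛ durfee (2 ℕ.+ m)
    ≈⟨ ⊛-congʳ (durfee (2 ℕ.+ m)) (X-+ 1 (suc m)) ⟨
  X (2 ℕ.+ m) ⊛ durfee (2 ℕ.+ m) ∎
  where
  open ≈-Reasoning
  term : ∀ w → X (m ℕ.* w) ⊛ ((𝟙 ⊖ X (suc w)) ⊛ ((𝟙 ⊖ X (suc w)) ⊛ durfeeTerm (suc w))) ≈
               X 1 ⊛ (X ((2 ℕ.+ m) ℕ.* w) ⊛ durfeeTerm w)
  term w = begin
    X (m ℕ.* w) ⊛ ((𝟙 ⊖ X (suc w)) ⊛ ((𝟙 ⊖ X (suc w)) ⊛ (X (suc w ℕ.* suc w) ⊛ invPoch² (suc w))))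
      ≈⟨ solve 4 (λ x y s i → x :* ((con 1ℤ :- y) :* ((con 1ℤ :- y) :* (s :* i))) :=
                              x :* s :* ((con 1ℤ :- y) :* ((con 1ℤ :- y) :* i))) ≈-refl
           (X (m ℕ.* w)) (X (suc w)) (X (suc w ℕ.* suc w)) (invPoch² (suc w)) ⟩
    X (m ℕ.* w) ⊛ X (suc w ℕ.* suc w) ⊛ ((𝟙 ⊖ X (suc w)) ⊛ ((𝟙 ⊖ X (suc w)) ⊛ invPoch² (suc w)))
      ≈⟨ ⊛-cong (⊛-congˡ (X (m ℕ.* w)) (X-suc² w)) (invPoch²-suc w) ⟩
    X (m ℕ.* w) ⊛ (X 1 ⊛ (X w ⊛ (X w ⊛ X (w ℕ.* w)))) ⊛ invPoch² w
      ≈⟨ solve 5 (λ x o w s i → x :* (o :* (w :* (w :* s))) :* i := o :* (w :* (w :* x) :* (s :* i))) ≈-refl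
           (X (m ℕ.* w)) (X 1) (X w) (X (w ℕ.* w)) (invPoch² w) ⟩
    X 1 ⊛ (X w ⊛ (X w ⊛ X (m ℕ.* w)) ⊛ durfeeTerm w)
      ≈⟨ ⊛-congˡ (X 1) (⊛-congʳ (durfeeTerm w) (≈-trans (X-+ w _) (⊛-congˡ (X w) (X-+ w _)))) ⟨
    X 1 ⊛ (X ((2 ℕ.+ m) ℕ.* w) ⊛ durfeeTerm w) ∎

-- Both sides satisfy the same second-order recurrence in m and tend to 1.
peaks≈invPoch∞⊛durfee : ∀ m → peaks m ≈ invPoch∞ m ⊛ durfee m
peaks≈invPoch∞⊛durfee m = ⊖≈𝟘⇒≈ (recurrence-unique (λ m → peaks m ⊖ P m) step small m)
  where
  open ≈-Reasoning
  P : ℕ → Series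
  P m = invPoch∞ m ⊛ durfee m

  -- Writing e₂ as (1 - y) e₁ lets the recurrence of `durfee` absorb d₁ and d₂: only (e₀ - e₁) d₀
  -- survives, and e₀ - e₁ = x e₀.
  P-Δ² : ∀ m → P m ⊖ P (suc m) ⊖ P (suc m) ⊕ P (2 ℕ.+ m) ≈ X (suc m) ⊛ P m
  P-Δ² m = begin
    P m ⊖ P (suc m) ⊖ P (suc m) ⊕ P (2 ℕ.+ m)
      ≈⟨ ⊕-cong ≈-refl (⊛-congʳ d₂ (invPoch∞-suc (suc m))) ⟨
    e₀ ⊛ d₀ ⊖ e₁ ⊛ d₁ ⊖ e₁ ⊛ d₁ ⊕ (𝟙 ⊖ y) ⊛ e₁ ⊛ d₂
      ≈⟨ solve 6 (λ e₀ e₁ d₀ d₁ d₂ y →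
           e₀ :* d₀ :- e₁ :* d₁ :- e₁ :* d₁ :+ (con 1ℤ :- y) :* e₁ :* d₂ :=
           e₀ :* d₀ :- e₁ :* d₀ :+ e₁ :* ((d₀ :- d₁ :- d₁ :+ d₂) :- y :* d₂)) ≈-refl e₀ e₁ d₀ d₁ d₂ y ⟩
    e₀ ⊛ d₀ ⊖ e₁ ⊛ d₀ ⊕ e₁ ⊛ ((d₀ ⊖ d₁ ⊖ d₁ ⊕ d₂) ⊖ y ⊛ d₂)
      ≈⟨ ⊕-cong (⊖-cong ≈-refl (⊛-congʳ d₀ (invPoch∞-suc m)))
                (⊛-congˡ e₁ (⊖-cong (≈-sym (durfee-Δ² m)) ≈-refl)) ⟨
    e₀ ⊛ d₀ ⊖ (𝟙 ⊖ x) ⊛ e₀ ⊛ d₀ ⊕ e₁ ⊛ (y ⊛ d₂ ⊖ y ⊛ d₂)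
      ≈⟨ solve 5 (λ e₀ e₁ d₀ z x →
           e₀ :* d₀ :- (con 1ℤ :- x) :* e₀ :* d₀ :+ e₁ :* (z :- z) := x :* (e₀ :* d₀)) ≈-refl
           e₀ e₁ d₀ (y ⊛ d₂) x ⟩
    x ⊛ (e₀ ⊛ d₀) ∎
    where
    e₀ = invPoch∞ m
    e₁ = invPoch∞ (suc m)
    d₀ = durfee m
    d₁ = durfee (suc m)
    d₂ = durfee (2 ℕ.+ m)
    x = X (suc m)
    y = X (2 ℕ.+ m)

  step : ∀ m → (peaks m ⊖ P m) ⊖ (peaks (suc m) ⊖ P (suc m)) ⊖ (peaks (suc m) ⊖ P (suc m)) ⊕
               (peaks (2 ℕ.+ m) ⊖ P (2 ℕ.+ m)) ≈ X (suc m) ⊛ (peaks m ⊖ P m)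
  step m = begin
    (a₀ ⊖ P₀) ⊖ (a₁ ⊖ P₁) ⊖ (a₁ ⊖ P₁) ⊕ (a₂ ⊖ P₂)
      ≈⟨ solve 6 (λ a b c p q r → (a :- p) :- (b :- q) :- (b :- q) :+ (c :- r) :=
           (a :- b :- b :+ c) :- (p :- q :- q :+ r)) ≈-refl a₀ a₁ a₂ P₀ P₁ P₂ ⟩
    (a₀ ⊖ a₁ ⊖ a₁ ⊕ a₂) ⊖ (P₀ ⊖ P₁ ⊖ P₁ ⊕ P₂)
      ≈⟨ ⊖-cong (peaks-Δ² m) (P-Δ² m) ⟩
    x ⊛ a₀ ⊖ x ⊛ P₀
      ≈⟨ solve 3 (λ x a p → x :* a :- x :* p := x :* (a :- p)) ≈-refl x a₀ P₀ ⟩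
    x ⊛ (a₀ ⊖ P₀) ∎
    where
    a₀ = peaks m
    a₁ = peaks (suc m)
    a₂ = peaks (2 ℕ.+ m)
    P₀ = P m
    P₁ = P (suc m)
    P₂ = P (2 ℕ.+ m)
    x = X (suc m)

  -- All three sums start with 1 and continue with multiples of q^{m+1}, so the ones cancel.
  small : ∀ m → q^ suc m ∣ peaks m ⊖ P m
  small m = (a ⊖ b ⊖ c ⊖ x ⊛ (b ⊛ c)) , (begin
    peaks m ⊖ invPoch∞ m ⊛ durfee m
      ≈⟨ ⊖-cong (dilate-unfold invPoch² m) (⊛-cong (dilate-unfold invPoch m) (dilate-unfold durfeeTerm m)) ⟩
    (𝟙 ⊛ 𝟙 ⊕ x ⊛ a) ⊖ (𝟙 ⊕ x ⊛ b) ⊛ (X 0 ⊛ (𝟙 ⊛ 𝟙) ⊕ x ⊛ c)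
      ≈⟨ ⊖-cong ≈-refl (⊛-congˡ _ (⊕-cong (⊛-congʳ (𝟙 ⊛ 𝟙) X0) ≈-refl)) ⟩
    (𝟙 ⊛ 𝟙 ⊕ x ⊛ a) ⊖ (𝟙 ⊕ x ⊛ b) ⊛ (𝟙 ⊛ (𝟙 ⊛ 𝟙) ⊕ x ⊛ c)
      ≈⟨ solve 4 (λ a b c x → let o = con 1ℤ in
           (o :* o :+ x :* a) :- (o :+ x :* b) :* (o :* (o :* o) :+ x :* c) :=
           x :* (a :- b :- c :- x :* (b :* c))) ≈-refl a b c x ⟩
    x ⊛ (a ⊖ b ⊖ c ⊖ x ⊛ (b ⊛ c)) ∎)
    where
    x = X (suc m)
    a = dilate (invPoch² ∘ suc) m
    b = dilate (invPoch ∘ suc) m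
    c = dilate (durfeeTerm ∘ suc) m

-- poch k b is (q^{k+1};q)_b.
poch : ℕ → ℕ → Series
poch k zero    = 𝟙
poch k (suc b) = (𝟙 ⊖ X (suc k)) ⊛ poch (suc k) b

poch-last : ∀ k b → poch k (suc b) ≈ (𝟙 ⊖ X (suc (k ℕ.+ b))) ⊛ poch k b
poch-last k zero    = ⊛-congʳ 𝟙 (⊖-cong ≈-refl (X-cong (cong suc (sym (ℕ.+-identityʳ k)))))
poch-last k (suc b) = begin
  (𝟙 ⊖ X (suc k)) ⊛ poch (suc k) (suc b)
    ≈⟨ ⊛-congˡ (𝟙 ⊖ X (suc k)) (poch-last (suc k) b) ⟩
  (𝟙 ⊖ X (suc k)) ⊛ ((𝟙 ⊖ X (suc (suc k ℕ.+ b))) ⊛ poch (suc k) b)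
    ≈⟨ solve 3 (λ a b c → a :* (b :* c) := b :* (a :* c)) ≈-refl _ _ _ ⟩
  (𝟙 ⊖ X (suc (suc k ℕ.+ b))) ⊛ poch k (suc b)
    ≈⟨ ⊛-congʳ _ (⊖-cong ≈-refl (X-cong (cong suc (ℕ.+-suc k b)))) ⟨
  (𝟙 ⊖ X (suc (k ℕ.+ suc b))) ⊛ poch k (suc b) ∎
  where open ≈-Reasoning

poch-invPoch∞ : ∀ k b → poch k b ⊛ invPoch∞ k ≈ invPoch∞ (b ℕ.+ k)
poch-invPoch∞ k zero    = ⊛-identityˡ (invPoch∞ k)
poch-invPoch∞ k (suc b) = begin
  (𝟙 ⊖ X (suc k)) ⊛ poch (suc k) b ⊛ invPoch∞ k
    ≈⟨ solve 3 (λ x p e → x :* p :* e := p :* (x :* e)) ≈-refl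
         (𝟙 ⊖ X (suc k)) (poch (suc k) b) (invPoch∞ k) ⟩
  poch (suc k) b ⊛ ((𝟙 ⊖ X (suc k)) ⊛ invPoch∞ k)
    ≈⟨ ⊛-congˡ (poch (suc k) b) (invPoch∞-suc k) ⟩
  poch (suc k) b ⊛ invPoch∞ (suc k)
    ≈⟨ poch-invPoch∞ (suc k) b ⟩
  invPoch∞ (b ℕ.+ suc k)
    ≡⟨ cong invPoch∞ (ℕ.+-suc b k) ⟩
  invPoch∞ (suc b ℕ.+ k) ∎
  where open ≈-Reasoning

-- pentagonalTail k is the sum of q^{(k+1)b} (q^{k+1};q)_b over b.
pentagonalTail : ℕ → Series
pentagonalTail k = dilate (poch k) k

-- Euler's proof of the pentagonal number theorem: split off the factor
-- 1 - q^{k+1} on the left in one copy, and 1 - q^{k+1+b} on the right in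
-- another.
pentagonalTail-step : ∀ k → pentagonalTail k ≈
  𝟙 ⊕ X (suc k) ⊖ X (suc k) ⊛ X (suc k) ⊛ X (suc (suc k)) ⊛ pentagonalTail (suc k)
pentagonalTail-step k = begin
  pentagonalTail k
    ≈⟨ dilate-unfold (poch k) k ⟩
  𝟙 ⊕ z ⊛ dilate (poch k ∘ suc) k
    ≈⟨ ⊕-cong ≈-refl (⊛-congˡ z (≈-trans
         (∑q-cong λ b → solve 3 (λ a b c → a :* (b :* c) := b :* (a :* c)) ≈-refl
              (X (k ℕ.* b)) (𝟙 ⊖ z) (poch (suc k) b))
         (≈-sym (∑q-⊛ (𝟙 ⊖ z) _)))) ⟩
  𝟙 ⊕ z ⊛ ((𝟙 ⊖ z) ⊛ W)
    ≈⟨ solve 2 (λ z w → con 1ℤ :+ z :* ((con 1ℤ :- z) :* w) := con 1ℤ :+ z :* (w :- z :* w)) ≈-refl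
         z W ⟩
  𝟙 ⊕ z ⊛ (W ⊖ z ⊛ W)
    ≈⟨ ⊕-cong ≈-refl (⊛-congˡ z (⊖-cong W-unfold ≈-refl)) ⟩
  𝟙 ⊕ z ⊛ (𝟙 ⊕ z ⊛ (W ⊖ y ⊛ V) ⊖ z ⊛ W)
    ≈⟨ solve 4 (λ z y w v → con 1ℤ :+ z :* (con 1ℤ :+ z :* (w :- y :* v) :- z :* w) :=
         con 1ℤ :+ z :- z :* z :* y :* v) ≈-refl z y W V ⟩
  𝟙 ⊕ z ⊖ z ⊛ z ⊛ y ⊛ V ∎
  where
  open ≈-Reasoning
  z = X (suc k)
  y = X (suc (suc k))
  V = pentagonalTail (suc k)
  -- A hybrid of the two tails: exponents as in the tail at k, products as in the tail at k + 1.
  -- Both expansions pass through it and their `W` terms cancel.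
  W = dilate (poch (suc k)) k

  -- The q^b inside the last factor raises the exponent (k+1)b to (k+2)b, which is where the tail at
  -- k + 1 comes from.
  last : ∀ b → X (k ℕ.* b) ⊛ poch (suc k) (suc b) ≈
               X (k ℕ.* b) ⊛ poch (suc k) b ⊖ y ⊛ (X (suc k ℕ.* b) ⊛ poch (suc k) b)
  last b = begin
    X (k ℕ.* b) ⊛ poch (suc k) (suc b)
      ≈⟨ ⊛-congˡ (X (k ℕ.* b)) (poch-last (suc k) b) ⟩
    X (k ℕ.* b) ⊛ ((𝟙 ⊖ X (suc (suc k) ℕ.+ b)) ⊛ poch (suc k) b)
      ≈⟨ ⊛-congˡ (X (k ℕ.* b)) (⊛-congʳ (poch (suc k) b) (⊖-cong ≈-refl (X-+ (suc (suc k)) b))) ⟩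
    X (k ℕ.* b) ⊛ ((𝟙 ⊖ y ⊛ X b) ⊛ poch (suc k) b)
      ≈⟨ solve 4 (λ x y b p → x :* ((con 1ℤ :- y :* b) :* p) := x :* p :- y :* (b :* x :* p)) ≈-refl
           (X (k ℕ.* b)) y (X b) (poch (suc k) b) ⟩
    X (k ℕ.* b) ⊛ poch (suc k) b ⊖ y ⊛ (X b ⊛ X (k ℕ.* b) ⊛ poch (suc k) b)
      ≈⟨ ⊖-cong ≈-refl (⊛-congˡ y (⊛-congʳ (poch (suc k) b) (X-+ b (k ℕ.* b)))) ⟨
    X (k ℕ.* b) ⊛ poch (suc k) b ⊖ y ⊛ (X (suc k ℕ.* b) ⊛ poch (suc k) b) ∎

  W-unfold : W ≈ 𝟙 ⊕ z ⊛ (W ⊖ y ⊛ V)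
  W-unfold = begin
    W
      ≈⟨ dilate-unfold (poch (suc k)) k ⟩
    𝟙 ⊕ z ⊛ dilate (poch (suc k) ∘ suc) k
      ≈⟨ ⊕-cong ≈-refl (⊛-congˡ z (≈-trans (∑q-cong last) (≈-trans (∑q-⊖ _ _)
           (⊖-cong ≈-refl (≈-sym (∑q-⊛ y _)))))) ⟩
    𝟙 ⊕ z ⊛ (W ⊖ y ⊛ V) ∎

-- eulerProduct is (q;q)_∞.
eulerProduct : Series
eulerProduct = 𝟙 ⊖ X 1 ⊛ pentagonalTail 0

-- With E_b = 1/(q^{b+1};q)_∞, the b-th term of the sum times E_0 is q^{b+1} E_b = E_b - E_{b+1}.
-- The sum telescopes to E_0 - 1 because E_b tends to 1.
eulerProduct-inverse : eulerProduct ⊛ invPoch∞ 0 ≈ 𝟙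
eulerProduct-inverse = begin
  (𝟙 ⊖ X 1 ⊛ pentagonalTail 0) ⊛ e 0
    ≈⟨ solve 3 (λ x v e → (con 1ℤ :- x :* v) :* e := e :- x :* (e :* v)) ≈-refl
         (X 1) (pentagonalTail 0) (e 0) ⟩
  e 0 ⊖ X 1 ⊛ (e 0 ⊛ pentagonalTail 0)
    ≈⟨ ⊖-cong ≈-refl (≈-trans (⊛-congˡ (X 1) (∑q-⊛ (e 0) _)) (∑q-⊛ (X 1) _)) ⟩
  e 0 ⊖ ∑q (λ b → X 1 ⊛ (e 0 ⊛ (X 0 ⊛ poch 0 b)))
    ≈⟨ ⊖-cong ≈-refl (∑q-cong λ b → ⊛-congˡ (X 1) (term b)) ⟩
  e 0 ⊖ ∑q (λ b → X 1 ⊛ e b)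
    ≈⟨ ⊖-cong ≈-refl (telescope (λ a → e a ⊖ 𝟙) (λ b → X 1 ⊛ e b) step small) ⟨
  e 0 ⊖ (e 0 ⊖ 𝟙)
    ≈⟨ solve 1 (λ e → e :- (e :- con 1ℤ) := con 1ℤ) ≈-refl (e 0) ⟩
  𝟙 ∎
  where
  open ≈-Reasoning
  e = invPoch∞

  term : ∀ b → e 0 ⊛ (X 0 ⊛ poch 0 b) ≈ e b
  term b = begin
    e 0 ⊛ (X 0 ⊛ poch 0 b)    ≈⟨ ⊛-congˡ (e 0) (⊛-congʳ (poch 0 b) X0) ⟩
    e 0 ⊛ (𝟙 ⊛ poch 0 b)
      ≈⟨ solve 2 (λ e p → e :* (con 1ℤ :* p) := p :* e) ≈-refl (e 0) (poch 0 b) ⟩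
    poch 0 b ⊛ e 0            ≈⟨ poch-invPoch∞ 0 b ⟩
    e (b ℕ.+ 0)               ≡⟨ cong e (ℕ.+-identityʳ b) ⟩
    e b                       ∎

  step : ∀ a → e a ⊖ 𝟙 ≈ X a ⊛ (X 1 ⊛ e a) ⊕ (e (suc a) ⊖ 𝟙)
  step a = begin
    e a ⊖ 𝟙
      ≈⟨ solve 3 (λ x o e → e :- con 1ℤ := o :* x :* e :+ ((con 1ℤ :- o :* x) :* e :- con 1ℤ)) ≈-refl
           (X a) (X 1) (e a) ⟩
    X 1 ⊛ X a ⊛ e a ⊕ ((𝟙 ⊖ X 1 ⊛ X a) ⊛ e a ⊖ 𝟙)
      ≈⟨ ⊕-cong (solve 3 (λ x o e → o :* x :* e := x :* (o :* e)) ≈-refl (X a) (X 1) (e a))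
           (⊖-cong (≈-trans (⊛-congʳ (e a) (⊖-cong ≈-refl (≈-sym (X-+ 1 a)))) (invPoch∞-suc a)) ≈-refl) ⟩
    X a ⊛ (X 1 ⊛ e a) ⊕ (e (suc a) ⊖ 𝟙) ∎

  small : ∀ a → q^ a ∣ e a ⊖ 𝟙
  small a = X 1 ⊛ t , (begin
    e a ⊖ 𝟙                        ≈⟨ ⊖-cong (dilate-unfold invPoch a) ≈-refl ⟩
    𝟙 ⊕ X (suc a) ⊛ t ⊖ 𝟙          ≈⟨ ⊖-cong (⊕-cong ≈-refl (⊛-congʳ t (X-+ 1 a))) ≈-refl ⟩
    𝟙 ⊕ X 1 ⊛ X a ⊛ t ⊖ 𝟙
      ≈⟨ solve 3 (λ o x t → con 1ℤ :+ o :* x :* t :- con 1ℤ := x :* (o :* t)) ≈-refl (X 1) (X a) t ⟩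
    X a ⊛ (X 1 ⊛ t)                ∎)
    where t = dilate (invPoch ∘ suc) a

invPoch∞≈invPoch⊛ : ∀ k → invPoch∞ 0 ≈ invPoch k ⊛ invPoch∞ k
invPoch∞≈invPoch⊛ zero    = ≈-sym (⊛-identityˡ _)
invPoch∞≈invPoch⊛ (suc k) = begin
  invPoch∞ 0
    ≈⟨ invPoch∞≈invPoch⊛ k ⟩
  invPoch k ⊛ invPoch∞ k
    ≈⟨ ⊛-congʳ (invPoch∞ k) (invPoch-suc k) ⟨
  (𝟙 ⊖ X (suc k)) ⊛ invPoch (suc k) ⊛ invPoch∞ k
    ≈⟨ solve 3 (λ x i e → x :* i :* e := i :* (x :* e)) ≈-refl
         (𝟙 ⊖ X (suc k)) (invPoch (suc k)) (invPoch∞ k) ⟩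
  invPoch (suc k) ⊛ ((𝟙 ⊖ X (suc k)) ⊛ invPoch∞ k)
    ≈⟨ ⊛-congˡ (invPoch (suc k)) (invPoch∞-suc k) ⟩
  invPoch (suc k) ⊛ invPoch∞ (suc k) ∎
  where open ≈-Reasoning

-- Nonnegativity of the pentagonal tail divided by (q)_∞

𝟙-nonnegative : Nonnegative 𝟙
𝟙-nonnegative = nonnegative-cong X0 (X-nonnegative 0)

dilate-nonnegative : ∀ {L} m → (∀ i → Nonnegative (L i)) → Nonnegative (dilate L m)
dilate-nonnegative m L≥0 = ∑q-nonnegative λ i → ⊛-nonnegative (X-nonnegative (m ℕ.* i)) (L≥0 i)

geometric-nonnegative : ∀ a → Nonnegative (geometric a)
geometric-nonnegative a = dilate-nonnegative a (λ _ → 𝟙-nonnegative)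

invPoch-nonnegative : ∀ n → Nonnegative (invPoch n)
invPoch-nonnegative zero    = 𝟙-nonnegative
invPoch-nonnegative (suc n) = ⊛-nonnegative (invPoch-nonnegative n) (geometric-nonnegative n)

invPoch∞-nonnegative : ∀ a → Nonnegative (invPoch∞ a)
invPoch∞-nonnegative a = dilate-nonnegative a invPoch-nonnegative

durfee-nonnegative : ∀ m → Nonnegative (durfee m)
durfee-nonnegative m = dilate-nonnegative m λ w → ⊛-nonnegative (X-nonnegative (w ℕ.* w))
  (⊛-nonnegative (invPoch-nonnegative w) (invPoch-nonnegative w))

-- Every 1/(q)_{n+1} contains the factor 1/(1 - q), which 1 - q cancels; 1/(q)_0 does not, hence the
-- successor.
[1-q]invPoch-nonnegative : ∀ n → Nonnegative ((𝟙 ⊖ X 1) ⊛ invPoch (suc n))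
[1-q]invPoch-nonnegative zero    = nonnegative-cong (≈-sym (invPoch-suc 0)) 𝟙-nonnegative
[1-q]invPoch-nonnegative (suc n) = nonnegative-cong (⊛-assoc (𝟙 ⊖ X 1) (invPoch (suc n)) (geometric (suc n)))
  (⊛-nonnegative ([1-q]invPoch-nonnegative n) (geometric-nonnegative (suc n)))

pentagonalTail⊛invPoch∞ : ∀ k → pentagonalTail k ⊛ invPoch∞ 0 ≈
  invPoch k ⊛ dilate (λ b → invPoch∞ (b ℕ.+ k)) k
pentagonalTail⊛invPoch∞ k = begin
  pentagonalTail k ⊛ invPoch∞ 0
    ≈⟨ ⊛-congˡ (pentagonalTail k) (invPoch∞≈invPoch⊛ k) ⟩
  pentagonalTail k ⊛ (invPoch k ⊛ invPoch∞ k)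
    ≈⟨ solve 3 (λ v i e → v :* (i :* e) := i :* (e :* v)) ≈-refl
         (pentagonalTail k) (invPoch k) (invPoch∞ k) ⟩
  invPoch k ⊛ (invPoch∞ k ⊛ pentagonalTail k)
    ≈⟨ ⊛-congˡ (invPoch k) (≈-trans (∑q-⊛ (invPoch∞ k) _) (∑q-cong λ b →
         ≈-trans (solve 3 (λ e x p → e :* (x :* p) := x :* (p :* e)) ≈-refl
              (invPoch∞ k) (X (k ℕ.* b)) (poch k b))
                 (⊛-congˡ (X (k ℕ.* b)) (poch-invPoch∞ k b)))) ⟩
  invPoch k ⊛ dilate (λ b → invPoch∞ (b ℕ.+ k)) k ∎
  where open ≈-Reasoning

pentagonalTail⊛invPoch∞-nonnegative : ∀ k → Nonnegative (pentagonalTail k ⊛ invPoch∞ 0)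
pentagonalTail⊛invPoch∞-nonnegative k = nonnegative-cong (≈-sym (pentagonalTail⊛invPoch∞ k))
  (⊛-nonnegative (invPoch-nonnegative k) (dilate-nonnegative k λ b → invPoch∞-nonnegative (b ℕ.+ k)))

[1-q]pentagonalTail⊛invPoch∞-nonnegative : ∀ k →
  Nonnegative ((𝟙 ⊖ X 1) ⊛ (pentagonalTail (suc k) ⊛ invPoch∞ 0))
[1-q]pentagonalTail⊛invPoch∞-nonnegative k = nonnegative-cong
  (≈-trans (⊛-assoc (𝟙 ⊖ X 1) (invPoch (suc k)) _)
           (⊛-congˡ (𝟙 ⊖ X 1) (≈-sym (pentagonalTail⊛invPoch∞ (suc k)))))
  (⊛-nonnegative ([1-q]invPoch-nonnegative k)
    (dilate-nonnegative (suc k) λ b → invPoch∞-nonnegative (b ℕ.+ suc k)))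

-- Generating functions of classes of compositions

Positive : List ℕ → Set
Positive = All (ℕ._≥ 1)

opaque

  gf : ∀ {P : Pred (List ℕ) 0ℓ} → Decidable P → Series
  gf P? n = + (# P? of compositions n)

  gf-coeff : ∀ {P : Pred (List ℕ) 0ℓ} (P? : Decidable P) n → gf P? n ≡ + (# P? of compositions n)
  gf-coeff P? n = refl

open IsComposition

unique∧set⇒length : ∀ {xs ys : List (List ℕ)} → Unique xs → Unique ys →
                    (∀ {z} → z ∈ xs → z ∈ ys) → (∀ {z} → z ∈ ys → z ∈ xs) →
                    length xs ≡ length ys
unique∧set⇒length xs! ys! xs⊆ys ys⊆xs =
  ↭-length (∼bag⇒↭ (unique∧set⇒bag xs! ys! (mk⇔ xs⊆ys ys⊆xs)))

-- The bridge from bijections to counting: repetition-free lists with the same members are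
-- permutations of each other, so any such list computes the coefficient.
gf-enumerate : ∀ {P : Pred (List ℕ) 0ℓ} (P? : Decidable P) n xs → Unique xs →
               (∀ {y} → y ∈ xs → IsComposition n y × P y) →
               (∀ {y} → IsComposition n y → P y → y ∈ xs) → gf P? n ≡ + length xs
gf-enumerate P? n xs xs! sound complete = trans (gf-coeff P? n) (cong +_ (unique∧set⇒length
  (Unique.filter⁺ P? (compositions-unique n)) xs!
  (λ y∈ → let y∈comps , Py = ∈-filter⁻ P? {xs = compositions n} y∈ in
    complete (compositions-sound n y∈comps) Py)
  (λ y∈ → let y-comp , Py = sound y∈ in ∈-filter⁺ P? (compositions-complete n y-comp) Py)))

module _ {P Q : Pred (List ℕ) 0ℓ} (P? : Decidable P) (Q? : Decidable Q) where

  -- Partitions and unimodal compositions are defined by one filter and counted by a second; this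
  -- merges both conditions into a single class.
  gf-filter-filter : ∀ n {R : Pred (List ℕ) 0ℓ} (R? : Decidable R) →
    (∀ {y} → IsComposition n y → P y → Q y → R y) →
    (∀ {y} → IsComposition n y → R y → P y × Q y) →
    + (# Q? of filter P? (compositions n)) ≡ gf R? n
  gf-filter-filter n R? to from = sym (gf-enumerate R? n _
    (Unique.filter⁺ Q? (Unique.filter⁺ P? (compositions-unique n)))
    (λ y∈ → let y∈P , Qy = ∈-filter⁻ Q? {xs = filter P? (compositions n)} y∈
                y∈comps , Py = ∈-filter⁻ P? {xs = compositions n} y∈P
                y-comp = compositions-sound n y∈comps
            in y-comp , to y-comp Py Qy)
    (λ y-comp Ry → let Py , Qy = from y-comp Ry in
      ∈-filter⁺ Q? (∈-filter⁺ P? (compositions-complete n y-comp) Py) Qy))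

  gf-cong : (∀ {y} → Positive y → P y → Q y) → (∀ {y} → Positive y → Q y → P y) → gf P? ≈ gf Q?
  gf-cong to from = coeffwise λ n → trans
    (gf-enumerate P? n (filter Q? (compositions n)) (Unique.filter⁺ Q? (compositions-unique n))
      (λ y∈ → let y∈comps , Qy = ∈-filter⁻ Q? {xs = compositions n} y∈
                  y-comp = compositions-sound n y∈comps
              in y-comp , from (positive y-comp) Qy)
      (λ y-comp Py → ∈-filter⁺ Q? (compositions-complete n y-comp) (to (positive y-comp) Py)))
    (sym (gf-coeff Q? n))

gf-divisible : ∀ {P : Pred (List ℕ) 0ℓ} (P? : Decidable P) a →
               (∀ {y} → Positive y → P y → a ℕ.≤ sum y) → q^ a ∣ gf P?
gf-divisible P? a large = coeff≡0⇒∣ a λ n n<a → gf-enumerate P? n [] [] (λ ())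
  λ { (composition pos refl) Py → contradiction (large pos Py) (ℕ.<⇒≱ n<a) }

gf-singleton : ∀ {P : Pred (List ℕ) 0ℓ} (P? : Decidable P) x → Positive x → P x →
               (∀ {y} → Positive y → P y → y ≡ x) → gf P? ≈ X (sum x)
gf-singleton P? x x-pos Px only = coeffwise λ n → trans (go n) (at X⊛𝟙 n)
  where
  -- The coefficient rules for powers of q are stated for products, so a factor 1 is supplied.
  X⊛𝟙 : X (sum x) ⊛ 𝟙 ≈ X (sum x)
  X⊛𝟙 = ≈-trans (⊛-comm _ _) (⊛-identityˡ _)

  go : ∀ n → gf P? n ≡ (X (sum x) ⊛ 𝟙) n
  go n with n ℕ.<? sum x
  ... | yes n<s = trans
    (gf-enumerate P? n [] [] (λ ())
      λ { (composition pos refl) Py →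
          contradiction (ℕ.≤-reflexive (cong sum (sym (only pos Py)))) (ℕ.<⇒≱ n<s) })
    (sym (X-coeff-< (sum x) 𝟙 n<s))
  ... | no n≮s with n ℕ.∸ sum x | ℕ.m+[n∸m]≡n (ℕ.≮⇒≥ n≮s)
  ...   | zero  | refl = trans
    (gf-enumerate P? (sum x ℕ.+ 0) (x ∷ []) ([] ∷ [])
      (λ { (here refl) → composition x-pos (sym (ℕ.+-identityʳ _)) , Px })
      (λ c Py → here (only (positive c) Py)))
    (sym (trans (X-coeff-+ (sum x) 𝟙 0) (constant-zero 1ℤ)))
  ...   | suc m | refl = trans
    (gf-enumerate P? (sum x ℕ.+ suc m) [] [] (λ ())
      λ c Py → contradiction (trans (cong sum (sym (only (positive c) Py))) (total c))
        (ℕ.m≢1+m+n (sum x) ∘ flip trans (ℕ.+-suc (sum x) m)))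
    (sym (trans (X-coeff-+ (sum x) 𝟙 (suc m)) (constant-suc 1ℤ m)))

-- An operation that puts peeled parts of total size d back. `positive⁻` ensures that a preimage of
-- a composition is again one, so that images can be counted in degree n ∸ d.
record WeightedInjection (f : List ℕ → List ℕ) (d : ℕ) : Set where
  field
    weight    : ∀ x → sum (f x) ≡ d ℕ.+ sum x
    positive⁺ : ∀ {x} → Positive x → Positive (f x)
    positive⁻ : ∀ {x} → Positive (f x) → Positive x
    injective : ∀ {x y} → f x ≡ f y → x ≡ y

-- The form shared by all peeling steps: `P` is the disjoint union of `P₁`, where nothing is peeled,
-- and the image of `P₂` under `f`, which adds d to the size and so contributes q^d.
gf-split : ∀ {P P₁ P₂ : Pred (List ℕ) 0ℓ} (P? : Decidable P) (P₁? : Decidable P₁) (P₂? : Decidable P₂)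
           {f d} → WeightedInjection f d →
           (∀ {y} → Positive y → P y → P₁ y ⊎ ∃ λ x → P₂ x × y ≡ f x) →
           (∀ {y} → Positive y → P₁ y → P y) →
           (∀ {x} → Positive x → P₂ x → P (f x)) →
           (∀ {x} → Positive x → P₂ x → P₁ (f x) → ⊥) →
           gf P? ≈ gf P₁? ⊕ X d ⊛ gf P₂?
gf-split {P₂ = P₂} P? P₁? P₂? {f} {d} inj to from₁ from₂ disjoint = coeffwise λ n → begin
  gf P? n
    ≡⟨ gf-enumerate P? n (ys n ++ zs n)
         (Unique.++⁺ (Unique.filter⁺ P₁? (compositions-unique n)) (zs! n) (disjoint′ n))
         (sound n) (complete n) ⟩
  + length (ys n ++ zs n)
    ≡⟨ cong +_ (length-++ (ys n)) ⟩
  + (length (ys n) ℕ.+ length (zs n))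
    ≡⟨ ℤ.pos-+ (length (ys n)) (length (zs n)) ⟩
  + length (ys n) ℤ.+ + length (zs n)
    ≡⟨ cong₂ ℤ._+_ (sym (gf-coeff P₁? n)) (length-zs n) ⟩
  gf P₁? n ℤ.+ (X d ⊛ gf P₂?) n
    ≡⟨ ⊕-coeff (gf P₁?) (X d ⊛ gf P₂?) n ⟨
  (gf P₁? ⊕ X d ⊛ gf P₂?) n ∎
  where
  open ≡-Reasoning
  open WeightedInjection inj

  ys : ℕ → List (List ℕ)
  ys n = filter P₁? (compositions n)

  images : ℕ → List (List ℕ)
  images m = map f (filter P₂? (compositions m))

  -- Below degree d there are no images, while the truncated difference n ∸ d would wrongly point to
  -- degree 0.
  zs : ℕ → List (List ℕ)
  zs n with n ℕ.<? d
  ... | yes _ = []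
  ... | no  _ = images (n ℕ.∸ d)

  zs! : ∀ n → Unique (zs n)
  zs! n with n ℕ.<? d
  ... | yes _ = []
  ... | no  _ = Unique.map⁺ injective (Unique.filter⁺ P₂? (compositions-unique (n ℕ.∸ d)))

  length-zs : ∀ n → + length (zs n) ≡ (X d ⊛ gf P₂?) n
  length-zs n with n ℕ.<? d
  ... | yes n<d = sym (X-coeff-< d (gf P₂?) n<d)
  ... | no  n≮d = begin
    + length (images (n ℕ.∸ d))
      ≡⟨ cong +_ (length-map f (filter P₂? (compositions (n ℕ.∸ d)))) ⟩
    + (# P₂? of compositions (n ℕ.∸ d))      ≡⟨ gf-coeff P₂? (n ℕ.∸ d) ⟨
    gf P₂? (n ℕ.∸ d)                         ≡⟨ X-coeff-+ d (gf P₂?) (n ℕ.∸ d) ⟨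
    (X d ⊛ gf P₂?) (d ℕ.+ (n ℕ.∸ d))         ≡⟨ cong (X d ⊛ gf P₂?) (ℕ.m+[n∸m]≡n (ℕ.≮⇒≥ n≮d)) ⟩
    (X d ⊛ gf P₂?) n                         ∎

  ∈-zs⁻ : ∀ n {y} → y ∈ zs n → ∃ λ x → IsComposition n y × Positive x × P₂ x × y ≡ f x
  ∈-zs⁻ n {y} y∈ with n ℕ.<? d
  ... | no n≮d =
    let x , x∈ , y≡fx = ∈-map⁻ f y∈
        x∈comps , P₂x = ∈-filter⁻ P₂? {xs = compositions (n ℕ.∸ d)} x∈
        c = compositions-sound (n ℕ.∸ d) x∈comps
    in x
     , composition (subst Positive (sym y≡fx) (positive⁺ (positive c)))
         (trans (cong sum y≡fx) (trans (weight x) (trans (cong (d ℕ.+_) (total c)) (ℕ.m+[n∸m]≡n (ℕ.≮⇒≥ n≮d)))))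
     , positive c , P₂x , y≡fx

  ∈-zs⁺ : ∀ n {x} → IsComposition n (f x) → P₂ x → f x ∈ zs n
  ∈-zs⁺ n {x} c P₂x with n ℕ.<? d
  ... | yes n<d = contradiction n<d
    (ℕ.≤⇒≯ (subst (d ℕ.≤_) (trans (sym (weight x)) (total c)) (ℕ.m≤m+n d (sum x))))
  ... | no  _   = ∈-map⁺ f (∈-filter⁺ P₂? (compositions-complete (n ℕ.∸ d)
      (composition (positive⁻ (positive c)) sum-x)) P₂x)
    where
    sum-x : sum x ≡ n ℕ.∸ d
    sum-x = trans (sym (ℕ.m+n∸m≡n d (sum x))) (cong (ℕ._∸ d) (trans (sym (weight x)) (total c)))

  disjoint′ : ∀ n {y} → y ∈ ys n × y ∈ zs n → ⊥
  disjoint′ n (y∈ys , y∈zs) with ∈-zs⁻ n y∈zs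
  ... | x , _ , x-pos , P₂x , refl = disjoint x-pos P₂x (proj₂ (∈-filter⁻ P₁? {xs = compositions n} y∈ys))

  sound : ∀ n {y} → y ∈ ys n ++ zs n → IsComposition n y × _
  sound n y∈ with ∈-++⁻ (ys n) y∈
  ... | inj₁ y∈ys = let y∈comps , P₁y = ∈-filter⁻ P₁? {xs = compositions n} y∈ys
                        c = compositions-sound n y∈comps
                    in c , from₁ (positive c) P₁y
  ... | inj₂ y∈zs with ∈-zs⁻ n y∈zs
  ...   | x , c , x-pos , P₂x , refl = c , from₂ x-pos P₂x

  complete : ∀ n {y} → IsComposition n y → _ → y ∈ ys n ++ zs n
  complete n c Py with to (positive c) Py
  ... | inj₁ P₁y              = ∈-++⁺ˡ (∈-filter⁺ P₁? (compositions-complete n c) P₁y)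
  ... | inj₂ (x , P₂x , refl) = ∈-++⁺ʳ (ys n) (∈-zs⁺ n c P₂x)

gf-⊎ : ∀ {P P₁ P₂ : Pred (List ℕ) 0ℓ} (P? : Decidable P) (P₁? : Decidable P₁) (P₂? : Decidable P₂) →
       (∀ {y} → Positive y → P y → P₁ y ⊎ P₂ y) →
       (∀ {y} → Positive y → P₁ y → P y) → (∀ {y} → Positive y → P₂ y → P y) →
       (∀ {y} → Positive y → P₂ y → P₁ y → ⊥) →
       gf P? ≈ gf P₁? ⊕ gf P₂?
gf-⊎ P? P₁? P₂? to from₁ from₂ disjoint = ≈-trans
  (gf-split P? P₁? P₂? {id} {0}
    (record { weight = λ _ → refl ; positive⁺ = id ; positive⁻ = id ; injective = id })
    (λ pos Py → Sum.map₂ (λ P₂y → _ , P₂y , refl) (to pos Py)) from₁ from₂ disjoint)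
  (⊕-cong ≈-refl (≈-trans (⊛-congʳ (gf P₂?) X0) (⊛-identityˡ (gf P₂?))))

cons : ∀ {a} → a ℕ.≥ 1 → WeightedInjection (a ∷_) a
cons a≥1 = record
  { weight = λ _ → refl ; positive⁺ = a≥1 ∷_ ; positive⁻ = All.tail ; injective = ∷-injectiveʳ }

append : ∀ {ys} → Positive ys → WeightedInjection (_++ ys) (sum ys)
append {ys} ys-pos = record
  { weight = λ x → trans (sum-++ x ys) (ℕ.+-comm (sum x) (sum ys))
  ; positive⁺ = λ x-pos → All.++⁺ x-pos ys-pos
  ; positive⁻ = All.++⁻ˡ _
  ; injective = ++-cancelʳ ys _ _ }

snoc : ∀ {a} → a ℕ.≥ 1 → WeightedInjection (_∷ʳ a) a
snoc {a} a≥1 = record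
  { weight = λ x → trans (sum-++ x (a ∷ []))
      (trans (ℕ.+-comm (sum x) (a ℕ.+ 0)) (cong (ℕ._+ sum x) (ℕ.+-identityʳ a)))
  ; positive⁺ = λ x-pos → All.++⁺ x-pos (a≥1 ∷ [])
  ; positive⁻ = All.++⁻ˡ _
  ; injective = ++-cancelʳ (a ∷ []) _ _ }

-- Partitions counted by number of ones and number of larger parts

Descending : List ℕ → Set
Descending = Linked ℕ._≥_

descending? : Decidable Descending
descending? = linked? ℕ._≥?_

descending-∷ʳ⁻ : ∀ xs {a} → Descending (xs ∷ʳ a) → Descending xs × All (ℕ._≥ a) xs
descending-∷ʳ⁻ []           _               = [] , []
descending-∷ʳ⁻ (x ∷ [])     (x≥a ∷ _)       = [-] , x≥a ∷ []
descending-∷ʳ⁻ (x ∷ y ∷ xs) (x≥y ∷ desc) with descending-∷ʳ⁻ (y ∷ xs) desc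
... | desc′ , y≥a ∷ xs≥a = x≥y ∷ desc′ , ℕ.≤-trans y≥a x≥y ∷ y≥a ∷ xs≥a

descending-∷ʳ⁺ : ∀ {xs a} → Descending xs → All (ℕ._≥ a) xs → Descending (xs ∷ʳ a)
descending-∷ʳ⁺ []           []            = [-]
descending-∷ʳ⁺ [-]          (x≥a ∷ [])    = x≥a ∷ [-]
descending-∷ʳ⁺ (x≥y ∷ desc) (_ ∷ xs≥a)    = x≥y ∷ descending-∷ʳ⁺ desc xs≥a

length≤sum : ∀ {xs} → Positive xs → length xs ℕ.≤ sum xs
length≤sum []          = z≤n
length≤sum (x≥1 ∷ pos) = ℕ.+-mono-≤ x≥1 (length≤sum pos)

length-∷ʳ : ∀ (xs : List ℕ) {a} → length (xs ∷ʳ a) ≡ suc (length xs)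
length-∷ʳ xs = trans (length-++ xs) (ℕ.+-comm (length xs) 1)

above : ℕ → List ℕ → ℕ
above w xs = # (ℕ._>? w) of xs

above-++ : ∀ w xs {ys} → All (ℕ._≤ w) ys → above w (xs ++ ys) ≡ above w xs
above-++ w xs {ys} ys≤w = trans (cong length (trans (filter-++ (ℕ._>? w) xs ys)
  (cong (filter (ℕ._>? w) xs ++_) (filter-none (ℕ._>? w) (All.map ℕ.≤⇒≯ ys≤w)))))
  (cong length (++-identityʳ (filter (ℕ._>? w) xs)))

-- The condition on the number of parts is left open, so that one derivation serves both w ≤ μ and μ
-- = w.
partsFrom : ℕ → {R : Pred ℕ 0ℓ} → Decidable R → Series
partsFrom a R? = gf (λ y → descending? y ×-dec all? (ℕ._≥? a) y ×-dec R? (length y))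

partsAbove : ℕ → ℕ → {R : Pred ℕ 0ℓ} → Decidable R → Series
partsAbove a w R? = gf (λ y → descending? y ×-dec all? (ℕ._≥? a) y ×-dec R? (above w y))

private

  -- In a descending list the last part is the smallest, so it alone decides between the cases.
  smallest : ∀ {a} y → Descending y → All (ℕ._≥ a) y →
             All (ℕ._≥ suc a) y ⊎ ∃ λ x → (Descending x × All (ℕ._≥ a) x) × y ≡ x ∷ʳ a
  smallest y desc y≥a with initLast y
  ... | []       = inj₁ []
  ... | xs ∷ʳ′ x with All.∷ʳ⁻ y≥a
  ...   | xs≥a , x≥a with ℕ.m≤n⇒m<n∨m≡n x≥a
  ...     | inj₂ refl = inj₂ (xs , (proj₁ (descending-∷ʳ⁻ xs desc) , xs≥a) , refl)
  ...     | inj₁ a<x  = inj₁ (All.∷ʳ⁺ (All.map (ℕ.≤-trans a<x) (proj₂ (descending-∷ʳ⁻ xs desc))) a<x)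

  ≱1+a : ∀ xs {a} → ¬ All (ℕ._≥ suc a) (xs ∷ʳ a)
  ≱1+a xs all = ℕ.<-irrefl refl (proj₂ (All.∷ʳ⁻ {xs = xs} all))

  weaken : ∀ {a y} → All (ℕ._≥ suc a) y → All (ℕ._≥ a) y
  weaken = All.map ℕ.<⇒≤

module _ {R : Pred ℕ 0ℓ} (R? : Decidable R) where

  partsFrom-step : ∀ a → partsFrom (suc a) R? ≈
                   partsFrom (2 ℕ.+ a) R? ⊕ X (suc a) ⊛ partsFrom (suc a) (R? ∘ suc)
  partsFrom-step a = gf-split _ _ _ (snoc {suc a} (s≤s z≤n))
    (λ {y} _ (desc , y≥ , r) → Sum.map (λ y> → desc , y> , r)
      (λ { (x , (desc-x , x≥) , refl) → x , (desc-x , x≥ , subst R (length-∷ʳ x) r) , refl })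
      (smallest y desc y≥))
    (λ _ (desc , y> , r) → desc , weaken y> , r)
    (λ {x} _ (desc , x≥ , r) → descending-∷ʳ⁺ desc x≥ , All.∷ʳ⁺ x≥ ℕ.≤-refl , subst R (sym (length-∷ʳ x)) r)
    (λ {x} _ _ (_ , y> , _) → ≱1+a x y>)

  -- A part a + 1 ≤ w is invisible to the count above w, so `R?` stays as it is; in `partsFrom-step`
  -- the same removal changes it to `R? ∘ suc`.
  partsAbove-step : ∀ a w → suc a ℕ.≤ w → partsAbove (suc a) w R? ≈
                    partsAbove (2 ℕ.+ a) w R? ⊕ X (suc a) ⊛ partsAbove (suc a) w R?
  partsAbove-step a w a<w = gf-split _ _ _ (snoc {suc a} (s≤s z≤n))
    (λ {y} _ (desc , y≥ , r) → Sum.map (λ y> → desc , y> , r)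
      (λ { (x , (desc-x , x≥) , refl) →
        x , (desc-x , x≥ , subst R (above-++ w x (a<w ∷ [])) r) , refl })
      (smallest y desc y≥))
    (λ _ (desc , y> , r) → desc , weaken y> , r)
    (λ {x} _ (desc , x≥ , r) →
      descending-∷ʳ⁺ desc x≥ , All.∷ʳ⁺ x≥ ℕ.≤-refl , subst R (sym (above-++ w x (a<w ∷ []))) r)
    (λ {x} _ _ (_ , y> , _) → ≱1+a x y>)

  partsAbove≈partsFrom : ∀ a w → w ℕ.< a → partsAbove a w R? ≈ partsFrom a R?
  partsAbove≈partsFrom a w w<a = gf-cong _ _
    (λ _ (desc , y≥ , r) → desc , y≥ , subst R (above≡length y≥) r)
    (λ _ (desc , y≥ , r) → desc , y≥ , subst R (sym (above≡length y≥)) r)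
    where
    above≡length : ∀ {y} → All (ℕ._≥ a) y → above w y ≡ length y
    above≡length y≥ = cong length (filter-all (ℕ._>? w) (All.map (ℕ.≤-trans w<a) y≥))

  partsAbove-geometric : ∀ a w → a ℕ.≤ w →
    partsAbove 1 w R? ≈ invPoch a ⊛ partsAbove (suc a) w R?
  partsAbove-geometric zero    w _   = ≈-sym (⊛-identityˡ _)
  partsAbove-geometric (suc a) w a<w = begin
    partsAbove 1 w R?
      ≈⟨ partsAbove-geometric a w (ℕ.<⇒≤ a<w) ⟩
    invPoch a ⊛ partsAbove (suc a) w R?
      ≈⟨ ⊛-congˡ (invPoch a) (geometric-unique a (≈-trans (partsAbove-step a w a<w) (⊕-comm _ _))) ⟩
    invPoch a ⊛ (geometric a ⊛ partsAbove (2 ℕ.+ a) w R?)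
      ≈⟨ ⊛-assoc (invPoch a) (geometric a) _ ⟨
    invPoch a ⊛ geometric a ⊛ partsAbove (2 ℕ.+ a) w R? ∎
    where open ≈-Reasoning

  -- With ones allowed, the sizes 1, ..., w + 1 are all free and give the complete product
  -- 1/(q)_{w+1}. Subtracting the partitions that contain a one multiplies by 1 - q.
  partsAbove-2 : ∀ w → partsAbove 2 (suc w) R? ≈
    (𝟙 ⊖ X 1) ⊛ (invPoch (suc w) ⊛ partsFrom (2 ℕ.+ w) R?)
  partsAbove-2 w = begin
    partsAbove 2 (suc w) R?
      ≈⟨ solve 2 (λ a b → b := (b :+ a) :- a) ≈-refl (X 1 ⊛ partsAbove 1 (suc w) R?) _ ⟩
    (partsAbove 2 (suc w) R? ⊕ X 1 ⊛ partsAbove 1 (suc w) R?) ⊖ X 1 ⊛ partsAbove 1 (suc w) R?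
      ≈⟨ ⊖-cong (partsAbove-step 0 (suc w) (s≤s z≤n)) ≈-refl ⟨
    partsAbove 1 (suc w) R? ⊖ X 1 ⊛ partsAbove 1 (suc w) R?
      ≈⟨ solve 2 (λ x p → p :- x :* p := (con 1ℤ :- x) :* p) ≈-refl (X 1) _ ⟩
    (𝟙 ⊖ X 1) ⊛ partsAbove 1 (suc w) R?
      ≈⟨ ⊛-congˡ (𝟙 ⊖ X 1) (≈-trans (partsAbove-geometric (suc w) (suc w) ℕ.≤-refl)
           (⊛-congˡ (invPoch (suc w)) (partsAbove≈partsFrom (2 ℕ.+ w) (suc w) ℕ.≤-refl))) ⟩
    (𝟙 ⊖ X 1) ⊛ (invPoch (suc w) ⊛ partsFrom (2 ℕ.+ w) R?) ∎
    where open ≈-Reasoning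

ω≤sum : ∀ {y} → Positive y → ω y ℕ.≤ sum y
ω≤sum {y} pos = ℕ.≤-trans (length-filter (ℕ._≟ 1) y) (length≤sum pos)

ones : ∀ {y} → Positive y → Descending y →
       ∃ λ x → Descending x × All (ℕ._≥ 2) x × y ≡ x ++ replicate (ω y) 1
ones {[]} [] _ = [] , [] , [] , refl
ones {suc zero ∷ ys} (_ ∷ pos) desc with ones pos (Linked.tail desc)
... | [] , _ , _ , ys≡ = [] , [] , [] , cong (1 ∷_) ys≡
... | z ∷ x , _ , z≥2 ∷ _ , ys≡ = contradiction
  (ℕ.≤-trans z≥2 (Linked.head (subst (λ zs → Descending (1 ∷ zs)) ys≡ desc))) ℕ.1+n≰n
ones {suc (suc a) ∷ ys} (_ ∷ pos) desc with ones pos (Linked.tail desc)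
... | [] , _ , _ , ys≡ = suc (suc a) ∷ [] , [-] , s≤s (s≤s z≤n) ∷ [] , cong (_ ∷_) ys≡
... | z ∷ x , desc-x , x≥2 , ys≡ = suc (suc a) ∷ z ∷ x
    , Linked.head (subst (λ zs → Descending (_ ∷ zs)) ys≡ desc) ∷ desc-x
    , s≤s (s≤s z≤n) ∷ x≥2 , cong (_ ∷_) ys≡

ω-ones : ∀ {x} w → All (ℕ._≥ 2) x → ω (x ++ replicate w 1) ≡ w
ω-ones zero    []                  = refl
ω-ones (suc w) []                  = cong suc (ω-ones w [])
ω-ones w       (s≤s (s≤s _) ∷ x≥2) = ω-ones w x≥2

descending-ones : ∀ {x} w → Descending x → All (ℕ._≥ 2) x → Descending (x ++ replicate w 1)
descending-ones zero          []           _               = []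
descending-ones (suc zero)    []           _               = [-]
descending-ones (suc (suc w)) []           _               = ℕ.≤-refl ∷ descending-ones (suc w) [] []
descending-ones zero          [-]          _               = [-]
descending-ones (suc w)       [-]          (s≤s (s≤s _) ∷ _) = s≤s z≤n ∷ descending-ones (suc w) [] []
descending-ones w             (x≥y ∷ desc) (_ ∷ x≥2)       = x≥y ∷ descending-ones w desc x≥2

-- A part 1 exceeds w only if w = 0, and then no ones are appended.
above-ones : ∀ w x → above w (x ++ replicate w 1) ≡ above w x
above-ones zero    x = cong (above 0) (++-identityʳ x)
above-ones (suc w) x = above-++ (suc w) x (All.replicate⁺ (suc w) (s≤s z≤n))

sum-ones : ∀ w → sum (replicate w 1) ≡ w
sum-ones zero    = refl
sum-ones (suc w) = cong suc (sum-ones w)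

module _ {R : ℕ → Pred ℕ 0ℓ} (R? : ∀ w → Decidable (R w)) where

  -- Sorting by ω = w turns μ into the number of parts above a fixed w, and the w ones account for
  -- the factor q^w in `∑q`. The telescoping runs over the condition ω ≥ w.
  ωμ-gf : gf (λ y → descending? y ×-dec R? (ω y) (μ y)) ≈ ∑q (λ w → partsAbove 2 w (R? w))
  ωμ-gf = ≈-trans
    (gf-cong _ (atLeast? 0) (λ _ (desc , r) → desc , z≤n , r) (λ _ (desc , _ , r) → desc , r))
    (telescope (gf ∘ atLeast?) (λ w → partsAbove 2 w (R? w)) step
      (λ w → gf-divisible (atLeast? w) w λ pos (_ , w≤ω , _) → ℕ.≤-trans w≤ω (ω≤sum pos)))
    where
    atLeast? : ∀ w → Decidable (λ y → Descending y × w ℕ.≤ ω y × R (ω y) (μ y))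
    atLeast? w y = descending? y ×-dec (w ℕ.≤? ω y) ×-dec R? (ω y) (μ y)

    step : ∀ w → gf (atLeast? w) ≈ X w ⊛ partsAbove 2 w (R? w) ⊕ gf (atLeast? (suc w))
    step w = ≈-trans
      (gf-split (atLeast? w) (atLeast? (suc w)) _
        (append {replicate w 1} (All.replicate⁺ w (s≤s z≤n)))
        to
        (λ _ (desc , w<ω , r) → desc , ℕ.<⇒≤ w<ω , r)
        (λ {x} _ (desc , x≥2 , r) → let ω≡w = ω-ones w x≥2 in
          descending-ones w desc x≥2 , ℕ.≤-reflexive (sym ω≡w) ,
          subst (λ v → R v (above v (x ++ replicate w 1))) (sym ω≡w) (subst (R w) (sym (above-ones w x)) r))
        (λ _ (_ , x≥2 , _) (_ , w<ω , _) → ℕ.<-irrefl (sym (ω-ones w x≥2)) w<ω))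
      (≈-trans (⊕-comm _ _) (⊕-cong (⊛-congʳ _ (X-cong (sum-ones w))) ≈-refl))
      where
      to : ∀ {y} → Positive y → Descending y × w ℕ.≤ ω y × R (ω y) (μ y) →
           (Descending y × suc w ℕ.≤ ω y × R (ω y) (μ y)) ⊎
           ∃ λ x → (Descending x × All (ℕ._≥ 2) x × R w (above w x)) × y ≡ x ++ replicate w 1
      to {y} pos (desc , w≤ω , r) with ℕ.m≤n⇒m<n∨m≡n w≤ω
      ... | inj₁ w<ω = inj₁ (desc , w<ω , r)
      ... | inj₂ w≡ω with ones pos desc
      ...   | x , desc-x , x≥2 , y≡ = inj₂ (x
        , (desc-x , x≥2 , subst (R w) (trans (cong (above w) y≡′) (above-ones w x)) r′) , y≡′)
        where
        y≡′ : y ≡ x ++ replicate w 1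
        y≡′ = trans y≡ (cong (λ v → x ++ replicate v 1) (sym w≡ω))
        r′ : R w (above w y)
        r′ = subst (λ v → R v (above v y)) (sym w≡ω) r

-- Partitions with exactly or at least t parts

exactly : ℕ → ℕ → Series
exactly a t = partsFrom a (ℕ._≟ t)

atLeast : ℕ → ℕ → Series
atLeast a t = partsFrom a (t ℕ.≤?_)

-- Induction on t, summing over the smallest part a + 1 + w. Removing it leaves t parts of at least
-- that size, and the sum of q^{(t+1)w} over w supplies the new factor 1/(1 - q^{t+1}).
exactly≈ : ∀ t a → exactly (suc a) t ≈ X (t ℕ.* suc a) ⊛ invPoch t
exactly≈ zero a = ≈-trans
  (gf-singleton _ [] [] ([] , [] , refl) λ { {[]} _ _ → refl ; {_ ∷ _} _ (_ , _ , ()) })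
  (≈-sym (≈-trans (⊛-comm _ _) (⊛-identityˡ _)))
exactly≈ (suc t) a = begin
  exactly (suc a) (suc t)
    ≈⟨ telescope (λ w → exactly (suc (w ℕ.+ a)) (suc t))
         (λ w → X (suc t ℕ.* suc a) ⊛ invPoch t ⊛ (X (t ℕ.* w) ⊛ 𝟙)) step small ⟩
  ∑q (λ w → X (suc t ℕ.* suc a) ⊛ invPoch t ⊛ (X (t ℕ.* w) ⊛ 𝟙))
    ≈⟨ ∑q-⊛ _ _ ⟨
  X (suc t ℕ.* suc a) ⊛ invPoch t ⊛ geometric t
    ≈⟨ ⊛-assoc _ _ _ ⟩
  X (suc t ℕ.* suc a) ⊛ invPoch (suc t) ∎
  where
  open ≈-Reasoning
  exponent : ∀ w → X (suc (w ℕ.+ a)) ⊛ X (t ℕ.* suc (w ℕ.+ a)) ≈ X w ⊛ (X (suc t ℕ.* suc a) ⊛ X (t ℕ.* w))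
  exponent w = begin
    X (suc (w ℕ.+ a)) ⊛ X (t ℕ.* suc (w ℕ.+ a))            ≈⟨ X-+ _ _ ⟨
    X (suc (w ℕ.+ a) ℕ.+ t ℕ.* suc (w ℕ.+ a))              ≈⟨ X-cong (rearrange t a w) ⟩
    X (w ℕ.+ (suc t ℕ.* suc a ℕ.+ t ℕ.* w))                ≈⟨ X-+ w _ ⟩
    X w ⊛ X (suc t ℕ.* suc a ℕ.+ t ℕ.* w)
      ≈⟨ ⊛-congˡ (X w) (X-+ (suc t ℕ.* suc a) (t ℕ.* w)) ⟩
    X w ⊛ (X (suc t ℕ.* suc a) ⊛ X (t ℕ.* w))              ∎
    where
    rearrange : ∀ t a w → suc (w ℕ.+ a) ℕ.+ t ℕ.* suc (w ℕ.+ a) ≡ w ℕ.+ (suc t ℕ.* suc a ℕ.+ t ℕ.* w)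
    rearrange = ℕ-solve-∀

  step : ∀ w → exactly (suc (w ℕ.+ a)) (suc t) ≈
    X w ⊛ (X (suc t ℕ.* suc a) ⊛ invPoch t ⊛ (X (t ℕ.* w) ⊛ 𝟙)) ⊕ exactly (2 ℕ.+ (w ℕ.+ a)) (suc t)
  step w = begin
    exactly (suc (w ℕ.+ a)) (suc t)
      ≈⟨ partsFrom-step (ℕ._≟ suc t) (w ℕ.+ a) ⟩
    rest ⊕ X (suc (w ℕ.+ a)) ⊛ partsFrom (suc (w ℕ.+ a)) ((ℕ._≟ suc t) ∘ suc)
      ≈⟨ ⊕-cong ≈-refl (⊛-congˡ (X (suc (w ℕ.+ a))) (≈-trans
           (gf-cong _ _ (λ _ (desc , y≥ , r) → desc , y≥ , ℕ.suc-injective r)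
                        (λ _ (desc , y≥ , r) → desc , y≥ , cong suc r))
           (exactly≈ t (w ℕ.+ a)))) ⟩
    rest ⊕ X (suc (w ℕ.+ a)) ⊛ (X (t ℕ.* suc (w ℕ.+ a)) ⊛ invPoch t)
      ≈⟨ ⊕-comm _ _ ⟩
    X (suc (w ℕ.+ a)) ⊛ (X (t ℕ.* suc (w ℕ.+ a)) ⊛ invPoch t) ⊕ rest
      ≈⟨ ⊕-cong (≈-trans (≈-sym (⊛-assoc _ _ _)) (⊛-congʳ (invPoch t) (exponent w))) ≈-refl ⟩
    X w ⊛ (X (suc t ℕ.* suc a) ⊛ X (t ℕ.* w)) ⊛ invPoch t ⊕ rest
      ≈⟨ ⊕-cong (solve 4 (λ w x y i → w :* (x :* y) :* i := w :* (x :* i :* (y :* con 1ℤ))) ≈-refl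
           (X w) (X (suc t ℕ.* suc a)) (X (t ℕ.* w)) (invPoch t)) ≈-refl ⟩
    X w ⊛ (X (suc t ℕ.* suc a) ⊛ invPoch t ⊛ (X (t ℕ.* w) ⊛ 𝟙)) ⊕ rest ∎
    where rest = exactly (2 ℕ.+ (w ℕ.+ a)) (suc t)

  small : ∀ w → q^ w ∣ exactly (suc (w ℕ.+ a)) (suc t)
  small w = gf-divisible _ w λ
    { {y ∷ ys} _ (_ , y> ∷ _ , _) → ℕ.≤-trans (ℕ.m≤n⇒m≤1+n (ℕ.m≤m+n w a)) (ℕ.≤-trans y> (ℕ.m≤m+n y (sum ys)))
    ; {[]} _ (_ , _ , ()) }

atLeast-suc : ∀ t a → atLeast a t ≈ exactly a t ⊕ atLeast a (suc t)
atLeast-suc t a = gf-⊎ _ _ _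
  (λ _ (desc , y≥ , t≤) → Sum.map (λ t≡ → desc , y≥ , sym t≡) (λ t< → desc , y≥ , t<)
    (Sum.swap (ℕ.m≤n⇒m<n∨m≡n t≤)))
  (λ _ (desc , y≥ , r) → desc , y≥ , ℕ.≤-reflexive (sym r))
  (λ _ (desc , y≥ , t<) → desc , y≥ , ℕ.<⇒≤ t<)
  (λ _ (_ , _ , t<) (_ , _ , r) → ℕ.<-irrefl (sym r) t<)

atLeast-step : ∀ t a → atLeast (suc a) (suc t) ≈ atLeast (2 ℕ.+ a) (suc t) ⊕ X (suc a) ⊛ atLeast (suc a) t
atLeast-step t a = ≈-trans (partsFrom-step (suc t ℕ.≤?_) a)
  (⊕-cong ≈-refl (⊛-congˡ (X (suc a)) (gf-cong _ _
    (λ _ (desc , y≥ , r) → desc , y≥ , ℕ.≤-pred r) (λ _ (desc , y≥ , r) → desc , y≥ , s≤s r))))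

module _ where
  private
    R T : ℕ → Series
    R w = invPoch w ⊛ atLeast (suc w) w
    T w = X (w ℕ.* w) ⊛ (invPoch w ⊛ invPoch (suc w))

  -- Passing from w to w + 1 raises both the required number of parts and the least size. The
  -- intermediate class `P` raises only the first: Q - P fixes the number of parts to w, and P - xQ
  -- leaves the parts of size at least w + 2.
  R-step : ∀ w → R w ≈ X w ⊛ T w ⊕ R (suc w)
  R-step w = begin
    invPoch w ⊛ Q
      ≈⟨ ⊛-congʳ Q (invPoch-suc w) ⟨
    (𝟙 ⊖ x) ⊛ I ⊛ Q
      ≈⟨ solve 4 (λ x i q p → (con 1ℤ :- x) :* i :* q := i :* (q :- p) :+ i :* (p :- x :* q)) ≈-refl
           x I Q P ⟩
    I ⊛ (Q ⊖ P) ⊕ I ⊛ (P ⊖ x ⊛ Q)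
      ≈⟨ ⊕-cong (⊛-congˡ I (⊖-cong (atLeast-suc w (suc w)) ≈-refl))
                (⊛-congˡ I (⊖-cong (atLeast-step w w) ≈-refl)) ⟩
    I ⊛ (exactly (suc w) w ⊕ P ⊖ P) ⊕ I ⊛ (atLeast (2 ℕ.+ w) (suc w) ⊕ x ⊛ Q ⊖ x ⊛ Q)
      ≈⟨ ⊕-cong (⊛-congˡ I (solve 2 (λ a b → a :+ b :- b := a) ≈-refl _ P))
                (⊛-congˡ I (solve 2 (λ a b → a :+ b :- b := a) ≈-refl _ (x ⊛ Q))) ⟩
    I ⊛ exactly (suc w) w ⊕ R (suc w)
      ≈⟨ ⊕-cong (⊛-congˡ I (≈-trans (exactly≈ w w) (⊛-congʳ (invPoch w) (X-*-suc w w)))) ≈-refl ⟩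
    I ⊛ (X w ⊛ X (w ℕ.* w) ⊛ invPoch w) ⊕ R (suc w)
      ≈⟨ ⊕-cong (solve 4 (λ i x s j → i :* (x :* s :* j) := x :* (s :* (j :* i))) ≈-refl
           I (X w) (X (w ℕ.* w)) (invPoch w)) ≈-refl ⟩
    X w ⊛ T w ⊕ R (suc w) ∎
    where
    open ≈-Reasoning
    x = X (suc w)
    I = invPoch (suc w)
    Q = atLeast (suc w) w
    P = atLeast (suc w) (suc w)

  R-small : ∀ w → q^ w ∣ R w
  R-small w = ∣-⊛ (invPoch w) (gf-divisible _ w λ pos (_ , _ , w≤) → ℕ.≤-trans w≤ (length≤sum pos))

  -- Summation by parts.
  [1-q]∑atLeast : (𝟙 ⊖ X 1) ⊛ ∑q (λ w → invPoch w ⊛ atLeast (suc w) w) ≈ durfee 0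
  [1-q]∑atLeast = begin
    (𝟙 ⊖ X 1) ⊛ ∑q R
      ≈⟨ solve 2 (λ x s → (con 1ℤ :- x) :* s := s :- x :* s) ≈-refl (X 1) (∑q R) ⟩
    ∑q R ⊖ X 1 ⊛ ∑q R
      ≈⟨ ⊖-cong (∑q-unfold R) ≈-refl ⟩
    R 0 ⊕ X 1 ⊛ ∑q (R ∘ suc) ⊖ X 1 ⊛ ∑q R
      ≈⟨ solve 4 (λ r x s t → r :+ x :* s :- x :* t := r :- x :* (t :- s)) ≈-refl
           (R 0) (X 1) (∑q (R ∘ suc)) (∑q R) ⟩
    R 0 ⊖ X 1 ⊛ (∑q R ⊖ ∑q (R ∘ suc))
      ≈⟨ ⊖-cong (telescope R T R-step R-small)
           (≈-trans (⊛-congˡ (X 1) (≈-sym (∑q-⊖ R (R ∘ suc)))) (∑q-⊛ (X 1) _)) ⟩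
    ∑q T ⊖ ∑q (λ w → X 1 ⊛ (R w ⊖ R (suc w)))
      ≈⟨ ∑q-⊖ _ _ ⟨
    ∑q (λ w → T w ⊖ X 1 ⊛ (R w ⊖ R (suc w)))
      ≈⟨ ∑q-cong term ⟩
    durfee 0 ∎
    where
    open ≈-Reasoning
    -- The `T w` in front comes from the boundary term `R 0`, itself expanded as `∑q T`. Since q (R
    -- w - R (w+1)) is q^{w+1} T w, a factor 1 - q^{w+1} appears and turns 1/(q)_{w+1} into 1/(q)_w.
    term : ∀ w → T w ⊖ X 1 ⊛ (R w ⊖ R (suc w)) ≈ X 0 ⊛ durfeeTerm w
    term w = begin
      T w ⊖ X 1 ⊛ (R w ⊖ R (suc w))
        ≈⟨ ⊖-cong ≈-refl (⊛-congˡ (X 1) (⊖-cong (R-step w) ≈-refl)) ⟩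
      s ⊛ (i ⊛ I) ⊖ X 1 ⊛ (X w ⊛ (s ⊛ (i ⊛ I)) ⊕ R (suc w) ⊖ R (suc w))
        ≈⟨ solve 6 (λ s i I o x r → s :* (i :* I) :- o :* (x :* (s :* (i :* I)) :+ r :- r) :=
             s :* (i :* ((con 1ℤ :- o :* x) :* I))) ≈-refl s i I (X 1) (X w) (R (suc w)) ⟩
      s ⊛ (i ⊛ ((𝟙 ⊖ X 1 ⊛ X w) ⊛ I))
        ≈⟨ ⊛-congˡ s (⊛-congˡ i (≈-trans (⊛-congʳ I (⊖-cong ≈-refl (≈-sym (X-+ 1 w)))) (invPoch-suc w))) ⟩
      durfeeTerm w
        ≈⟨ ≈-trans (⊛-congʳ (durfeeTerm w) X0) (⊛-identityˡ _) ⟨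
      X 0 ⊛ durfeeTerm w ∎
      where
      s = X (w ℕ.* w)
      i = invPoch w
      I = invPoch (suc w)

-- Generating functions of the crank classes

nonnegativeCrank-gf : gf (λ y → descending? y ×-dec ω y ℕ.≤? μ y) ≈ durfee 0
nonnegativeCrank-gf = begin
  gf (λ y → descending? y ×-dec ω y ℕ.≤? μ y)
    ≈⟨ ωμ-gf (λ w → w ℕ.≤?_) ⟩
  ∑q (λ w → partsAbove 2 w (w ℕ.≤?_))
    ≈⟨ ∑q-cong term ⟩
  ∑q (λ w → (𝟙 ⊖ X 1) ⊛ (invPoch w ⊛ atLeast (suc w) w))
    ≈⟨ ∑q-⊛ (𝟙 ⊖ X 1) _ ⟨
  (𝟙 ⊖ X 1) ⊛ ∑q (λ w → invPoch w ⊛ atLeast (suc w) w)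
    ≈⟨ [1-q]∑atLeast ⟩
  durfee 0 ∎
  where
  open ≈-Reasoning
  term : ∀ w → partsAbove 2 w (w ℕ.≤?_) ≈ (𝟙 ⊖ X 1) ⊛ (invPoch w ⊛ atLeast (suc w) w)
  term (suc w) = partsAbove-2 (suc w ℕ.≤?_) w
  -- With w = 0 a part 1 would count as lying above w, so the ones are removed through
  -- `partsFrom-step` instead.
  term zero    = begin
    partsAbove 2 0 (0 ℕ.≤?_)
      ≈⟨ partsAbove≈partsFrom (0 ℕ.≤?_) 2 0 (s≤s z≤n) ⟩
    atLeast 2 0
      ≈⟨ solve 2 (λ a b → a := a :+ b :- b) ≈-refl (atLeast 2 0) (X 1 ⊛ atLeast 1 0) ⟩
    atLeast 2 0 ⊕ X 1 ⊛ atLeast 1 0 ⊖ X 1 ⊛ atLeast 1 0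
      ≈⟨ ⊖-cong (≈-trans (partsFrom-step (0 ℕ.≤?_) 0) (⊕-cong ≈-refl (⊛-congˡ (X 1)
           (gf-cong _ _ (λ _ (desc , y≥ , _) → desc , y≥ , z≤n)
                        (λ _ (desc , y≥ , _) → desc , y≥ , z≤n))))) ≈-refl ⟨
    atLeast 1 0 ⊖ X 1 ⊛ atLeast 1 0
      ≈⟨ solve 2 (λ x a → a :- x :* a := (con 1ℤ :- x) :* (con 1ℤ :* a)) ≈-refl
           (X 1) (atLeast 1 0) ⟩
    (𝟙 ⊖ X 1) ⊛ (𝟙 ⊛ atLeast 1 0) ∎

-- The terms with w ≥ 1 carry the factor 1 - q, but the term w = 0 is the empty partition and
-- contributes a bare 1. Writing 1 = (1 - q) + q produces the extra q.
zeroCrank-gf : gf (λ y → descending? y ×-dec μ y ℕ.≟ ω y) ≈ (𝟙 ⊖ X 1) ⊛ durfee 1 ⊕ X 1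
zeroCrank-gf = begin
  gf (λ y → descending? y ×-dec μ y ℕ.≟ ω y)
    ≈⟨ ωμ-gf (λ w → ℕ._≟ w) ⟩
  ∑q (λ w → partsAbove 2 w (ℕ._≟ w))
    ≈⟨ ∑q-unfold _ ⟩
  partsAbove 2 0 (ℕ._≟ 0) ⊕ X 1 ⊛ ∑q (λ w → partsAbove 2 (suc w) (ℕ._≟ suc w))
    ≈⟨ ⊕-cong (≈-trans (partsAbove≈partsFrom (ℕ._≟ 0) 2 0 (s≤s z≤n)) (exactly≈ 0 1))
              (⊛-congˡ (X 1) (≈-trans (∑q-cong λ w →
                 ≈-trans (partsAbove-2 (ℕ._≟ suc w) w) (⊛-congˡ (𝟙 ⊖ X 1) (term w)))
                                      (≈-sym (∑q-⊛ (𝟙 ⊖ X 1) _)))) ⟩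
  X 0 ⊛ 𝟙 ⊕ X 1 ⊛ ((𝟙 ⊖ X 1) ⊛ s)
    ≈⟨ ⊕-cong (⊛-congʳ 𝟙 X0) ≈-refl ⟩
  𝟙 ⊛ 𝟙 ⊕ X 1 ⊛ ((𝟙 ⊖ X 1) ⊛ s)
    ≈⟨ solve 2 (λ x s → let o = con 1ℤ in
         o :* o :+ x :* ((o :- x) :* s) := (o :- x) :* (o :* (o :* (o :* o)) :+ x :* s) :+ x) ≈-refl
         (X 1) s ⟩
  (𝟙 ⊖ X 1) ⊛ (𝟙 ⊛ (𝟙 ⊛ (𝟙 ⊛ 𝟙)) ⊕ X 1 ⊛ s) ⊕ X 1
    ≈⟨ ⊕-cong (⊛-congˡ (𝟙 ⊖ X 1) (≈-trans (∑q-unfold _)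
         (⊕-cong (⊛-cong X0 (⊛-congʳ (𝟙 ⊛ 𝟙) X0)) ≈-refl))) ≈-refl ⟨
  (𝟙 ⊖ X 1) ⊛ durfee 1 ⊕ X 1 ∎
  where
  open ≈-Reasoning
  s = ∑q (λ w → X (1 ℕ.* suc w) ⊛ durfeeTerm (suc w))
  term : ∀ w → invPoch (suc w) ⊛ exactly (2 ℕ.+ w) (suc w) ≈ X (1 ℕ.* suc w) ⊛ durfeeTerm (suc w)
  term w = begin
    I ⊛ exactly (2 ℕ.+ w) (suc w)
      ≈⟨ ⊛-congˡ I (≈-trans (exactly≈ (suc w) (suc w)) (⊛-congʳ I (X-*-suc (suc w) (suc w)))) ⟩
    I ⊛ (X (suc w) ⊛ X (suc w ℕ.* suc w) ⊛ I)
      ≈⟨ solve 3 (λ i x s → i :* (x :* s :* i) := x :* (s :* (i :* i))) ≈-refl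
           I (X (suc w)) (X (suc w ℕ.* suc w)) ⟩
    X (suc w) ⊛ durfeeTerm (suc w)
      ≈⟨ ⊛-congʳ (durfeeTerm (suc w)) (X-cong (ℕ.*-identityˡ (suc w))) ⟨
    X (1 ℕ.* suc w) ⊛ durfeeTerm (suc w) ∎
    where I = invPoch (suc w)

-- Unimodal compositions

-- Unimodality by recursion on the list instead of a peak position, suited to peeling at either end.
-- Equal neighbours allow several derivations, which is harmless since only existence is used.
data Hill : List ℕ → Set where
  descent : ∀ {x xs} → Descending (x ∷ xs) → Hill (x ∷ xs)
  _∷_     : ∀ {x y ys} → x ℕ.≤ y → Hill (y ∷ ys) → Hill (x ∷ y ∷ ys)

unimodal⇒hill : ∀ {y} → Unimodal y → Hill y
unimodal⇒hill {x ∷ xs}     (zero  , _ , desc)        = descent desc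
unimodal⇒hill {x ∷ y ∷ ys} (suc i , x≤y ∷ asc , desc) = x≤y ∷ unimodal⇒hill (i , asc , desc)

hill⇒unimodal : ∀ {y} → Hill y → Unimodal y
hill⇒unimodal (descent desc) = zero , [-] , desc
hill⇒unimodal (x≤y ∷ hill) with hill⇒unimodal hill
... | i , asc , desc = suc i , x≤y ∷ asc , desc

hill-tail : ∀ {x y ys} → Hill (x ∷ y ∷ ys) → Hill (y ∷ ys)
hill-tail (descent desc) = descent (Linked.tail desc)
hill-tail (_ ∷ hill)     = hill

hill-∷ʳ⁻ : ∀ {x} xs {a} → Hill (x ∷ xs ∷ʳ a) → Hill (x ∷ xs)
hill-∷ʳ⁻     []       _              = descent [-]
hill-∷ʳ⁻ {x} (y ∷ ys) (descent desc) = descent (proj₁ (descending-∷ʳ⁻ (x ∷ y ∷ ys) desc))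
hill-∷ʳ⁻     (y ∷ ys) (x≤y ∷ hill)   = x≤y ∷ hill-∷ʳ⁻ ys hill

hill-∷ʳ⁺ : ∀ {x xs a} → Hill (x ∷ xs) → All (ℕ._≥ a) (x ∷ xs) → Hill (x ∷ xs ∷ʳ a)
hill-∷ʳ⁺ (descent desc) all≥a        = descent (descending-∷ʳ⁺ desc all≥a)
hill-∷ʳ⁺ (x≤y ∷ hill)   (_ ∷ all≥a)  = x≤y ∷ hill-∷ʳ⁺ hill all≥a

-- A unimodal sequence attains its minimum at one of its ends.
hill-> : ∀ {x} xs {z b} → Hill (x ∷ xs ∷ʳ z) → b ℕ.< x → b ℕ.< z → All (ℕ._> b) (x ∷ xs ∷ʳ z)
hill->     []       _              b<x b<z = b<x ∷ b<z ∷ []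
hill-> {x} (y ∷ ys) (descent desc) b<x b<z =
  All.∷ʳ⁺ (All.map (ℕ.≤-trans b<z) (proj₂ (descending-∷ʳ⁻ (x ∷ y ∷ ys) desc))) b<z
hill->     (y ∷ ys) (x≤y ∷ hill)   b<x b<z = b<x ∷ hill-> ys hill (ℕ.≤-trans b<x x≤y) b<z

opaque

  peakMultiplicity : List ℕ → ℕ
  peakMultiplicity y = multiplicity (largestPart y) y

  peakMultiplicity≡ : ∀ y → peakMultiplicity y ≡ multiplicity (largestPart y) y
  peakMultiplicity≡ y = refl

module _ {b xs} (some>b : Any (ℕ._> b) xs) where

  private
    l = largestPart xs

    b<l : b ℕ.< l
    b<l = v<max⁺ 0 xs (inj₂ some>b)

    peakMultiplicity-unchanged : ∀ ys → All (ℕ._≤ l) ys → xs ⊆ ys → multiplicity l ys ≡ multiplicity l xs →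
                                 peakMultiplicity ys ≡ peakMultiplicity xs
    peakMultiplicity-unchanged ys ys≤l xs⊆ys mult≡ = begin
      peakMultiplicity ys                ≡⟨ peakMultiplicity≡ ys ⟩
      multiplicity (largestPart ys) ys   ≡⟨ cong (λ i → multiplicity i ys)
                                              (ℕ.≤-antisym (max≤v⁺ z≤n ys≤l) (max-mono-⊆ {xs = xs} z≤n xs⊆ys)) ⟩
      multiplicity l ys                  ≡⟨ mult≡ ⟩
      multiplicity l xs                  ≡⟨ peakMultiplicity≡ xs ⟨
      peakMultiplicity xs                ∎
      where open ≡-Reasoning

  -- As `xs` has a part above b, the added b stays below the maximum and affects neither its value
  -- nor its multiplicity.
  peakMultiplicity-∷ : peakMultiplicity (b ∷ xs) ≡ peakMultiplicity xs
  peakMultiplicity-∷ = peakMultiplicity-unchanged (b ∷ xs) (ℕ.<⇒≤ b<l ∷ xs≤max 0 xs) there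
    (cong length (filter-reject (ℕ._≟ l) (ℕ.<⇒≢ b<l)))

  peakMultiplicity-∷ʳ : peakMultiplicity (xs ∷ʳ b) ≡ peakMultiplicity xs
  peakMultiplicity-∷ʳ = peakMultiplicity-unchanged (xs ∷ʳ b) (All.∷ʳ⁺ (xs≤max 0 xs) (ℕ.<⇒≤ b<l)) ∈-++⁺ˡ
    (cong length (trans (filter-++ (ℕ._≟ l) xs (b ∷ []))
      (trans (cong (filter (ℕ._≟ l) xs ++_) (filter-reject (ℕ._≟ l) (ℕ.<⇒≢ b<l))) (++-identityʳ _))))

module _ {M : Pred ℕ 0ℓ} (M? : Decidable M) where

  -- `M` is the equation with m + 1 for u_{m+1}, and always true for u_0.
  PeakFrom : ℕ → Pred (List ℕ) 0ℓ
  PeakFrom b y = Unimodal y × All (ℕ._≥ b) y × M (peakMultiplicity y)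

  peakFrom? : ∀ b → Decidable (PeakFrom b)
  peakFrom? b y = unimodal? y ×-dec all? (ℕ._≥? b) y ×-dec M? (peakMultiplicity y)

  flat? : ∀ b → Decidable (λ y → PeakFrom b y × All (ℕ._≤ b) y)
  flat? b y = peakFrom? b y ×-dec all? (ℕ._≤? b) y

  -- The class in which a part b at an end can be peeled without touching the peak. In the
  -- complementary flat class b is itself the peak.
  Steep : ℕ → Pred (List ℕ) 0ℓ
  Steep b y = PeakFrom b y × Any (ℕ._> b) y

  steep? : ∀ b → Decidable (Steep b)
  steep? b y = peakFrom? b y ×-dec any? (ℕ._>? b) y

  HeadAbove : ℕ → Pred (List ℕ) 0ℓ
  HeadAbove b []      = ⊥
  HeadAbove b (x ∷ _) = b ℕ.< x

  headAbove? : ∀ b → Decidable (HeadAbove b)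
  headAbove? b []      = no λ ()
  headAbove? b (x ∷ _) = b ℕ.<? x

  leftSteep? : ∀ b → Decidable (λ y → PeakFrom b y × HeadAbove b y)
  leftSteep? b y = peakFrom? b y ×-dec headAbove? b y

  private
    headAbove⇒any : ∀ {b} y → HeadAbove b y → Any (ℕ._> b) y
    headAbove⇒any (_ ∷ _) b<x = here b<x

  flat-or-steep : ∀ b → gf (peakFrom? b) ≈ gf (flat? b) ⊕ gf (steep? b)
  flat-or-steep b = gf-⊎ (peakFrom? b) (flat? b) (steep? b) to (λ _ → proj₁) (λ _ → proj₁)
    (λ _ (_ , any>) (_ , all≤) → All.All¬⇒¬Any (All.map ℕ.≤⇒≯ all≤) any>)
    where
    to : ∀ {y} → Positive y → PeakFrom b y → (PeakFrom b y × All (ℕ._≤ b) y) ⊎ Steep b y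
    to {y} _ p with any? (ℕ._>? b) y
    ... | yes any> = inj₂ (p , any>)
    ... | no ¬any> = inj₁ (p , All.map ℕ.≮⇒≥ (All.¬Any⇒All¬ y ¬any>))

  strip-left : ∀ a → gf (steep? (suc a)) ≈ gf (leftSteep? (suc a)) ⊕ X (suc a) ⊛ gf (steep? (suc a))
  strip-left a = gf-split (steep? b) (leftSteep? b) (steep? b) (cons {b} (s≤s z≤n)) to
    (λ {y} _ (p , h) → p , headAbove⇒any y h) from
    (λ _ _ (_ , b<b) → ℕ.<-irrefl refl b<b)
    where
    b = suc a

    to : ∀ {y} → Positive y → Steep b y → (PeakFrom b y × HeadAbove b y) ⊎ ∃ λ x → Steep b x × y ≡ b ∷ x
    to {x ∷ xs} _ ((uni , x≥b ∷ xs≥b , m) , any>) with ℕ.m≤n⇒m<n∨m≡n x≥b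
    ... | inj₁ b<x = inj₁ ((uni , x≥b ∷ xs≥b , m) , b<x)
    to {x ∷ y ∷ ys} _ ((uni , x≥b ∷ xs≥b , m) , there any>) | inj₂ refl = inj₂ (y ∷ ys
      , ((hill⇒unimodal (hill-tail (unimodal⇒hill uni)) , xs≥b
        , subst M (peakMultiplicity-∷ any>) m) , any>) , refl)
    to {x ∷ xs} _ (_ , here b<b) | inj₂ refl = contradiction b<b (ℕ.<-irrefl refl)

    from : ∀ {x} → Positive x → Steep b x → Steep b (b ∷ x)
    from {x ∷ xs} _ ((uni , x≥b ∷ xs≥b , m) , any>) =
      (hill⇒unimodal (x≥b ∷ unimodal⇒hill uni) , ℕ.≤-refl ∷ x≥b ∷ xs≥b
      , subst M (sym (peakMultiplicity-∷ any>)) m) , there any>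

  -- Once the head lies above b, a last part b belongs to the right slope, and removing it leaves a
  -- nonempty list. If the last part lies above b too, `hill->` puts every part above b.
  strip-right : ∀ a → gf (leftSteep? (suc a)) ≈ gf (peakFrom? (2 ℕ.+ a)) ⊕ X (suc a) ⊛ gf (leftSteep? (suc a))
  strip-right a = gf-split (leftSteep? b) (peakFrom? (suc b)) (leftSteep? b) (snoc {b} (s≤s z≤n)) to from₁ from₂
    (λ {x} _ _ (_ , all> , _) → ℕ.<-irrefl refl (proj₂ (All.∷ʳ⁻ {xs = x} all>)))
    where
    b = suc a

    LeftSteep : Pred (List ℕ) 0ℓ
    LeftSteep y = PeakFrom b y × HeadAbove b y

    to : ∀ {y} → Positive y → LeftSteep y → PeakFrom (suc b) y ⊎ ∃ λ x → LeftSteep x × y ≡ x ∷ʳ b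
    to {y} _ ((uni , all≥ , m) , b<x) with initLast y
    ... | [] ∷ʳ′ z       = inj₁ (uni , b<x ∷ [] , m)
    ... | (x ∷ xs) ∷ʳ′ z with All.∷ʳ⁻ {xs = x ∷ xs} all≥
    ...   | xs≥b , z≥b with ℕ.m≤n⇒m<n∨m≡n z≥b
    ...     | inj₁ b<z  = inj₁ (uni , hill-> xs (unimodal⇒hill uni) b<x b<z , m)
    ...     | inj₂ refl = inj₂ (x ∷ xs , ((hill⇒unimodal (hill-∷ʳ⁻ xs (unimodal⇒hill uni)) , xs≥b
        , subst M (peakMultiplicity-∷ʳ (here {xs = xs} b<x)) m) , b<x) , refl)

    from₁ : ∀ {y} → Positive y → PeakFrom (suc b) y → LeftSteep y
    from₁ {x ∷ xs} _ (uni , b<x ∷ all> , m) = (uni , All.map ℕ.<⇒≤ (b<x ∷ all>) , m) , b<x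

    from₂ : ∀ {x} → Positive x → LeftSteep x → LeftSteep (x ∷ʳ b)
    from₂ {x ∷ xs} _ ((uni , all≥ , m) , b<x) =
      (hill⇒unimodal (hill-∷ʳ⁺ (unimodal⇒hill uni) all≥) , All.∷ʳ⁺ all≥ ℕ.≤-refl
      , subst M (sym (peakMultiplicity-∷ʳ (here {xs = xs} b<x))) m) , b<x

  peakFrom-step : ∀ a → gf (peakFrom? (suc a)) ≈
    gf (flat? (suc a)) ⊕ geometric a ⊛ (geometric a ⊛ gf (peakFrom? (2 ℕ.+ a)))
  peakFrom-step a = ≈-trans (flat-or-steep (suc a)) (⊕-cong ≈-refl (≈-trans
    (geometric-unique a (≈-trans (strip-left a) (⊕-comm _ _)))
    (⊛-congˡ (geometric a) (geometric-unique a (≈-trans (strip-right a) (⊕-comm _ _))))))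

  -- The peak has size w + 1, and 1/(q)_w² chooses the parts 1, ..., w on its two slopes. The flat
  -- series is given with q^w taken out, as `∑q` requires.
  peakFrom-1 : ∀ (s : ℕ → Series) → (∀ w → gf (flat? (suc w)) ≈ X w ⊛ s w) →
    gf (peakFrom? 1) ≈ ∑q (λ w → s w ⊛ invPoch² w)
  peakFrom-1 s flat≈ = ≈-trans (solve 1 (λ p → p := con 1ℤ :* con 1ℤ :* p) ≈-refl
       (gf (peakFrom? 1)))
    (telescope (λ w → invPoch² w ⊛ gf (peakFrom? (suc w))) (λ w → s w ⊛ invPoch² w) step small)
    where
    open ≈-Reasoning
    step : ∀ w → invPoch² w ⊛ gf (peakFrom? (suc w)) ≈
      X w ⊛ (s w ⊛ invPoch² w) ⊕ invPoch² (suc w) ⊛ gf (peakFrom? (2 ℕ.+ w))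
    step w = begin
      i ⊛ i ⊛ gf (peakFrom? (suc w))
        ≈⟨ ⊛-congˡ (i ⊛ i) (≈-trans (peakFrom-step w) (⊕-cong (flat≈ w) ≈-refl)) ⟩
      i ⊛ i ⊛ (X w ⊛ s w ⊕ g ⊛ (g ⊛ gf (peakFrom? (2 ℕ.+ w))))
        ≈⟨ solve 5 (λ i g x s p →
           i :* i :* (x :* s :+ g :* (g :* p)) := x :* (s :* (i :* i)) :+ i :* g :* (i :* g) :* p) ≈-refl
             i g (X w) (s w) (gf (peakFrom? (2 ℕ.+ w))) ⟩
      X w ⊛ (s w ⊛ invPoch² w) ⊕ invPoch² (suc w) ⊛ gf (peakFrom? (2 ℕ.+ w)) ∎
      where
      i = invPoch w
      g = geometric w

    small : ∀ w → q^ w ∣ invPoch² w ⊛ gf (peakFrom? (suc w))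
    small w = ∣-⊛ (invPoch² w) (gf-divisible _ w
      λ { {x ∷ xs} _ (_ , w<x ∷ _ , _) → ℕ.≤-trans (ℕ.<⇒≤ w<x) (ℕ.m≤m+n x (sum xs)) })

private
  flat≡replicate : ∀ {b} y → All (ℕ._≥ b) y → All (ℕ._≤ b) y → y ≡ replicate (length y) b
  flat≡replicate []       _          _          = refl
  flat≡replicate (x ∷ xs) (x≥b ∷ ≥b) (x≤b ∷ ≤b) = cong₂ _∷_ (ℕ.≤-antisym x≤b x≥b) (flat≡replicate xs ≥b ≤b)

descending-replicate : ∀ n {b} → Descending (replicate n b)
descending-replicate zero          = []
descending-replicate (suc zero)    = [-]
descending-replicate (suc (suc n)) = ℕ.≤-refl ∷ descending-replicate (suc n)

unimodal-replicate : ∀ n {b} → Unimodal (replicate (suc n) b)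
unimodal-replicate n = hill⇒unimodal (descent (descending-replicate (suc n)))

peakMultiplicity-replicate : ∀ n {b} → peakMultiplicity (replicate (suc n) b) ≡ suc n
peakMultiplicity-replicate n {b} = begin
  peakMultiplicity ys                ≡⟨ peakMultiplicity≡ ys ⟩
  multiplicity (largestPart ys) ys   ≡⟨ cong (λ l → multiplicity l ys) largest ⟩
  multiplicity b ys
    ≡⟨ cong length (filter-all (ℕ._≟ b) (All.replicate⁺ (suc n) refl)) ⟩
  length ys                          ≡⟨ length-replicate (suc n) ⟩
  suc n                              ∎
  where
  open ≡-Reasoning
  ys = replicate (suc n) b
  largest : largestPart ys ≡ b
  largest = max≈v⁺ (here refl) (All.replicate⁺ (suc n) ℕ.≤-refl) z≤n

sum-replicate : ∀ n b → sum (replicate n b) ≡ n ℕ.* b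
sum-replicate zero    b = refl
sum-replicate (suc n) b = cong (b ℕ.+_) (sum-replicate n b)

-- A plateau of m + 1 parts w + 1 has size w + (m+1) + mw: the first summand is the weight of `∑q`,
-- the second the shift built into u_{m+1}, the third the exponent in `peaks m`.
peaks-gf : ∀ m → gf (peakFrom? (ℕ._≟ suc m) 1) ≈ X (suc m) ⊛ peaks m
peaks-gf m = begin
  gf (peakFrom? M? 1)
    ≈⟨ peakFrom-1 M? (λ w → X (suc m) ⊛ X (m ℕ.* w)) flat ⟩
  ∑q (λ w → X (suc m) ⊛ X (m ℕ.* w) ⊛ invPoch² w)
    ≈⟨ ∑q-cong (λ w → ⊛-assoc (X (suc m)) (X (m ℕ.* w)) (invPoch² w)) ⟩
  ∑q (λ w → X (suc m) ⊛ (X (m ℕ.* w) ⊛ invPoch² w))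
    ≈⟨ ∑q-⊛ (X (suc m)) _ ⟨
  X (suc m) ⊛ peaks m ∎
  where
  open ≈-Reasoning
  M? = ℕ._≟ suc m
  flat : ∀ w → gf (flat? M? (suc w)) ≈ X w ⊛ (X (suc m) ⊛ X (m ℕ.* w))
  flat w = begin
    gf (flat? M? (suc w))
      ≈⟨ gf-singleton (flat? M? (suc w)) (replicate (suc m) (suc w)) (All.replicate⁺ (suc m) (s≤s z≤n))
           ((unimodal-replicate m , All.replicate⁺ (suc m) ℕ.≤-refl , peakMultiplicity-replicate m)
           , All.replicate⁺ (suc m) ℕ.≤-refl)
           (λ {y} _ ((uni , ≥w , mult) , ≤w) → only y uni ≥w ≤w mult) ⟩
    X (sum (replicate (suc m) (suc w)))
      ≈⟨ X-cong (trans (sum-replicate (suc m) (suc w)) (rearrange m w)) ⟩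
    X (w ℕ.+ (suc m ℕ.+ m ℕ.* w))
      ≈⟨ ≈-trans (X-+ w _) (⊛-congˡ (X w) (X-+ (suc m) (m ℕ.* w))) ⟩
    X w ⊛ (X (suc m) ⊛ X (m ℕ.* w)) ∎
    where
    only : ∀ y → Unimodal y → All (ℕ._≥ suc w) y → All (ℕ._≤ suc w) y → peakMultiplicity y ≡ suc m →
           y ≡ replicate (suc m) (suc w)
    only []       ()
    only (x ∷ xs) _ ≥w ≤w mult = trans y≡ (cong (λ n → replicate n (suc w))
      (trans (sym (trans (cong peakMultiplicity y≡) (peakMultiplicity-replicate (length xs)))) mult))
      where y≡ = flat≡replicate (x ∷ xs) ≥w ≤w

    rearrange : ∀ m w → suc m ℕ.* suc w ≡ w ℕ.+ (suc m ℕ.+ m ℕ.* w)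
    rearrange = ℕ-solve-∀

anyPeak? : Decidable {A = ℕ} (λ _ → ⊤)
anyPeak? _ = yes tt

-- A plateau of any positive length contributes q^{w+1}/(1 - q^{w+1}). Over (q)_w² this equals
-- q^{w+1} (1 - q^{w+1})/(q)_{w+1}², the term of index w + 1 in A_1 - A_2.
unimodal-gf : gf (peakFrom? anyPeak? 1) ≈ peaks 0 ⊖ peaks 1
unimodal-gf = begin
  gf (peakFrom? anyPeak? 1)
    ≈⟨ peakFrom-1 anyPeak? (λ w → X 1 ⊛ geometric w) flat ⟩
  ∑q (λ w → X 1 ⊛ geometric w ⊛ invPoch² w)
    ≈⟨ ∑q-cong term ⟩
  ∑q (λ w → X 1 ⊛ (X 0 ⊛ ((𝟙 ⊖ X (suc w)) ⊛ invPoch² (suc w))))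
    ≈⟨ ∑q-⊛ (X 1) _ ⟨
  X 1 ⊛ dilate (λ w → (𝟙 ⊖ X (suc w)) ⊛ invPoch² (suc w)) 0
    ≈⟨ dilate-Δ invPoch² 0 ⟨
  peaks 0 ⊖ peaks 1 ∎
  where
  open ≈-Reasoning
  term : ∀ w → X 1 ⊛ geometric w ⊛ invPoch² w ≈ X 1 ⊛ (X 0 ⊛ ((𝟙 ⊖ X (suc w)) ⊛ invPoch² (suc w)))
  term w = begin
    X 1 ⊛ g ⊛ (i ⊛ i)
      ≈⟨ solve 3 (λ x g i → x :* g :* (i :* i) := x :* (con 1ℤ :* (i :* (i :* g)))) ≈-refl
           (X 1) g i ⟩
    X 1 ⊛ (𝟙 ⊛ (i ⊛ I))
      ≈⟨ ⊛-congˡ (X 1) (⊛-cong X0 (⊛-congʳ I (invPoch-suc w))) ⟨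
    X 1 ⊛ (X 0 ⊛ ((𝟙 ⊖ X (suc w)) ⊛ I ⊛ I))
      ≈⟨ ⊛-congˡ (X 1) (⊛-congˡ (X 0) (⊛-assoc (𝟙 ⊖ X (suc w)) I I)) ⟩
    X 1 ⊛ (X 0 ⊛ ((𝟙 ⊖ X (suc w)) ⊛ (I ⊛ I))) ∎
    where
    g = geometric w
    i = invPoch w
    I = invPoch (suc w)

  flat : ∀ w → gf (flat? anyPeak? (suc w)) ≈ X w ⊛ (X 1 ⊛ geometric w)
  flat w = begin
    gf (flat? anyPeak? (suc w))
      ≈⟨ geometric-unique w (≈-trans strip (⊕-comm _ _)) ⟩
    geometric w ⊛ gf single?
      ≈⟨ ⊛-congˡ (geometric w) (≈-trans (gf-singleton single? (suc w ∷ []) (s≤s z≤n ∷ []) refl (λ _ → id))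
           (≈-trans (X-cong (trans (ℕ.+-identityʳ (suc w)) (ℕ.+-comm 1 w))) (X-+ w 1))) ⟩
    geometric w ⊛ (X w ⊛ X 1)
      ≈⟨ solve 3 (λ g x o → g :* (x :* o) := x :* (o :* g)) ≈-refl (geometric w) (X w) (X 1) ⟩
    X w ⊛ (X 1 ⊛ geometric w) ∎
    where
    single? : Decidable (_≡ suc w ∷ [])
    single? y = ≡-dec ℕ._≟_ y (suc w ∷ [])

    Flat : Pred (List ℕ) 0ℓ
    Flat y = PeakFrom anyPeak? (suc w) y × All (ℕ._≤ suc w) y

    to : ∀ {y} → Positive y → Flat y → y ≡ suc w ∷ [] ⊎ ∃ λ x → Flat x × y ≡ suc w ∷ x
    to {x ∷ []}     _ ((_ , x≥ ∷ [] , _) , x≤ ∷ [])        = inj₁ (cong (_∷ []) (ℕ.≤-antisym x≤ x≥))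
    to {x ∷ y ∷ ys} _ ((uni , x≥ ∷ ys≥ , _) , x≤ ∷ ys≤) = inj₂ (y ∷ ys
      , ((hill⇒unimodal (hill-tail (unimodal⇒hill uni)) , ys≥ , tt) , ys≤) , cong (_∷ y ∷ ys) (ℕ.≤-antisym x≤ x≥))

    from : ∀ {x} → Positive x → Flat x → Flat (suc w ∷ x)
    from {x ∷ xs} _ ((uni , x≥ ∷ xs≥ , _) , x≤ ∷ xs≤) =
      (hill⇒unimodal (x≥ ∷ unimodal⇒hill uni) , ℕ.≤-refl ∷ x≥ ∷ xs≥ , tt) , ℕ.≤-refl ∷ x≤ ∷ xs≤

    strip : gf (flat? anyPeak? (suc w)) ≈ gf single? ⊕ X (suc w) ⊛ gf (flat? anyPeak? (suc w))
    strip = gf-split (flat? anyPeak? (suc w)) single? (flat? anyPeak? (suc w)) (cons {suc w} (s≤s z≤n)) to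
      (λ { _ refl → (unimodal-replicate 0 , ℕ.≤-refl ∷ [] , tt) , ℕ.≤-refl ∷ [] })
      from
      (λ { {x ∷ xs} _ _ () })

-- The crank

-- μ y is above (ω y) y, so that both occurrences of ω y can be generalised.
crankAt : ℕ → List ℕ → ℤ
crankAt zero      y = + largestPart y
crankAt w@(suc _) y = + above w y - + w

crank≡crankAt : ∀ y → crank y ≡ crankAt (ω y) y
crank≡crankAt y with ω y in ω≡
... | zero  = refl
... | suc w = cong (λ v → + above v y - + suc w) ω≡

crankAt≥0⇒ : ∀ w {y} → 0ℤ ℤ.≤ crankAt w y → w ℕ.≤ above w y
crankAt≥0⇒ zero    _   = z≤n
crankAt≥0⇒ (suc w) c≥0 = ℤ.drop‿+≤+ (ℤ.0≤i-j⇒j≤i c≥0)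

crankAt≥0⇐ : ∀ w {y} → w ℕ.≤ above w y → 0ℤ ℤ.≤ crankAt w y
crankAt≥0⇐ zero    _ = ℤ.+≤+ z≤n
crankAt≥0⇐ (suc w) p = ℤ.i≤j⇒0≤j-i (ℤ.+≤+ p)

private
  largestPart≡0⇒[] : ∀ {y} → Positive y → largestPart y ≡ 0 → y ≡ []
  largestPart≡0⇒[] []            _  = refl
  largestPart≡0⇒[] {x ∷ xs} (x≥1 ∷ _) l≡0 =
    contradiction (subst (0 ℕ.<_) l≡0 (v<max⁺ 0 (x ∷ xs) (inj₂ (here x≥1)))) λ ()

  above-0≡0⇒[] : ∀ {y} → Positive y → above 0 y ≡ 0 → y ≡ []
  above-0≡0⇒[] []          _  = refl
  above-0≡0⇒[] (s≤s _ ∷ _) ()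

-- For w = 0 the crank is the largest part; it vanishes only for the empty list, as does the number
-- of positive parts.
crankAt≡0⇒ : ∀ w {y} → Positive y → crankAt w y ≡ 0ℤ → above w y ≡ w
crankAt≡0⇒ zero    pos c≡0 = cong (above 0) (largestPart≡0⇒[] pos (ℤ.+-injective c≡0))
crankAt≡0⇒ (suc w) pos c≡0 = ℤ.+-injective (ℤ.i-j≡0⇒i≡j _ _ c≡0)

crankAt≡0⇐ : ∀ w {y} → Positive y → above w y ≡ w → crankAt w y ≡ 0ℤ
crankAt≡0⇐ zero    pos p = cong (λ y → + largestPart y) (above-0≡0⇒[] pos p)
crankAt≡0⇐ (suc w) pos p = ℤ.i≡j⇒i-j≡0 (cong +_ p)

crank≥0⇒ : ∀ y → 0ℤ ℤ.≤ crank y → ω y ℕ.≤ μ y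
crank≥0⇒ y c≥0 = crankAt≥0⇒ (ω y) (subst (0ℤ ℤ.≤_) (crank≡crankAt y) c≥0)

crank≥0⇐ : ∀ y → ω y ℕ.≤ μ y → 0ℤ ℤ.≤ crank y
crank≥0⇐ y ω≤μ = subst (0ℤ ℤ.≤_) (sym (crank≡crankAt y)) (crankAt≥0⇐ (ω y) ω≤μ)

crank≡0⇒ : ∀ {y} → Positive y → crank y ≡ 0ℤ → μ y ≡ ω y
crank≡0⇒ {y} pos c≡0 = crankAt≡0⇒ (ω y) pos (trans (sym (crank≡crankAt y)) c≡0)

crank≡0⇐ : ∀ {y} → Positive y → μ y ≡ ω y → crank y ≡ 0ℤ
crank≡0⇐ {y} pos μ≡ω = trans (crank≡crankAt y) (crankAt≡0⇐ (ω y) pos μ≡ω)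

-- The constant terms are unrelated to C m 0, but the convention C₂(1) = −1 is
-- what the factor 1 − q produces.
crankSeries : Fin 3 → Series
crankSeries zero             = durfee 0 ⊖ (𝟙 ⊖ X 1) ⊛ durfee 1
crankSeries (suc zero)       = durfee 0
crankSeries (suc (suc zero)) = (𝟙 ⊖ X 1) ⊛ durfee 1

private
  nonnegative? : Decidable (λ y → Descending y × ω y ℕ.≤ μ y)
  nonnegative? y = descending? y ×-dec ω y ℕ.≤? μ y

  zero? : Decidable (λ y → Descending y × μ y ≡ ω y)
  zero? y = descending? y ×-dec μ y ℕ.≟ ω y

  positive? : Decidable (λ y → Descending y × ω y ℕ.< μ y)
  positive? y = descending? y ×-dec ω y ℕ.<? μ y

  trichotomy : gf nonnegative? ≈ gf zero? ⊕ gf positive?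
  trichotomy = gf-⊎ nonnegative? zero? positive?
    (λ _ (desc , ω≤μ) → Sum.map (λ ω≡μ → desc , sym ω≡μ) (desc ,_) (Sum.swap (ℕ.m≤n⇒m<n∨m≡n ω≤μ)))
    (λ _ (desc , μ≡ω) → desc , ℕ.≤-reflexive (sym μ≡ω))
    (λ _ (desc , ω<μ) → desc , ℕ.<⇒≤ ω<μ)
    (λ _ (_ , ω<μ) (_ , μ≡ω) → ℕ.<-irrefl (sym μ≡ω) ω<μ)

  X⊛𝟙 : X 1 ≈ X 1 ⊛ 𝟙
  X⊛𝟙 = solve 1 (λ x → x := x :* con 1ℤ) ≈-refl (X 1)

  X1-1 : X 1 1 ≡ 1ℤ
  X1-1 = trans (at X⊛𝟙 1) (trans (X-coeff-+ 1 𝟙 0) (constant-zero 1ℤ))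

  X1-≥2 : ∀ n → X 1 (2 ℕ.+ n) ≡ 0ℤ
  X1-≥2 n = trans (at X⊛𝟙 (2 ℕ.+ n)) (trans (X-coeff-+ 1 𝟙 (suc n)) (constant-suc 1ℤ n))

  zeroCrank-coeff : ∀ n → gf zero? n ≡ crankSeries (suc (suc zero)) n ℤ.+ X 1 n
  zeroCrank-coeff n = trans (at zeroCrank-gf n) (⊕-coeff _ _ n)

  +1≡0⇒ : ∀ {i} → 0ℤ ≡ i ℤ.+ 1ℤ → -1ℤ ≡ i
  +1≡0⇒ {i} p = trans (cong (ℤ._+ -1ℤ) p) (cancel i)
    where
    cancel : ∀ i → i ℤ.+ 1ℤ ℤ.+ -1ℤ ≡ i
    cancel = ℤ-solve-∀

-- In degree 1 the only partition has ω = 1 and μ = 0, so the counts of nonnegative and of zero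
-- crank are both 0. The extra q of `zeroCrank-gf` then yields C_2(1) = -1, and C_0(1) = 0 - (-1).
C-coeff : ∀ m n → C m (suc n) ≡ crankSeries m (suc n)
C-coeff (suc zero) zero = trans (sym (gf-coeff nonnegative? 1)) (at nonnegativeCrank-gf 1)
C-coeff (suc zero) (suc n) = trans
  (gf-filter-filter descending? (λ y → 0ℤ ℤ.≤? crank y) (2 ℕ.+ n) nonnegative?
    (λ {y} _ desc c≥0 → desc , crank≥0⇒ y c≥0)
    (λ {y} _ (desc , ω≤μ) → desc , crank≥0⇐ y ω≤μ))
  (at nonnegativeCrank-gf (2 ℕ.+ n))
C-coeff (suc (suc zero)) zero = +1≡0⇒ (begin
  0ℤ                                                ≡⟨ gf-coeff zero? 1 ⟨
  gf zero? 1                                        ≡⟨ zeroCrank-coeff 1 ⟩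
  crankSeries (suc (suc zero)) 1 ℤ.+ X 1 1
    ≡⟨ cong (ℤ._+_ (crankSeries (suc (suc zero)) 1)) X1-1 ⟩
  crankSeries (suc (suc zero)) 1 ℤ.+ 1ℤ             ∎)
  where open ≡-Reasoning
C-coeff (suc (suc zero)) (suc n) = begin
  + (# (λ y → crank y ℤ.≟ 0ℤ) of partitions (2 ℕ.+ n))
    ≡⟨ gf-filter-filter descending? (λ y → crank y ℤ.≟ 0ℤ) (2 ℕ.+ n) zero?
         (λ c desc c≡0 → desc , crank≡0⇒ (positive c) c≡0)
         (λ c (desc , μ≡ω) → desc , crank≡0⇐ (positive c) μ≡ω) ⟩
  gf zero? (2 ℕ.+ n)
    ≡⟨ zeroCrank-coeff (2 ℕ.+ n) ⟩
  crankSeries (suc (suc zero)) (2 ℕ.+ n) ℤ.+ X 1 (2 ℕ.+ n)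
    ≡⟨ cong (ℤ._+_ (crankSeries (suc (suc zero)) (2 ℕ.+ n))) (X1-≥2 n) ⟩
  crankSeries (suc (suc zero)) (2 ℕ.+ n) ℤ.+ 0ℤ
    ≡⟨ ℤ.+-identityʳ _ ⟩
  crankSeries (suc (suc zero)) (2 ℕ.+ n) ∎
  where open ≡-Reasoning
C-coeff zero zero = sym (begin
  crankSeries zero 1                                           ≡⟨ ⊖-coeff (durfee 0) _ 1 ⟩
  durfee 0 1 - crankSeries (suc (suc zero)) 1
    ≡⟨ cong₂ _-_ (C-coeff (suc zero) 0) (C-coeff (suc (suc zero)) 0) ⟨
  1ℤ                                                           ∎)
  where open ≡-Reasoning
C-coeff zero (suc n) = begin
  + (# (λ y → 0ℤ ℤ.<? crank y) of partitions (2 ℕ.+ n))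
    ≡⟨ gf-filter-filter descending? (λ y → 0ℤ ℤ.<? crank y) (2 ℕ.+ n) positive? to from ⟩
  gf positive? (2 ℕ.+ n)
    ≡⟨ i≡j+k⇒k≡i-j (trans (at trichotomy (2 ℕ.+ n)) (⊕-coeff _ _ (2 ℕ.+ n))) ⟩
  gf nonnegative? (2 ℕ.+ n) - gf zero? (2 ℕ.+ n)
    ≡⟨ cong₂ _-_ (at nonnegativeCrank-gf (2 ℕ.+ n)) (trans (zeroCrank-coeff (2 ℕ.+ n))
         (trans (cong (ℤ._+_ (crankSeries (suc (suc zero)) (2 ℕ.+ n))) (X1-≥2 n)) (ℤ.+-identityʳ _))) ⟩
  durfee 0 (2 ℕ.+ n) - crankSeries (suc (suc zero)) (2 ℕ.+ n)
    ≡⟨ ⊖-coeff (durfee 0) _ (2 ℕ.+ n) ⟨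
  crankSeries zero (2 ℕ.+ n) ∎
  where
  open ≡-Reasoning
  i≡j+k⇒k≡i-j : ∀ {i j k} → i ≡ j ℤ.+ k → k ≡ i - j
  i≡j+k⇒k≡i-j {j = j} {k} refl = lemma j k
    where
    lemma : ∀ j k → k ≡ j ℤ.+ k - j
    lemma = ℤ-solve-∀

  to : ∀ {y} → IsComposition (2 ℕ.+ n) y → Descending y → 0ℤ ℤ.< crank y → Descending y × ω y ℕ.< μ y
  to {y} c desc c>0 = desc , ℕ.≤∧≢⇒< (crank≥0⇒ y (ℤ.<⇒≤ c>0))
    λ ω≡μ → ℤ.<-irrefl (sym (crank≡0⇐ (positive c) (sym ω≡μ))) c>0

  from : ∀ {y} → IsComposition (2 ℕ.+ n) y → Descending y × ω y ℕ.< μ y → Descending y × 0ℤ ℤ.< crank y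
  from {y} c (desc , ω<μ) = desc , ℤ.≤∧≢⇒< (crank≥0⇐ y (ℕ.<⇒≤ ω<μ))
    λ 0≡c → ℕ.<-irrefl (sym (crank≡0⇒ (positive c) (sym 0≡c))) ω<μ

-- The numbers u_m as coefficients

unimodalSeries : Fin 3 → Series
unimodalSeries zero             = peaks 0 ⊖ peaks 1
unimodalSeries (suc zero)       = peaks 0
unimodalSeries (suc (suc zero)) = peaks 1

u-suc-coeff : ∀ m n → + u (suc m) (+ n) ≡ peaks m n
u-suc-coeff m n = begin
  + (# maxAppears? (suc m) of unimodalCompositions (n ℕ.+ suc m))
    ≡⟨ gf-filter-filter unimodal? (maxAppears? (suc m)) (n ℕ.+ suc m) (peakFrom? (ℕ._≟ suc m) 1)
         (λ {y} c uni max → uni , positive c , trans (peakMultiplicity≡ y) max)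
         (λ {y} c (uni , _ , max) → uni , trans (sym (peakMultiplicity≡ y)) max) ⟩
  gf (peakFrom? (ℕ._≟ suc m) 1) (n ℕ.+ suc m)
    ≡⟨ at (peaks-gf m) (n ℕ.+ suc m) ⟩
  (X (suc m) ⊛ peaks m) (n ℕ.+ suc m)
    ≡⟨ cong (X (suc m) ⊛ peaks m) (ℕ.+-comm n (suc m)) ⟩
  (X (suc m) ⊛ peaks m) (suc m ℕ.+ n)
    ≡⟨ X-coeff-+ (suc m) (peaks m) n ⟩
  peaks m n ∎
  where open ≡-Reasoning

u-coeff : ∀ m n → + u (toℕ m) (+ n) ≡ unimodalSeries m n
-- The empty composition has no peak position, in accordance with u_0(0) = 0.
u-coeff zero zero = trans
  (sym (gf-enumerate (peakFrom? anyPeak? 1) 0 [] [] (λ ())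
    λ { {[]} _ (() , _) ; {zero ∷ _} (composition (() ∷ _) _) _ }))
  (at unimodal-gf 0)
u-coeff zero (suc n) = trans
  (sym (gf-enumerate (peakFrom? anyPeak? 1) (suc n) (unimodalCompositions (suc n))
    (Unique.filter⁺ unimodal? (compositions-unique (suc n)))
    (λ y∈ → let y∈comps , uni = ∈-filter⁻ unimodal? {xs = compositions (suc n)} y∈
                c = compositions-sound (suc n) y∈comps
            in c , uni , positive c , tt)
    (λ c (uni , _) → ∈-filter⁺ unimodal? (compositions-complete (suc n) c) uni)))
  (at unimodal-gf (suc n))
u-coeff (suc zero)       n = u-suc-coeff 0 n
u-coeff (suc (suc zero)) n = u-suc-coeff 1 n

u-shift : ∀ m n p → + u (toℕ m) (+ n - + p) ≡ (X p ⊛ unimodalSeries m) n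
u-shift m n p with n ℕ.<? p
... | yes n<p = trans (cong (λ i → + u (toℕ m) i) n-p≡)
    (trans (u-negative m {p ℕ.∸ suc n}) (sym (X-coeff-< p (unimodalSeries m) n<p)))
  where
  n-p≡ : + n - + p ≡ -[1+ p ℕ.∸ suc n ]
  n-p≡ = begin
    + n - + p                      ≡⟨ ℤ.m-n≡m⊖n n p ⟩
    n ℤ.⊖ p                        ≡⟨ ℤ.⊖-< n<p ⟩
    ℤ.- + (p ℕ.∸ n)                ≡⟨ cong (λ i → ℤ.- + i) (ℕ.+-∸-assoc 1 n<p) ⟩
    -[1+ p ℕ.∸ suc n ]             ∎
    where open ≡-Reasoning
  u-negative : ∀ (m : Fin 3) {i} → + u (toℕ m) -[1+ i ] ≡ 0ℤ
  u-negative zero    = refl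
  u-negative (suc _) = refl
... | no n≮p = begin
    + u (toℕ m) (+ n - + p)
      ≡⟨ cong (λ i → + u (toℕ m) i) (trans (ℤ.m-n≡m⊖n n p) (ℤ.⊖-≥ p≤n)) ⟩
    + u (toℕ m) (+ (n ℕ.∸ p))                    ≡⟨ u-coeff m (n ℕ.∸ p) ⟩
    unimodalSeries m (n ℕ.∸ p)                   ≡⟨ X-coeff-+ p (unimodalSeries m) (n ℕ.∸ p) ⟨
    (X p ⊛ unimodalSeries m) (p ℕ.+ (n ℕ.∸ p))
      ≡⟨ cong (X p ⊛ unimodalSeries m) (ℕ.m+[n∸m]≡n p≤n) ⟩
    (X p ⊛ unimodalSeries m) n                   ∎
  where
  open ≡-Reasoning
  p≤n = ℕ.≮⇒≥ n≮p

-- Pentagonal numbers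

pent : ℕ → ℕ
pent zero    = 0
pent (suc k) = 1 ℕ.+ 3 ℕ.* k ℕ.+ pent k

private
  2pent : ∀ k → + (pent k ℕ.* 2) ≡ + k * (+ 3 * + k - 1ℤ)
  2pent zero    = refl
  2pent (suc k) = begin
    + ((1 ℕ.+ 3 ℕ.* k ℕ.+ pent k) ℕ.* 2)
      ≡⟨ cong +_ (rearrange k (pent k)) ⟩
    + (6 ℕ.* k ℕ.+ 2 ℕ.+ pent k ℕ.* 2)
      ≡⟨ trans (ℤ.pos-+ (6 ℕ.* k ℕ.+ 2) (pent k ℕ.* 2))
           (cong (ℤ._+ + (pent k ℕ.* 2)) (trans (ℤ.pos-+ (6 ℕ.* k) 2) (cong (ℤ._+ + 2) (ℤ.pos-* 6 k)))) ⟩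
    + 6 * + k ℤ.+ + 2 ℤ.+ + (pent k ℕ.* 2)
      ≡⟨ cong (ℤ._+_ (+ 6 * + k ℤ.+ + 2)) (2pent k) ⟩
    + 6 * + k ℤ.+ + 2 ℤ.+ + k * (+ 3 * + k - 1ℤ)
      ≡⟨ expand (+ k) ⟩
    (1ℤ ℤ.+ + k) * (+ 3 * (1ℤ ℤ.+ + k) - 1ℤ)
      ∎
    where
    open ≡-Reasoning
    rearrange : ∀ k p → (1 ℕ.+ 3 ℕ.* k ℕ.+ p) ℕ.* 2 ≡ 6 ℕ.* k ℕ.+ 2 ℕ.+ p ℕ.* 2
    rearrange = ℕ-solve-∀
    expand : ∀ i → + 6 * i ℤ.+ + 2 ℤ.+ i * (+ 3 * i - 1ℤ) ≡ (1ℤ ℤ.+ i) * (+ 3 * (1ℤ ℤ.+ i) - 1ℤ)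
    expand = ℤ-solve-∀

pentagonal-+ : ∀ k → pentagonal (+ k) ≡ + pent k
pentagonal-+ k = trans (cong (ℤ._/ℕ 2) (sym (2pent k))) (cong +_ (m*n/n≡m (pent k) 2))

pentagonal-neg : ∀ k → pentagonal (ℤ.- + k) ≡ + (pent k ℕ.+ k)
pentagonal-neg k = trans (cong (ℤ._/ℕ 2) (sym double)) (cong +_ (m*n/n≡m (pent k ℕ.+ k) 2))
  where
  open ≡-Reasoning
  double : + ((pent k ℕ.+ k) ℕ.* 2) ≡ ℤ.- + k * (+ 3 * ℤ.- + k - 1ℤ)
  double = begin
    + ((pent k ℕ.+ k) ℕ.* 2)                    ≡⟨ cong +_ (ℕ.*-distribʳ-+ 2 (pent k) k) ⟩
    + (pent k ℕ.* 2 ℕ.+ k ℕ.* 2)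
      ≡⟨ trans (ℤ.pos-+ (pent k ℕ.* 2) (k ℕ.* 2)) (cong₂ ℤ._+_ (2pent k) (ℤ.pos-* k 2)) ⟩
    + k * (+ 3 * + k - 1ℤ) ℤ.+ + k * + 2        ≡⟨ flip-sign (+ k) ⟩
    ℤ.- + k * (+ 3 * ℤ.- + k - 1ℤ)              ∎
    where
    flip-sign : ∀ i → i * (+ 3 * i - 1ℤ) ℤ.+ i * + 2 ≡ ℤ.- i * (+ 3 * ℤ.- i - 1ℤ)
    flip-sign = ℤ-solve-∀

sumTo : ℕ → (ℕ → ℤ) → ℤ
sumTo zero    f = 0ℤ
sumTo (suc n) f = f 0 ℤ.+ sumTo n (f ∘ suc)

sumTo-last : ∀ n f → sumTo (suc n) f ≡ sumTo n f ℤ.+ f n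
sumTo-last zero    f = ℤ.+-comm (f 0) 0ℤ
sumTo-last (suc n) f = trans (cong (ℤ._+_ (f 0)) (sumTo-last n (f ∘ suc)))
  (sym (ℤ.+-assoc (f 0) (sumTo n (f ∘ suc)) (f (suc n))))

sumTo-cong : ∀ n {f g} → (∀ i → f i ≡ g i) → sumTo n f ≡ sumTo n g
sumTo-cong zero    p = refl
sumTo-cong (suc n) p = cong₂ ℤ._+_ (p 0) (sumTo-cong n (p ∘ suc))

∑±≡sumTo : ∀ k f → ∑± k f ≡ sumTo (suc (2 ℕ.* k)) (λ i → f (+ i - + k))
∑±≡sumTo k f = go (suc (2 ℕ.* k)) id
  where
  go : ∀ n h → foldr ℤ._+_ 0ℤ (map (λ i → f (+ i - + k)) (applyUpTo h n)) ≡ sumTo n (λ i → f (+ h i - + k))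
  go zero    h = refl
  go (suc n) h = cong (ℤ._+_ (f (+ h 0 - + k))) (go n (h ∘ suc))

-- The index range grows by one term at each end, which shifts the positions of the old terms by
-- one.
∑±-suc : ∀ k f → ∑± (suc k) f ≡ ∑± k f ℤ.+ (f (+ suc k) ℤ.+ f (ℤ.- + suc k))
∑±-suc k f = begin
  ∑± (suc k) f
    ≡⟨ ∑±≡sumTo (suc k) f ⟩
  sumTo (suc (2 ℕ.* suc k)) g
    ≡⟨ cong (λ n → sumTo (suc n) g) (ℕ.*-suc 2 k) ⟩
  g 0 ℤ.+ sumTo (2 ℕ.+ 2 ℕ.* k) (g ∘ suc)
    ≡⟨ cong (ℤ._+_ (g 0)) (sumTo-last (suc (2 ℕ.* k)) (g ∘ suc)) ⟩
  g 0 ℤ.+ (sumTo (suc (2 ℕ.* k)) (g ∘ suc) ℤ.+ g (2 ℕ.+ 2 ℕ.* k))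
    ≡⟨ cong₂ ℤ._+_ (cong f (ℤ.+-identityˡ (ℤ.- + suc k))) (cong₂ ℤ._+_
         (trans (sumTo-cong (suc (2 ℕ.* k)) λ i → cong f (shift (+ i) (+ k))) (sym (∑±≡sumTo k f)))
         (cong f last)) ⟩
  f (ℤ.- + suc k) ℤ.+ (∑± k f ℤ.+ f (+ suc k))
    ≡⟨ rotate (f (ℤ.- + suc k)) (∑± k f) (f (+ suc k)) ⟩
  ∑± k f ℤ.+ (f (+ suc k) ℤ.+ f (ℤ.- + suc k)) ∎
  where
  open ≡-Reasoning
  g : ℕ → ℤ
  g i = f (+ i - + suc k)
  shift : ∀ i j → 1ℤ ℤ.+ i - (1ℤ ℤ.+ j) ≡ i - j
  shift = ℤ-solve-∀
  rotate : ∀ a b c → a ℤ.+ (b ℤ.+ c) ≡ b ℤ.+ (c ℤ.+ a)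
  rotate = ℤ-solve-∀
  double : ∀ j → 1ℤ ℤ.+ 1ℤ ℤ.+ + 2 * j - (1ℤ ℤ.+ j) ≡ 1ℤ ℤ.+ j
  double = ℤ-solve-∀
  last : + (2 ℕ.+ 2 ℕ.* k) - + suc k ≡ + suc k
  last = trans (cong (λ i → + 2 ℤ.+ i - + suc k) (ℤ.pos-* 2 k)) (double (+ k))

-- The truncated pentagonal series and its remainder

sign : ℕ → ℤ
sign k = -1ℤ ^ k

truncatedEuler : ℕ → Series
truncatedEuler zero    = 𝟙
truncatedEuler (suc k) =
  truncatedEuler k ⊕ constant (sign (suc k)) ⊛ (X (pent (suc k)) ⊕ X (pent (suc k) ℕ.+ suc k))

∑±-u : ∀ m n k → ∑± k (λ j → -1ℤ ^ ∣ j ∣ * + u (toℕ m) (+ n - pentagonal j)) ≡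
       (truncatedEuler k ⊛ unimodalSeries m) n
∑±-u m n zero = begin
  1ℤ * + u (toℕ m) (+ n - 0ℤ) ℤ.+ 0ℤ     ≡⟨ trans (ℤ.+-identityʳ _) (ℤ.*-identityˡ _) ⟩
  + u (toℕ m) (+ n - 0ℤ)                 ≡⟨ u-shift m n 0 ⟩
  (X 0 ⊛ unimodalSeries m) n             ≡⟨ at (⊛-congʳ (unimodalSeries m) X0) n ⟩
  (𝟙 ⊛ unimodalSeries m) n               ∎
  where open ≡-Reasoning
∑±-u m n (suc k) = begin
  ∑± (suc k) f
    ≡⟨ ∑±-suc k f ⟩
  ∑± k f ℤ.+ (f (+ suc k) ℤ.+ f (ℤ.- + suc k))
    ≡⟨ cong₂ ℤ._+_ (∑±-u m n k) (cong₂ ℤ._+_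
         (cong (s *_) (trans (cong (λ p → + u (toℕ m) (+ n - p)) (pentagonal-+ (suc k))) (u-shift m n p₁)))
         (cong (s *_) (trans (cong (λ p → + u (toℕ m) (+ n - p)) (pentagonal-neg (suc k))) (u-shift m n p₂)))) ⟩
  (truncatedEuler k ⊛ U) n ℤ.+ (s * (X p₁ ⊛ U) n ℤ.+ s * (X p₂ ⊛ U) n)
    ≡⟨ cong (ℤ._+_ ((truncatedEuler k ⊛ U) n))
         (cong₂ ℤ._+_ (constant-⊛ s (X p₁ ⊛ U) n) (constant-⊛ s (X p₂ ⊛ U) n)) ⟨
  (truncatedEuler k ⊛ U) n ℤ.+ ((constant s ⊛ (X p₁ ⊛ U)) n ℤ.+ (constant s ⊛ (X p₂ ⊛ U)) n)
    ≡⟨ cong (ℤ._+_ ((truncatedEuler k ⊛ U) n)) (⊕-coeff (constant s ⊛ (X p₁ ⊛ U)) (constant s ⊛ (X p₂ ⊛ U)) n) ⟨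
  (truncatedEuler k ⊛ U) n ℤ.+ (constant s ⊛ (X p₁ ⊛ U) ⊕ constant s ⊛ (X p₂ ⊛ U)) n
    ≡⟨ ⊕-coeff (truncatedEuler k ⊛ U) (constant s ⊛ (X p₁ ⊛ U) ⊕ constant s ⊛ (X p₂ ⊛ U)) n ⟨
  (truncatedEuler k ⊛ U ⊕ (constant s ⊛ (X p₁ ⊛ U) ⊕ constant s ⊛ (X p₂ ⊛ U))) n
    ≡⟨ at (solve 5 (λ t c x y u → t :* u :+ (c :* (x :* u) :+ c :* (y :* u)) := (t :+ c :* (x :+ y)) :* u) ≈-refl
         (truncatedEuler k) (constant s) (X p₁) (X p₂) U) n ⟩
  (truncatedEuler (suc k) ⊛ U) n ∎
  where
  open ≡-Reasoning
  f : ℤ → ℤ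
  f j = -1ℤ ^ ∣ j ∣ * + u (toℕ m) (+ n - pentagonal j)
  U = unimodalSeries m
  s = sign (suc k)
  p₁ = pent (suc k)
  p₂ = pent (suc k) ℕ.+ suc k

-- The base case is the definition of `eulerProduct`. In the step, the summands 1 + q^{k+1} of
-- `pentagonalTail-step` are the new terms j = k + 1 and j = -(k + 1), and the exponent 3k + 4 of
-- its last summand is the gap to the next pentagonal number.
eulerProduct⊖truncatedEuler : ∀ k → eulerProduct ⊖ truncatedEuler k ≈
  constant (sign (suc k)) ⊛ (X (pent (suc k)) ⊛ pentagonalTail k)
eulerProduct⊖truncatedEuler zero =
  solve 2 (λ x v → con 1ℤ :- x :* v :- con 1ℤ := con -1ℤ :* (x :* v)) ≈-refl
       (X 1) (pentagonalTail 0)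
eulerProduct⊖truncatedEuler (suc k) = begin
  eulerProduct ⊖ (truncatedEuler k ⊕ c ⊛ (x ⊕ X (pent (suc k) ℕ.+ suc k)))
    ≈⟨ ⊖-cong ≈-refl (⊕-cong ≈-refl (⊛-congˡ c (⊕-cong ≈-refl (X-+ (pent (suc k)) (suc k))))) ⟩
  eulerProduct ⊖ (truncatedEuler k ⊕ c ⊛ (x ⊕ x ⊛ z))
    ≈⟨ solve 5 (λ e t c x z → e :- (t :+ c :* (x :+ x :* z)) := e :- t :- c :* (x :+ x :* z)) ≈-refl
         eulerProduct (truncatedEuler k) c x z ⟩
  eulerProduct ⊖ truncatedEuler k ⊖ c ⊛ (x ⊕ x ⊛ z)
    ≈⟨ ⊖-cong (≈-trans (eulerProduct⊖truncatedEuler k) (⊛-congˡ c (⊛-congˡ x (pentagonalTail-step k)))) ≈-refl ⟩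
  c ⊛ (x ⊛ (𝟙 ⊕ z ⊖ z ⊛ z ⊛ y ⊛ V)) ⊖ c ⊛ (x ⊕ x ⊛ z)
    ≈⟨ solve 5 (λ c x z y v → c :* (x :* (con 1ℤ :+ z :- z :* z :* y :* v)) :- c :* (x :+ x :* z) :=
         con -1ℤ :* c :* (z :* z :* y :* x :* v)) ≈-refl c x z y V ⟩
  constant -1ℤ ⊛ c ⊛ (z ⊛ z ⊛ y ⊛ x ⊛ V)
    ≈⟨ ⊛-cong (≈-sym (constant-* -1ℤ (sign (suc k)))) (⊛-congʳ V exponent) ⟩
  constant (sign (2 ℕ.+ k)) ⊛ (X (pent (2 ℕ.+ k)) ⊛ V) ∎
  where
  open ≈-Reasoning
  c = constant (sign (suc k))
  x = X (pent (suc k))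
  z = X (suc k)
  y = X (2 ℕ.+ k)
  V = pentagonalTail (suc k)
  exponent : z ⊛ z ⊛ y ⊛ x ≈ X (pent (2 ℕ.+ k))
  exponent = begin
    z ⊛ z ⊛ y ⊛ x
      ≈⟨ ⊛-congʳ x (≈-trans (⊛-congʳ y (≈-sym (X-+ (suc k) (suc k)))) (≈-sym (X-+ (suc k ℕ.+ suc k) (2 ℕ.+ k)))) ⟩
    X (suc k ℕ.+ suc k ℕ.+ (2 ℕ.+ k)) ⊛ x
      ≈⟨ X-+ _ (pent (suc k)) ⟨
    X (suc k ℕ.+ suc k ℕ.+ (2 ℕ.+ k) ℕ.+ pent (suc k))
      ≈⟨ X-cong (cong (ℕ._+ pent (suc k)) (collect k)) ⟩
    X (pent (2 ℕ.+ k)) ∎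
    where
    collect : ∀ k → suc k ℕ.+ suc k ℕ.+ (2 ℕ.+ k) ≡ 1 ℕ.+ 3 ℕ.* suc k
    collect = ℕ-solve-∀

-- Comparison of the two families and the sign of the remainder

unimodalSeries≈ : ∀ m → unimodalSeries m ≈ invPoch∞ 0 ⊛ crankSeries m
unimodalSeries≈ (suc zero)       = peaks≈invPoch∞⊛durfee 0
-- The product belonging to A_2 starts at q². Completing it to (q)_∞ costs the factor 1 - q, the
-- same one that occurs in the series of C_2.
unimodalSeries≈ (suc (suc zero)) = begin
  peaks 1                                       ≈⟨ peaks≈invPoch∞⊛durfee 1 ⟩
  invPoch∞ 1 ⊛ durfee 1                         ≈⟨ ⊛-congʳ (durfee 1) (invPoch∞-suc 0) ⟨
  (𝟙 ⊖ X 1) ⊛ invPoch∞ 0 ⊛ durfee 1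
    ≈⟨ solve 3 (λ x e d → x :* e :* d := e :* (x :* d)) ≈-refl (𝟙 ⊖ X 1) (invPoch∞ 0) (durfee 1) ⟩
  invPoch∞ 0 ⊛ ((𝟙 ⊖ X 1) ⊛ durfee 1)           ∎
  where open ≈-Reasoning
unimodalSeries≈ zero = ≈-trans (⊖-cong (unimodalSeries≈ (suc zero)) (unimodalSeries≈ (suc (suc zero))))
  (solve 3 (λ e a b → e :* a :- e :* b := e :* (a :- b)) ≈-refl
       (invPoch∞ 0) (durfee 0) ((𝟙 ⊖ X 1) ⊛ durfee 1))

eulerProduct⊛unimodalSeries : ∀ m → eulerProduct ⊛ unimodalSeries m ≈ crankSeries m
eulerProduct⊛unimodalSeries m = begin
  eulerProduct ⊛ unimodalSeries m              ≈⟨ ⊛-congˡ eulerProduct (unimodalSeries≈ m) ⟩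
  eulerProduct ⊛ (invPoch∞ 0 ⊛ crankSeries m)
    ≈⟨ ⊛-assoc eulerProduct (invPoch∞ 0) (crankSeries m) ⟨
  eulerProduct ⊛ invPoch∞ 0 ⊛ crankSeries m    ≈⟨ ⊛-congʳ (crankSeries m) eulerProduct-inverse ⟩
  𝟙 ⊛ crankSeries m                            ≈⟨ ⊛-identityˡ (crankSeries m) ⟩
  crankSeries m                                ∎
  where open ≈-Reasoning

-- Regrouped as (F_1 - F_2) + q F_2: the difference puts 1 - q^{i+1} on each term, where it cancels
-- a factor of the denominator.
positiveCrank-nonnegative : Nonnegative (crankSeries zero)
positiveCrank-nonnegative = nonnegative-cong (≈-sym expand)
  (⊕-nonnegative
    (⊛-nonnegative (X-nonnegative 1) (dilate-nonnegative 0 λ i →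
      ⊛-nonnegative (X-nonnegative (suc i ℕ.* suc i))
      (⊛-nonnegative (invPoch-nonnegative i) (invPoch-nonnegative (suc i)))))
    (⊛-nonnegative (X-nonnegative 1) (durfee-nonnegative 1)))
  where
  open ≈-Reasoning
  L : ℕ → Series
  L i = X (suc i ℕ.* suc i) ⊛ (invPoch i ⊛ invPoch (suc i))

  term : ∀ i → (𝟙 ⊖ X (suc i)) ⊛ durfeeTerm (suc i) ≈ L i
  term i = ≈-trans
    (solve 3 (λ x s I → (con 1ℤ :- x) :* (s :* (I :* I)) := s :* ((con 1ℤ :- x) :* I :* I)) ≈-refl
      (X (suc i)) (X (suc i ℕ.* suc i)) (invPoch (suc i)))
    (⊛-congˡ (X (suc i ℕ.* suc i)) (⊛-congʳ (invPoch (suc i)) (invPoch-suc i)))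

  expand : durfee 0 ⊖ (𝟙 ⊖ X 1) ⊛ durfee 1 ≈ X 1 ⊛ dilate L 0 ⊕ X 1 ⊛ durfee 1
  expand = begin
    durfee 0 ⊖ (𝟙 ⊖ X 1) ⊛ durfee 1
      ≈⟨ solve 3 (λ a x b → a :- (con 1ℤ :- x) :* b := a :- b :+ x :* b) ≈-refl
           (durfee 0) (X 1) (durfee 1) ⟩
    durfee 0 ⊖ durfee 1 ⊕ X 1 ⊛ durfee 1
      ≈⟨ ⊕-cong (≈-trans (dilate-Δ durfeeTerm 0) (⊛-congˡ (X 1) (dilate-cong 0 term))) ≈-refl ⟩
    X 1 ⊛ dilate L 0 ⊕ X 1 ⊛ durfee 1 ∎

pentagonalTail⊛unimodalSeries-nonnegative : ∀ k m → Nonnegative (pentagonalTail (suc k) ⊛ unimodalSeries m)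
pentagonalTail⊛unimodalSeries-nonnegative k m = nonnegative-cong (≈-sym regroup) (nonneg m)
  where
  V = pentagonalTail (suc k)
  regroup : V ⊛ unimodalSeries m ≈ V ⊛ invPoch∞ 0 ⊛ crankSeries m
  regroup = ≈-trans (⊛-congˡ V (unimodalSeries≈ m)) (≈-sym (⊛-assoc V (invPoch∞ 0) (crankSeries m)))

  nonneg : ∀ m → Nonnegative (V ⊛ invPoch∞ 0 ⊛ crankSeries m)
  nonneg zero             = ⊛-nonnegative (pentagonalTail⊛invPoch∞-nonnegative (suc k)) positiveCrank-nonnegative
  nonneg (suc zero)       = ⊛-nonnegative (pentagonalTail⊛invPoch∞-nonnegative (suc k)) (durfee-nonnegative 0)
  -- The crank series has a negative coefficient here, so its factor 1 - q is handed over to the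
  -- tail.
  nonneg (suc (suc zero)) = nonnegative-cong
    (solve 3 (λ x v d → x :* v :* d := v :* (x :* d)) ≈-refl (𝟙 ⊖ X 1) (V ⊛ invPoch∞ 0) (durfee 1))
    (⊛-nonnegative ([1-q]pentagonalTail⊛invPoch∞-nonnegative k) (durfee-nonnegative 1))

sign-* : ∀ k → sign k * sign (2 ℕ.+ k) ≡ 1ℤ
sign-* zero    = refl
sign-* (suc k) = trans (cancel (sign k) (sign (2 ℕ.+ k))) (sign-* k)
  where
  cancel : ∀ s t → -1ℤ * s * (-1ℤ * t) ≡ s * t
  cancel = ℤ-solve-∀

corollary1p5 : (k n : ℕ) → k ℕ.≥ 1 → n ℕ.≥ 1 → (m : Fin 3) →
    -1ℤ ^ (k ℕ.∸ 1) *
    (C m n - ∑± k (λ j → -1ℤ ^ ∣ j ∣ * + u (toℕ m) (+ n - pentagonal j)))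
    ≥ 0ℤ
corollary1p5 (suc k) (suc n) _ _ m = subst (0ℤ ℤ.≤_) (sym value)
  (⊛-nonnegative (X-nonnegative (pent (2 ℕ.+ k))) (pentagonalTail⊛unimodalSeries-nonnegative k m) (suc n))
  where
  open ≡-Reasoning
  U = unimodalSeries m
  W = X (pent (2 ℕ.+ k)) ⊛ (pentagonalTail (suc k) ⊛ U)

  remainder : crankSeries m ⊖ truncatedEuler (suc k) ⊛ U ≈ constant (sign (2 ℕ.+ k)) ⊛ W
  remainder = ≈-trans (⊖-cong (≈-sym (eulerProduct⊛unimodalSeries m)) ≈-refl) (≈-trans
    (solve 3 (λ e t u → e :* u :- t :* u := (e :- t) :* u) ≈-refl
         eulerProduct (truncatedEuler (suc k)) U)
    (≈-trans (⊛-congʳ U (eulerProduct⊖truncatedEuler (suc k)))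
      (solve 4 (λ c x v u → c :* (x :* v) :* u := c :* (x :* (v :* u))) ≈-refl _ _ _ U)))

  summand : ℤ → ℤ
  summand j = -1ℤ ^ ∣ j ∣ * + u (toℕ m) (+ suc n - pentagonal j)

  -- With k + 1 in place of k, the outer sign is (-1)^k and that of the remainder is (-1)^{k+2}, so
  -- they cancel.
  value : sign k * (C m (suc n) - ∑± (suc k) summand) ≡ W (suc n)
  value = begin
    sign k * (C m (suc n) - ∑± (suc k) summand)
      ≡⟨ cong (sign k *_) (cong₂ _-_ (C-coeff m n) (∑±-u m (suc n) (suc k))) ⟩
    sign k * (crankSeries m (suc n) - (truncatedEuler (suc k) ⊛ U) (suc n))
      ≡⟨ cong (sign k *_) (⊖-coeff (crankSeries m) (truncatedEuler (suc k) ⊛ U) (suc n)) ⟨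
    sign k * (crankSeries m ⊖ truncatedEuler (suc k) ⊛ U) (suc n)
      ≡⟨ cong (sign k *_) (trans (at remainder (suc n)) (constant-⊛ (sign (2 ℕ.+ k)) W (suc n))) ⟩
    sign k * (sign (2 ℕ.+ k) * W (suc n))
      ≡⟨ ℤ.*-assoc (sign k) (sign (2 ℕ.+ k)) (W (suc n)) ⟨
    sign k * sign (2 ℕ.+ k) * W (suc n)
      ≡⟨ cong (_* W (suc n)) (sign-* k) ⟩
    1ℤ * W (suc n)
      ≡⟨ ℤ.*-identityˡ (W (suc n)) ⟩
    W (suc n) ∎
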